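{- Let $G$ be a simple connected unicyclic graph with $n$ vertices that is not the cycle $C_n$. Then $G$ has exactly two main signless Laplacian eigenvalues if and only if $G$ is isomorphic to $G_1$ or to $G_2$, where: $G_1$ is the graph obtained from a cycle of length $r\geq 3$ by attaching $k\geq 1$ pendant vertices to each vertex of the cycle (so $n=(k+1)r$); and $G_2$ is the graph obtained from a cycle $u_1u_2\cdots u_{3t}u_1$ ($t\geq 1$) by attaching one pendant vertex to each of the vertices $u_{3s+1}$, $s=0,1,\dots,t-1$ (so $n=4t$).
   Context: For a graph $G$ with adjacency matrix $A$ and diagonal degree matrix $D$, the signless Laplacian is $Q=D+A$; an eigenvalue of $Q$ is a main signless Laplacian eigenvalue if it has an eigenvector whose entries do not sum to zero. A unicyclic graph is a connected graph with exactly one cycle. Attaching a pendant vertex to $v$ means adding a new vertex adjacent only to $v$. -}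

module Defs where

open import Level using (0ℓ)
open import Data.Bool using (Bool; true; false; _∧_; _∨_; if_then_else_; T)
open import Data.Nat as ℕ using (ℕ; zero; suc; _≡ᵇ_; _∸_)
open import Data.Fin as Fin using (Fin; toℕ; remQuot; splitAt; inject₁; fromℕ)
open import Data.Fin.Properties using (_≟_)
open import Data.Product using (Σ; ∃; ∃₂; _×_; _,_)
open import Data.Sum using (_⊎_; inj₁; inj₂)
open import Relation.Nullary using (¬_; does)
open import Relation.Binary.PropositionalEquality using (_≡_)
open import Relation.Binary.Structures using (IsTotalOrder)
open import Algebra.Structures using (IsCommutativeRing)
open import Function.Bundles using (_⤖_; _⇔_; Bijection)
open import Function.Definitions using (Injective)

-- The real numbers, axiomatised as a complete ordered field
-- (characterises ℝ up to isomorphism).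

record RealField : Set₁ where
  field
    Carrier : Set
    _+_ _*_ : Carrier → Carrier → Carrier
    -_      : Carrier → Carrier
    0# 1#   : Carrier
    _≤_     : Carrier → Carrier → Set
    isCommutativeRing : IsCommutativeRing _≡_ _+_ _*_ -_ 0# 1#
    0≢1      : ¬ (0# ≡ 1#)
    inverse  : ∀ x → ¬ (x ≡ 0#) → ∃ λ y → (x * y) ≡ 1#
    isTotalOrder : IsTotalOrder _≡_ _≤_
    +-mono-≤ : ∀ x y z → x ≤ y → (x + z) ≤ (y + z)
    *-nonneg : ∀ x y → 0# ≤ x → 0# ≤ y → 0# ≤ (x * y)
    complete : (P : Carrier → Set) → ∃ P → (∃ λ b → ∀ x → P x → x ≤ b) →
               ∃ λ s → (∀ x → P x → x ≤ s) × (∀ b → (∀ x → P x → x ≤ b) → s ≤ b)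

  natR : ℕ → Carrier
  natR zero    = 0#
  natR (suc m) = 1# + natR m

  Σ[_] : ∀ {n} → (Fin n → Carrier) → Carrier
  Σ[_] {zero}  f = 0#
  Σ[_] {suc n} f = f Fin.zero + Σ[_] (λ i → f (Fin.suc i))

Graph : ℕ → Set
Graph n = Fin n → Fin n → Bool

countTrue : ∀ {n} → (Fin n → Bool) → ℕ
countTrue {zero}  f = 0
countTrue {suc n} f = (if f Fin.zero then 1 else 0) ℕ.+ countTrue (λ i → f (Fin.suc i))

_==_ : ∀ {n} → Fin n → Fin n → Bool
i == j = does (i ≟ j)

record IsSimple {n} (G : Graph n) : Set where
  field
    symmetric   : ∀ u v → G u v ≡ G v u
    irreflexive : ∀ v → G v v ≡ false

data Reach {n} (G : Graph n) : Fin n → Fin n → Set where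
  here : ∀ {u} → Reach G u u
  step : ∀ {u w v} → T (G u w) → Reach G w v → Reach G u v

Connected : ∀ {n} → Graph n → Set
Connected G = ∀ u v → Reach G u v

record Cycle {n} (G : Graph n) : Set where
  field
    len   : ℕ
    vtx   : Fin (3 ℕ.+ len) → Fin n
    inj   : Injective _≡_ _≡_ vtx
    adjs  : ∀ (i : Fin (2 ℕ.+ len)) → T (G (vtx (inject₁ i)) (vtx (Fin.suc i)))
    close : T (G (vtx (fromℕ (2 ℕ.+ len))) (vtx Fin.zero))

CycleEdge : ∀ {n} {G : Graph n} → Cycle G → Fin n → Fin n → Set
CycleEdge c u v =
    (∃ λ i → (u ≡ vtx (inject₁ i) × v ≡ vtx (Fin.suc i)) ⊎ (v ≡ vtx (inject₁ i) × u ≡ vtx (Fin.suc i)))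
  ⊎ ((u ≡ vtx (fromℕ (2 ℕ.+ len)) × v ≡ vtx Fin.zero) ⊎ (v ≡ vtx (fromℕ (2 ℕ.+ len)) × u ≡ vtx Fin.zero))
  where open Cycle c

-- connected with exactly one cycle (cycles identified by their edge sets)
record Unicyclic {n} (G : Graph n) : Set where
  field
    connected : Connected G
    aCycle    : Cycle G
    unique    : ∀ (c c′ : Cycle G) → ∀ u v → CycleEdge c u v ⇔ CycleEdge c′ u v

_≅_ : ∀ {n m} → Graph n → Graph m → Set
_≅_ {n} {m} G H = Σ (Fin n ⤖ Fin m) λ f → ∀ u v → G u v ≡ H (Bijection.to f u) (Bijection.to f v)

-- adjacency of the cycle 0 - 1 - ... - (r-1) - 0 (meant for r ≥ 3)
cycAdj : ∀ r → Fin r → Fin r → Bool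
cycAdj r i j = st i j ∨ st j i ∨ wr i j ∨ wr j i
  where
    st : Fin r → Fin r → Bool
    st a b = suc (toℕ a) ≡ᵇ toℕ b
    wr : Fin r → Fin r → Bool
    wr a b = (toℕ a ≡ᵇ (r ∸ 1)) ∧ (toℕ b ≡ᵇ 0)

cycleGraph : ∀ n → Graph n
cycleGraph n = cycAdj n

-- G₁ r k: cycle of length r, k pendant vertices at every cycle vertex.
-- Vertex with remQuot = (i , 0) is cycle vertex i; (i , suc p) is the
-- p-th pendant vertex attached to i.  n = r * (k+1).
G₁ : ∀ r k → Graph (r ℕ.* suc k)
G₁ r k x y with remQuot {r} (suc k) x | remQuot {r} (suc k) y
... | i , Fin.zero  | j , Fin.zero  = cycAdj r i j
... | i , Fin.zero  | j , Fin.suc _ = i == j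
... | i , Fin.suc _ | j , Fin.zero  = i == j
... | _ , Fin.suc _ | _ , Fin.suc _ = false

-- G₂ t: cycle u₁ … u_{3t} (indices 0 … 3t-1), with one pendant vertex s
-- attached to u_{3s+1} (index 3s), s = 0 … t-1.  n = 3t + t = 4t.
G₂ : ∀ t → Graph (3 ℕ.* t ℕ.+ t)
G₂ t x y with splitAt (3 ℕ.* t) x | splitAt (3 ℕ.* t) y
... | inj₁ i | inj₁ j = cycAdj (3 ℕ.* t) i j
... | inj₁ i | inj₂ s = toℕ i ≡ᵇ (3 ℕ.* toℕ s)
... | inj₂ s | inj₁ i = toℕ i ≡ᵇ (3 ℕ.* toℕ s)
... | inj₂ _ | inj₂ _ = false

module _ (ℝ : RealField) where
  open RealField ℝ

  degree : ∀ {n} → Graph n → Fin n → ℕ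
  degree G v = countTrue (G v)

  signlessLaplacian : ∀ {n} → Graph n → Fin n → Fin n → Carrier
  signlessLaplacian G v u =
    (if v == u then natR (degree G v) else 0#) + (if G v u then 1# else 0#)

  IsMainEigenvalue : ∀ {n} → Graph n → Carrier → Set
  IsMainEigenvalue G μ =
    ∃ λ x → (∀ v → Σ[ (λ u → signlessLaplacian G v u * x u) ] ≡ μ * x v) × ¬ (Σ[ x ] ≡ 0#)

  HasExactlyTwoMainEigenvalues : ∀ {n} → Graph n → Set
  HasExactlyTwoMainEigenvalues G =
    ∃₂ λ μ₁ μ₂ → ¬ (μ₁ ≡ μ₂) × IsMainEigenvalue G μ₁ × IsMainEigenvalue G μ₂ ×
      (∀ ν → IsMainEigenvalue G ν → ν ≡ μ₁ ⊎ ν ≡ μ₂)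

{-# OPTIONS --safe #-}

-- For the all-one vector e one has Qe = 2d and Q²e = 2F, where d is the degree vector and F(v) = d(v)² + Σ d(u)
-- over the neighbours u of v.  Exactly two main eigenvalues μ₁, μ₂ means that (Q - μ₁)(Q - μ₂)e = 0, i.e. that
-- the points (d(v), F(v)) lie on a line but not all at one point: a nonzero vector w has an eigenvector not
-- orthogonal to it (maximise the Rayleigh quotient on the Krylov space of w), applied to w = (Q - μ₁)(Q - μ₂)e.
-- Let v be furthest from the cycle.  At distance at least 2, write d = q + 1 for its neighbour y and d = P + 1 for
-- the parent z of y: the line is then determined by (q, P), and its equation at z contradicts divisibility.
-- Hence the graph is a cycle with pendant vertices, of cycle degrees 2 and k + 2, and the line leaves only the
-- patterns G₁ and G₂.
module Submission where

open import Defs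
open import Data.Nat as ℕ using (ℕ; zero; suc; _≡ᵇ_)
import Data.Nat.Properties as ℕP
open import Data.Nat.DivMod
  using (_%_; _/_; _mod_; m%n<n; m<n⇒m%n≡m; m%n%n≡m%n; [m+n]%n≡m%n; [m+kn]%n≡m%n; m≡m%n+[m/n]*n; %-distribˡ-+)
open import Data.Nat.Divisibility using (_∣_; divides; ∣m+n∣m⇒∣n; m∣m*n; ∣1⇒≡1)
open import Data.Nat.Tactic.RingSolver using (solve-∀)
open import Data.Integer as ℤ using (ℤ)
import Data.Integer.Properties as ℤP
open import Data.Bool using (Bool; true; false; if_then_else_; T; not; _∨_; _∧_)
open import Data.Bool.Properties as BoolP using (T-≡; ∨-zeroʳ)
open import Data.Fin as Fin using (Fin; toℕ; inject₁; fromℕ<; remQuot; combine; splitAt)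
open import Data.Fin.Properties as FinP
  using (_≟_; any?; toℕ<n; toℕ-injective; toℕ-fromℕ<; toℕ-inject₁; toℕ-fromℕ; combine-remQuot; remQuot-combine; splitAt-join; join-splitAt; injective⇒≤)
open import Data.Fin.Permutation using (Permutation; _⟨$⟩ˡ_; inverseʳ)
open import Data.List using (List; []; _∷_; length; map; allFin)
open import Data.List.Properties using (length-tabulate; length-map)
open import Data.List.Membership.Propositional.Properties using (∈-allFin)
open import Data.List.Relation.Unary.All as All using (All; []; _∷_)
import Data.List.Relation.Unary.All.Properties as AllP
open import Data.Maybe using (Maybe; just; nothing)
open import Data.Product using (∃; ∃₂; _×_; _,_; proj₁; proj₂)
open import Data.Sum using (_⊎_; inj₁; inj₂)
open import Data.Sum.Properties using (inj₁-injective)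
open import Data.Empty using (⊥; ⊥-elim)
open import Function.Bundles using (_⇔_; mk⇔; mk⤖; Bijection; Equivalence)
open import Function.Properties.Bijection using (⤖⇒↔)
open import Relation.Nullary using (¬_; Dec; yes; no; _×-dec_; _⊎-dec_)
open import Relation.Binary.PropositionalEquality
open import Relation.Binary.Structures using (IsTotalOrder)
open import Algebra.Bundles using (CommutativeRing)
import Algebra.Properties.CommutativeMonoid.Sum
import Algebra.Properties.Ring
import Algebra.Properties.Semiring.Sum
import Algebra.Solver.Ring
import Algebra.Solver.Ring.AlmostCommutativeRing as ACR

-- Spectral theory

-- The reals are only a complete ordered field, so the eigenvector has to be constructed. The
-- supremum `s` of the Rayleigh quotient is reached without compactness: Lagrange reduction either
-- exhibits a nonzero vector on which the form of `s - Q` is not positive, or yields a constant `K`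
-- with `dot x x ≤ K * form x x`, which would leave a gap `1/K` below the supremum. The Krylov space
-- is chosen because an eigenvector in it cannot be orthogonal to `w`: it would be orthogonal to
-- every `Q^m w`, hence to itself. The contradiction at `z` runs as follows. The line gives
-- `q ∣ P²`, say `P² = j q`. If `z` is off the cycle, sizes alone exclude every `j`. If `z` is on
-- the cycle, only `j = 1` survives; then `q = P²`, the line makes every degree congruent to 1
-- modulo `P`, and the degree sum `e` of the two cycle neighbours satisfies `e + P = P² + 3`. Hence
-- 2 ≡ 3 modulo `P`, although `P ≥ 2`.

module ΣN where
  open Algebra.Properties.CommutativeMonoid.Sum ℕP.+-0-commutativeMonoid public
    using (sum; ∑-distrib-+; sum-cong-≗; sum-replicate-zero; sum-permute)
  open Algebra.Properties.Semiring.Sum ℕP.+-*-semiring public using (*-distribˡ-sum; *-distribʳ-sum)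

𝟙 : Bool → ℕ
𝟙 b = if b then 1 else 0

deg : ∀ {n} → Graph n → Fin n → ℕ
deg G v = countTrue (G v)

nbrDeg : ∀ {n} → Graph n → Fin n → ℕ
nbrDeg G v = ΣN.sum (λ u → 𝟙 (G v u) ℕ.* deg G u)

F : ∀ {n} → Graph n → Fin n → ℕ
F G v = deg G v ℕ.* deg G v ℕ.+ nbrDeg G v

countTrue≡sum : ∀ {n} (f : Fin n → Bool) → countTrue f ≡ ΣN.sum (λ i → 𝟙 (f i))
countTrue≡sum {zero} f = refl
countTrue≡sum {suc n} f = cong (𝟙 (f Fin.zero) ℕ.+_) (countTrue≡sum (λ i → f (Fin.suc i)))

-- Arithmetic and order in a complete ordered field.

module Field (ℝ : RealField) where
  open import Data.Integer using (+_; -[1+_]) public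
  open RealField ℝ public
    renaming (_+_ to infixl 6 _+_; _*_ to infixl 7 _*_; -_ to infix 8 -_; _≤_ to infix 4 _≤_)

  infixl 6 _−_

  commutativeRing : CommutativeRing _ _
  commutativeRing = record { isCommutativeRing = isCommutativeRing }

  open CommutativeRing commutativeRing public using
    ( +-comm; +-assoc; *-comm; *-assoc; +-identityˡ; +-identityʳ; *-identityˡ; *-identityʳ
    ; distribʳ; zeroˡ; zeroʳ; -‿inverseʳ; semiring; +-commutativeMonoid)
  open Algebra.Properties.Ring (CommutativeRing.ring commutativeRing) using (-‿distribˡ-*; -0#≈0#; -‿involutive)

  _−_ : Carrier → Carrier → Carrier
  x − y = x + - y

  natR-+ : ∀ m n → natR (m ℕ.+ n) ≡ natR m + natR n
  natR-+ zero n = sym (+-identityˡ _)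
  natR-+ (suc m) n = trans (cong (λ z → 1# + z) (natR-+ m n)) (sym (+-assoc _ _ _))

  natR-* : ∀ m n → natR (m ℕ.* n) ≡ natR m * natR n
  natR-* zero n = sym (zeroˡ _)
  natR-* (suc m) n = trans (natR-+ n (m ℕ.* n))
    (trans (cong₂ _+_ (sym (*-identityˡ _)) (natR-* m n)) (sym (distribʳ _ _ _)))

  private
    -- The ring solver takes its coefficients from the integers, whose equality computes. The
    -- literal `con (+ 1)` then denotes `1# + 0#`, not `1#`: hence the `natR 1` in later equations
    -- and the solver variable `o` that stands for `1#`.
    intR : ℤ → Carrier
    intR (+ n) = natR n
    intR (-[1+ n ]) = - natR (suc n)

    intR-neg : ∀ i → intR (ℤ.- i) ≡ - intR i
    intR-neg (+ zero) = sym -0#≈0#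
    intR-neg (+ suc n) = refl
    intR-neg (-[1+ n ]) = sym (-‿involutive _)

    cancel : ∀ a b → (1# + a) − (1# + b) ≡ a − b
    cancel a b = begin
      (1# + a) + - (1# + b)      ≡⟨ cong (λ z → (1# + a) + z) (sym (-‿+-comm 1# b)) ⟩
      (1# + a) + (- 1# + - b)    ≡⟨ cong (λ z → z + (- 1# + - b)) (+-comm 1# a) ⟩
      (a + 1#) + (- 1# + - b)    ≡⟨ +-assoc a 1# _ ⟩
      a + (1# + (- 1# + - b))    ≡⟨ cong (λ z → a + z) (sym (+-assoc 1# (- 1#) (- b))) ⟩
      a + ((1# + - 1#) + - b)    ≡⟨ cong (λ z → a + (z + - b)) (-‿inverseʳ 1#) ⟩
      a + (0# + - b)             ≡⟨ cong (λ z → a + z) (+-identityˡ _) ⟩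
      a + - b                    ∎
      where
      open ≡-Reasoning
      open ACR.AlmostCommutativeRing (ACR.fromCommutativeRing commutativeRing) using (-‿+-comm)

    intR-⊖ : ∀ m n → intR (m ℤ.⊖ n) ≡ natR m − natR n
    intR-⊖ m zero = trans (sym (+-identityʳ _)) (cong (λ z → natR m + z) (sym -0#≈0#))
    intR-⊖ zero (suc n) = sym (+-identityˡ _)
    intR-⊖ (suc m) (suc n) = trans (cong intR (ℤP.[1+m]⊖[1+n]≡m⊖n m n))
      (trans (intR-⊖ m n) (sym (cancel (natR m) (natR n))))

    intR-+ : ∀ i j → intR (i ℤ.+ j) ≡ intR i + intR j
    intR-+ (+ m) (+ n) = natR-+ m n
    intR-+ (+ m) (-[1+ n ]) = intR-⊖ m (suc n)
    intR-+ (-[1+ m ]) (+ n) = trans (intR-⊖ n (suc m)) (+-comm _ _)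
    intR-+ (-[1+ m ]) (-[1+ n ]) = trans
      (cong (λ k → - natR (suc k)) (sym (ℕP.+-suc m n)))
      (trans (cong -_ (natR-+ (suc m) (suc n))) (sym (-‿+-comm _ _)))
      where open ACR.AlmostCommutativeRing (ACR.fromCommutativeRing commutativeRing) using (-‿+-comm)

    intR-*⁺ : ∀ m j → intR (+ m ℤ.* j) ≡ natR m * intR j
    intR-*⁺ zero j = sym (zeroˡ _)
    intR-*⁺ (suc m) j = trans (cong intR (ℤP.suc-* (+ m) j))
      (trans (intR-+ j (+ m ℤ.* j)) (trans (cong₂ _+_ (sym (*-identityˡ _)) (intR-*⁺ m j)) (sym (distribʳ _ _ _))))

    intR-* : ∀ i j → intR (i ℤ.* j) ≡ intR i * intR j
    intR-* (+ m) j = intR-*⁺ m j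
    intR-* (-[1+ m ]) j = trans (cong intR (sym (ℤP.neg-distribˡ-* (+ suc m) j)))
      (trans (intR-neg (+ suc m ℤ.* j)) (trans (cong -_ (intR-*⁺ (suc m) j)) (-‿distribˡ-* _ _)))

    morphism : ℤ.+-*-rawRing ACR.-Raw-AlmostCommutative⟶ ACR.fromCommutativeRing commutativeRing
    morphism = record
      { ⟦_⟧ = intR ; +-homo = intR-+ ; *-homo = intR-* ; -‿homo = intR-neg
      ; 0-homo = refl ; 1-homo = +-identityʳ _ }

  private
    coeff≟ : ∀ i j → Maybe (intR i ≡ intR j)
    coeff≟ i j with i ℤP.≟ j
    ... | yes p = just (cong intR p)
    ... | no _ = nothing

  open Algebra.Solver.Ring ℤ.+-*-rawRing (ACR.fromCommutativeRing commutativeRing) morphism coeff≟ public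
    using (solve; _:=_; _:+_; _:*_; _:-_; :-_; con)

  open IsTotalOrder isTotalOrder public using (total; antisym) renaming (trans to ≤-trans; reflexive to ≤-reflexive)

  private
    inj₁≢inj₂ : ∀ {A B : Set} {a : A} {b : B} → ¬ (inj₁ a ≡ inj₂ b)
    inj₁≢inj₂ ()

  -- total is a function of its arguments, so on equal arguments it answers the same way twice.
  _≟ᴿ_ : ∀ x y → Dec (x ≡ y)
  x ≟ᴿ y with total x y in p | total y x in q
  ... | inj₁ a | inj₁ b = yes (antisym a b)
  ... | inj₂ a | inj₂ b = yes (antisym b a)
  ... | inj₁ _ | inj₂ _ = no λ { refl → inj₁≢inj₂ (trans (sym p) q) }
  ... | inj₂ _ | inj₁ _ = no λ { refl → inj₁≢inj₂ (trans (sym q) p) }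

  ≤-refl : ∀ {x} → x ≤ x
  ≤-refl = ≤-reflexive refl

  ≤⇒0≤ : ∀ {x y} → x ≤ y → 0# ≤ y − x
  ≤⇒0≤ {x} {y} p = subst (λ z → z ≤ y − x) (-‿inverseʳ x) (+-mono-≤ _ _ (- x) p)

  0≤⇒≤ : ∀ {x y e} → 0# ≤ e → e ≡ y − x → x ≤ y
  0≤⇒≤ {x} {y} {e} p refl = subst₂ _≤_ (+-identityˡ x)
    (solve 2 (λ x y → y :- x :+ x := y) refl x y) (+-mono-≤ _ _ x p)

  0≤+ : ∀ {x y} → 0# ≤ x → 0# ≤ y → 0# ≤ x + y
  0≤+ {x} {y} p q = ≤-trans q (subst (λ z → z ≤ x + y) (+-identityˡ y) (+-mono-≤ _ _ y p))

  0≤* : ∀ {x y} → 0# ≤ x → 0# ≤ y → 0# ≤ x * y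
  0≤* = *-nonneg _ _

  ≤0⇒0≤- : ∀ {x} → x ≤ 0# → 0# ≤ - x
  ≤0⇒0≤- {x} p = subst (λ z → 0# ≤ z) (+-identityˡ _) (≤⇒0≤ p)

  0≤sq : ∀ x → 0# ≤ x * x
  0≤sq x with total 0# x
  ... | inj₁ p = 0≤* p p
  ... | inj₂ p = subst (λ z → 0# ≤ z) (solve 1 (λ x → (:- x) :* (:- x) := x :* x) refl x) (0≤* (≤0⇒0≤- p) (≤0⇒0≤- p))

  0≤1 : 0# ≤ 1#
  0≤1 = subst (λ z → 0# ≤ z) (*-identityˡ 1#) (0≤sq 1#)

  0≤natR : ∀ n → 0# ≤ natR n
  0≤natR zero = ≤-refl
  0≤natR (suc n) = 0≤+ 0≤1 (0≤natR n)

  ¬1≤0 : ¬ (1# ≤ 0#)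
  ¬1≤0 p = 0≢1 (antisym 0≤1 p)

  natR-suc≢0 : ∀ n → ¬ (natR (suc n) ≡ 0#)
  natR-suc≢0 n e = ¬1≤0 (0≤⇒≤ (0≤natR n) (trans (solve 2 (λ x y → y := (x :+ y) :- x) refl 1# (natR n)) (cong (λ z → z − 1#) e)))

  natR-injective : ∀ m n → natR m ≡ natR n → m ≡ n
  natR-injective zero zero e = refl
  natR-injective zero (suc n) e = ⊥-elim (natR-suc≢0 n (sym e))
  natR-injective (suc m) zero e = ⊥-elim (natR-suc≢0 m e)
  natR-injective (suc m) (suc n) e = cong suc (natR-injective m n
    (trans (drop (natR m)) (trans (cong (λ z → z − 1#) e) (sym (drop (natR n))))))
    where
    drop : ∀ y → y ≡ (1# + y) − 1#
    drop y = solve 2 (λ x y → y := (x :+ y) :- x) refl 1# y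

  *-zero-cancel : ∀ {x y} → ¬ (x ≡ 0#) → x * y ≡ 0# → y ≡ 0#
  *-zero-cancel {x} {y} x≢0 e with inverse x x≢0
  ... | z , xz≡1 = begin
      y           ≡⟨ sym (*-identityˡ y) ⟩
      1# * y      ≡⟨ cong (λ w → w * y) (sym xz≡1) ⟩
      x * z * y   ≡⟨ solve 3 (λ x y z → x :* z :* y := z :* (x :* y)) refl x y z ⟩
      z * (x * y) ≡⟨ cong (λ w → z * w) e ⟩
      z * 0#      ≡⟨ zeroʳ z ⟩
      0#          ∎
    where open ≡-Reasoning

  ≡⇐−≡0 : ∀ {x y} → x − y ≡ 0# → x ≡ y
  ≡⇐−≡0 {x} {y} e = trans (solve 2 (λ x y → x := x :- y :+ y) refl x y) (trans (cong (λ z → z + y) e) (+-identityˡ y))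

  −≡0 : ∀ {x y} → x ≡ y → x − y ≡ 0#
  −≡0 {x} refl = -‿inverseʳ x

  sq≡0 : ∀ {x} → x * x ≡ 0# → x ≡ 0#
  sq≡0 {x} e with x ≟ᴿ 0#
  ... | yes p = p
  ... | no p = *-zero-cancel p e

  0≤inverse : ∀ {x y} → 0# ≤ x → x * y ≡ 1# → 0# ≤ y
  0≤inverse {x} {y} p e = subst (λ z → 0# ≤ z)
    (trans (solve 2 (λ x y → x :* (y :* y) := x :* y :* y) refl x y) (trans (cong (λ z → z * y) e) (*-identityˡ y)))
    (0≤* p (0≤sq y))

  ≤-cancel-*ˡ : ∀ {a x y} → 0# ≤ a → ¬ (a ≡ 0#) → a * x ≤ a * y → x ≤ y
  ≤-cancel-*ˡ {a} {x} {y} p a≢0 q with inverse a a≢0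
  ... | b , ab≡1 = 0≤⇒≤ (0≤* (0≤inverse p ab≡1) (≤⇒0≤ q)) (begin
      b * (a * y − a * x) ≡⟨ solve 4 (λ a b x y → b :* (a :* y :- a :* x) := (a :* b) :* (y :- x)) refl a b x y ⟩
      (a * b) * (y − x)   ≡⟨ cong (λ z → z * (y − x)) ab≡1 ⟩
      1# * (y − x)        ≡⟨ *-identityˡ _ ⟩
      y − x               ∎)
    where open ≡-Reasoning

  -- At `t = - N d` with `d = 1 / (β + 1)` the quadratic has the value `- d N² - d² N²`, so
  -- nonnegativity forces `N = 0`. Dividing by `β + 1` rather than `β` includes the case `β = 0`.
  -- The summand `0#` is the constant term of `form-sq` at a null vector.
  linear-term≡0 : ∀ N β → 0# ≤ β → (∀ t → 0# ≤ t * t * β + (t * N + t * N) + 0#) → N ≡ 0#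
  linear-term≡0 N β 0≤β h = sq≡0 (*-zero-cancel d≢0 (antisym dNN≤0 (0≤* 0≤d (0≤sq N))))
    where
    β+1≢0 : ¬ (β + 1# ≡ 0#)
    β+1≢0 q = ¬1≤0 (0≤⇒≤ 0≤β (trans (solve 2 (λ b o → b := (b :+ o) :- o) refl β 1#) (cong (λ z → z − 1#) q)))
    inv = inverse (β + 1#) β+1≢0
    d = proj₁ inv
    0≤d : 0# ≤ d
    0≤d = 0≤inverse (0≤+ 0≤β 0≤1) (proj₂ inv)
    d≢0 : ¬ (d ≡ 0#)
    d≢0 q = 0≢1 (trans (sym (zeroʳ _)) (trans (cong (λ z → (β + 1#) * z) (sym q)) (proj₂ inv)))
    identity : ∀ d → (β + 1#) * d ≡ 1# → (- (N * d)) * (- (N * d)) * β + ((- (N * d)) * N + (- (N * d)) * N) + 0# + d * d * (N * N) ≡ 0# − d * (N * N)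
    identity d e = trans
      (solve 4 (λ N d b o → (:- (N :* d)) :* (:- (N :* d)) :* b :+ ((:- (N :* d)) :* N :+ (:- (N :* d)) :* N) :+ con (+ 0) :+ d :* d :* (N :* N)
         := N :* N :* d :* ((b :+ o) :* d) :- con (+ 2) :* (d :* (N :* N)) :+ N :* N :* d :* d :* (con (+ 1) :- o)) refl N d β 1#)
      (trans (cong (λ q → N * N * d * q − natR 2 * (d * (N * N)) + N * N * d * d * (natR 1 − 1#)) e)
        (trans (cong₂ (λ p r → p − natR 2 * (d * (N * N)) + N * N * d * d * r) (trans (*-comm _ _) (*-identityˡ _)) (trans (cong (λ z → z − 1#) (+-identityʳ 1#)) (-‿inverseʳ 1#)))
          (solve 2 (λ N d → N :* N :* d :- con (+ 2) :* (d :* (N :* N)) :+ N :* N :* d :* d :* con (+ 0) := con (+ 0) :- d :* (N :* N)) refl N d)))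
    dNN≤0 : d * (N * N) ≤ 0#
    dNN≤0 = 0≤⇒≤ (0≤+ (h (- (N * d))) (0≤* (0≤* 0≤d 0≤d) (0≤sq N))) (identity d (proj₂ inv))

  open Algebra.Properties.CommutativeMonoid.Sum +-commutativeMonoid public using (sum; ∑-distrib-+; ∑-comm; sum-cong-≗; sum-replicate-zero)
  open Algebra.Properties.Semiring.Sum semiring public using (*-distribˡ-sum)

  Σ≡sum : ∀ {n} (f : Fin n → Carrier) → Σ[ f ] ≡ sum f
  Σ≡sum {zero} f = refl
  Σ≡sum {suc n} f = cong (λ z → f Fin.zero + z) (Σ≡sum (λ i → f (Fin.suc i)))

  sum-nonneg : ∀ {n} (f : Fin n → Carrier) → (∀ i → 0# ≤ f i) → 0# ≤ sum f
  sum-nonneg {zero} f p = ≤-refl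
  sum-nonneg {suc n} f p = 0≤+ (p _) (sum-nonneg _ (λ i → p (Fin.suc i)))

  sum-sub : ∀ {n} (f g : Fin n → Carrier) → sum g − sum f ≡ sum (λ i → g i − f i)
  sum-sub {zero} f g = -‿inverseʳ 0#
  sum-sub {suc n} f g = trans
    (solve 4 (λ a b c d → (a :+ b) :- (c :+ d) := (a :- c) :+ (b :- d)) refl _ _ _ _)
    (cong (λ z → (g Fin.zero − f Fin.zero) + z) (sum-sub (λ i → f (Fin.suc i)) (λ i → g (Fin.suc i))))

  sum-mono : ∀ {n} (f g : Fin n → Carrier) → (∀ i → f i ≤ g i) → sum f ≤ sum g
  sum-mono f g p = 0≤⇒≤ (sum-nonneg _ (λ i → ≤⇒0≤ (p i))) (sym (sum-sub f g))

  ≤-sum : ∀ {n} (f : Fin n → Carrier) → (∀ i → 0# ≤ f i) → ∀ i → f i ≤ sum f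
  ≤-sum {suc n} f p Fin.zero = 0≤⇒≤ (sum-nonneg _ (λ i → p (Fin.suc i)))
    (solve 2 (λ x y → y := (x :+ y) :- x) refl _ _)
  ≤-sum {suc n} f p (Fin.suc i) = ≤-trans (≤-sum _ (λ i → p (Fin.suc i)) i)
    (0≤⇒≤ (p Fin.zero) (solve 2 (λ x y → x := (x :+ y) :- y) refl _ _))

  natR-sum : ∀ {n} (f : Fin n → ℕ) → natR (ΣN.sum f) ≡ sum (λ i → natR (f i))
  natR-sum {zero} f = refl
  natR-sum {suc n} f = trans (natR-+ (f Fin.zero) _) (cong (λ z → natR (f Fin.zero) + z) (natR-sum (λ i → f (Fin.suc i))))

  sum-diag : ∀ {n} (v : Fin n) c (x : Fin n → Carrier) → sum (λ u → (if v == u then c else 0#) * x u) ≡ c * x v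
  sum-diag {suc n} Fin.zero c x = trans (cong (λ z → c * x Fin.zero + z)
    (trans (sum-cong-≗ (λ i → zeroˡ (x (Fin.suc i)))) (sum-replicate-zero n))) (+-identityʳ _)
  sum-diag {suc n} (Fin.suc v) c x = trans (cong₂ _+_ (zeroˡ _)
    (trans (sum-cong-≗ (λ u → cong (λ b → (if b then c else 0#) * x (Fin.suc u)) refl)) (sum-diag v c (λ i → x (Fin.suc i))))) (+-identityˡ _)

-- Spans, linear dependence and quadratic forms.

module Linear (ℝ : RealField) (n : ℕ) where
  open Field ℝ public

  V : Set
  V = Fin n → Carrier

  infixr 8 _∙_+̇_
  _∙_+̇_ : Carrier → V → V → V
  (a ∙ x +̇ y) i = a * x i + y i

  0̇ : V
  0̇ _ = 0#

  abstract
    -- `abstract` keeps `dot` from unfolding into a sum in later goals; where the sum itself is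
    -- wanted, `dot-def` supplies it.
    dot : V → V → Carrier
    dot x y = sum (λ i → x i * y i)

    dot-def : ∀ x y → dot x y ≡ sum (λ i → x i * y i)
    dot-def x y = refl

    dot-cong : ∀ {x x′ y y′} → x ≗ x′ → y ≗ y′ → dot x y ≡ dot x′ y′
    dot-cong p q = sum-cong-≗ (λ i → cong₂ _*_ (p i) (q i))

    dot-comm : ∀ x y → dot x y ≡ dot y x
    dot-comm x y = sum-cong-≗ (λ i → *-comm (x i) (y i))

    dot-linˡ : ∀ a x y z → dot (a ∙ x +̇ y) z ≡ a * dot x z + dot y z
    dot-linˡ a x y z = begin
      dot (a ∙ x +̇ y) z
        ≡⟨ sum-cong-≗ (λ i → solve 4 (λ a x y z → (a :* x :+ y) :* z := a :* (x :* z) :+ y :* z) refl a (x i) (y i) (z i)) ⟩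
      sum (λ i → a * (x i * z i) + y i * z i)
        ≡⟨ ∑-distrib-+ (λ i → a * (x i * z i)) (λ i → y i * z i) ⟩
      sum (λ i → a * (x i * z i)) + dot y z
        ≡⟨ cong (λ s → s + dot y z) (sym (*-distribˡ-sum a (λ i → x i * z i))) ⟩
      a * dot x z + dot y z ∎
      where open ≡-Reasoning

    dot-self-nonneg : ∀ x → 0# ≤ dot x x
    dot-self-nonneg x = sum-nonneg _ (λ i → 0≤sq (x i))

    dot-self≡0 : ∀ {x} → dot x x ≡ 0# → x ≗ 0̇
    dot-self≡0 {x} e i = sq≡0 (antisym (subst (λ z → x i * x i ≤ z) e (≤-sum _ (λ i → 0≤sq (x i)) i)) (0≤sq (x i)))

    dot-0ˡ : ∀ {x} y → x ≗ 0̇ → dot x y ≡ 0#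
    dot-0ˡ {x} y p = trans (sum-cong-≗ (λ i → trans (cong (λ z → z * y i) (p i)) (zeroˡ (y i)))) (sum-replicate-zero n)

  dot-linʳ : ∀ a x y z → dot z (a ∙ x +̇ y) ≡ a * dot z x + dot z y
  dot-linʳ a x y z = trans (dot-comm z _) (trans (dot-linˡ a x y z) (cong₂ (λ p q → a * p + q) (dot-comm x z) (dot-comm y z)))

  dot-0ʳ : ∀ x {y} → y ≗ 0̇ → dot x y ≡ 0#
  dot-0ʳ x p = trans (dot-comm x _) (dot-0ˡ x p)

  data Span : List V → V → Set where
    nil  : ∀ {x} → x ≗ 0̇ → Span [] x
    cons : ∀ {u us x} γ y → Span us y → x ≗ γ ∙ u +̇ y → Span (u ∷ us) x

  span-cong : ∀ {us x y} → y ≗ x → Span us x → Span us y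
  span-cong e (nil p) = nil (λ i → trans (e i) (p i))
  span-cong e (cons γ y s p) = cons γ y s (λ i → trans (e i) (p i))

  span-there : ∀ {u us x} → Span us x → Span (u ∷ us) x
  span-there {u} {x = x} s = cons 0# x s (λ i → sym (trans (cong (λ z → z + x i) (zeroˡ (u i))) (+-identityˡ _)))

  span-0 : ∀ us → Span us 0̇
  span-0 [] = nil (λ _ → refl)
  span-0 (u ∷ us) = span-there (span-0 us)

  span-here : ∀ {u us} → Span (u ∷ us) u
  span-here {u} {us} = cons 1# 0̇ (span-0 us) (λ i → sym (trans (+-identityʳ _) (*-identityˡ (u i))))

  span-lin : ∀ {us x y} a → Span us x → Span us y → Span us (a ∙ x +̇ y)
  span-lin a (nil p) (nil q) = nil (λ i → trans (cong₂ (λ x y → a * x + y) (p i) (q i)) (trans (+-identityʳ _) (zeroʳ a)))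
  span-lin a (cons {u} γ y s p) (cons γ′ y′ s′ p′) = cons (a * γ + γ′) (a ∙ y +̇ y′) (span-lin a s s′)
    (λ i → trans (cong₂ (λ x y → a * x + y) (p i) (p′ i))
      (solve 6 (λ a γ u y γ′ y′ → a :* (γ :* u :+ y) :+ (γ′ :* u :+ y′) := (a :* γ :+ γ′) :* u :+ (a :* y :+ y′)) refl a γ (u i) (y i) γ′ (y′ i)))

  span-trans : ∀ {us vs x} → All (Span vs) us → Span us x → Span vs x
  span-trans {vs = vs} [] (nil p) = span-cong p (span-0 vs)
  span-trans (q ∷ qs) (cons γ y s p) = span-cong p (span-lin γ q (span-trans qs s))

  span-self : ∀ us → All (Span us) us
  span-self [] = []
  span-self (u ∷ us) = span-here ∷ All.map span-there (span-self us)

  -- An oriented form of linear dependence. The Krylov list runs from the highest power down, so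
  -- there it says directly that some power is a combination of lower ones.
  data Dep : List V → Set where
    here  : ∀ {u us} → Span us u → Dep (u ∷ us)
    there : ∀ {u us} → Dep us → Dep (u ∷ us)

  span-coord : ∀ {us x} i → All (λ u → u i ≡ 0#) us → Span us x → x i ≡ 0#
  span-coord i [] (nil p) = p i
  span-coord i (q ∷ qs) (cons {u} γ y s p) = trans (p i)
    (trans (cong₂ (λ v z → γ * v + z) q (span-coord i qs s)) (trans (+-identityʳ _) (zeroʳ γ)))

  record Reduced (i : Fin n) (us : List V) : Set where
    field
      pivot   : V
      pivot∈  : Span us pivot
      pivot≢0 : ¬ (pivot i ≡ 0#)
      rest    : List V
      len     : length us ≡ suc (length rest)
      rest∈   : All (Span us) rest
      rest≡0  : All (λ u → u i ≡ 0#) rest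
      dep     : Dep rest → Dep us

  -- The pivot is the last vector with a nonzero i-th coordinate, so that clearing this
  -- coordinate in a vector only adds a combination of later ones.
  reduce : ∀ i us → All (λ u → u i ≡ 0#) us ⊎ Reduced i us
  reduce i [] = inj₁ []
  reduce i (u ∷ us) with reduce i us
  ... | inj₁ z with u i ≟ᴿ 0#
  ...   | yes p = inj₁ (p ∷ z)
  ...   | no p = inj₂ (record
    { pivot = u ; pivot∈ = span-here ; pivot≢0 = p ; rest = us ; len = refl
    ; rest∈ = All.map span-there (span-self us) ; rest≡0 = z ; dep = there })
  reduce i (u ∷ us) | inj₂ R = inj₂ (record
    { pivot = pivot ; pivot∈ = span-there pivot∈ ; pivot≢0 = pivot≢0 ; rest = u′ ∷ rest
    ; len = cong suc len
    ; rest∈ = span-lin (- t) (span-there pivot∈) span-here ∷ All.map span-there rest∈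
    ; rest≡0 = u′i≡0 ∷ rest≡0
    ; dep = dep′ })
    where
    open Reduced R
    inv = inverse (pivot i) pivot≢0
    t = u i * proj₁ inv
    u′ = (- t) ∙ pivot +̇ u
    u′i≡0 : u′ i ≡ 0#
    u′i≡0 = trans (solve 3 (λ u z p → (:- (u :* z)) :* p :+ u := u :* (con (+ 1) :- p :* z)) refl (u i) (proj₁ inv) (pivot i))
      (trans (cong (λ q → u i * (natR 1 − q)) (proj₂ inv))
        (solve 2 (λ u o → u :* ((o :+ con (+ 0)) :- o) := con (+ 0)) refl (u i) 1#))
    dep′ : Dep (u′ ∷ rest) → Dep (u ∷ us)
    dep′ (here s) = here (span-cong (λ j → solve 3 (λ t p u → u := t :* p :+ ((:- t) :* p :+ u)) refl t (pivot j) (u j))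
      (span-lin t pivot∈ (span-trans rest∈ s)))
    dep′ (there d) = there (dep d)

  -- Gaussian elimination, one coordinate at a time. Each step uses up one coordinate and at most
  -- one vector, and keeps the invariant that the remaining coordinates separate the span from 0.
  -- When no coordinate is left, the first remaining vector is 0, hence in the span of the others.
  dependent : ∀ is us → length is ℕ.< length us →
    (∀ x → Span us x → All (λ i → x i ≡ 0#) is → x ≗ 0̇) → Dep us
  dependent [] (u ∷ us) _ sep = here (span-cong (sep u span-here []) (span-0 us))
  dependent (i ∷ is) us lt sep with reduce i us
  ... | inj₁ z = dependent is us (ℕP.<-trans (ℕP.n<1+n _) lt) (λ x s a → sep x s (span-coord i z s ∷ a))
  ... | inj₂ R = dep (dependent is rest (ℕ.s<s⁻¹ (subst (λ m → suc (length is) ℕ.< m) len lt))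
      (λ x s a → sep x (span-trans rest∈ s) (span-coord i rest≡0 s ∷ a)))
    where open Reduced R

  record SymOp : Set where
    field
      app      : V → V
      app-cong : ∀ {x y} → x ≗ y → app x ≗ app y
      app-lin  : ∀ a x y → app (a ∙ x +̇ y) ≗ a ∙ app x +̇ app y
      self-adj : ∀ x y → dot (app x) y ≡ dot x (app y)

    form : V → V → Carrier
    form x y = dot x (app y)

    app-0 : ∀ {x} → x ≗ 0̇ → app x ≗ 0̇
    app-0 {x} p i = begin
      app x i                        ≡⟨ app-cong (λ j → trans (p j) (sym (trans (cong (λ z → (- 1#) * z + z) (p j)) (trans (+-identityʳ _) (zeroʳ _))))) i ⟩
      app ((- 1#) ∙ x +̇ x) i         ≡⟨ app-lin (- 1#) x x i ⟩
      (- 1#) * app x i + app x i     ≡⟨ cong (λ z → (- 1#) * app x i + z) (sym (*-identityˡ (app x i))) ⟩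
      (- 1#) * app x i + 1# * app x i ≡⟨ solve 2 (λ o z → (:- o) :* z :+ o :* z := con (+ 0)) refl 1# (app x i) ⟩
      0#                             ∎
      where open ≡-Reasoning

    form-cong : ∀ {x x′ y y′} → x ≗ x′ → y ≗ y′ → form x y ≡ form x′ y′
    form-cong p q = dot-cong p (app-cong q)

    form-sym : ∀ x y → form x y ≡ form y x
    form-sym x y = trans (sym (self-adj x y)) (dot-comm (app x) y)

    form-linʳ : ∀ a x y z → form z (a ∙ x +̇ y) ≡ a * form z x + form z y
    form-linʳ a x y z = trans (dot-cong (λ _ → refl) (app-lin a x y)) (dot-linʳ a (app x) (app y) z)

    form-sq : ∀ a x y → form (a ∙ x +̇ y) (a ∙ x +̇ y) ≡ a * a * form x x + (a * form x y + a * form x y) + form y y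
    form-sq a x y = begin
      form (a ∙ x +̇ y) (a ∙ x +̇ y)                    ≡⟨ dot-linˡ a x y _ ⟩
      a * form x (a ∙ x +̇ y) + form y (a ∙ x +̇ y)     ≡⟨ cong₂ (λ p q → a * p + q) (form-linʳ a x y x) (form-linʳ a x y y) ⟩
      a * (a * form x x + form x y) + (a * form y x + form y y)
        ≡⟨ cong (λ p → a * (a * form x x + form x y) + (a * p + form y y)) (form-sym y x) ⟩
      a * (a * form x x + form x y) + (a * form x y + form y y)
        ≡⟨ solve 4 (λ a p q r → a :* (a :* p :+ q) :+ (a :* q :+ r) := a :* a :* p :+ (a :* q :+ a :* q) :+ r) refl a _ _ _ ⟩
      a * a * form x x + (a * form x y + a * form x y) + form y y ∎
      where open ≡-Reasoning

    form-span : ∀ u {us x} → All (λ v → form u v ≡ 0#) us → Span us x → form u x ≡ 0#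
    form-span u [] (nil p) = dot-0ʳ u (app-0 p)
    form-span u (q ∷ qs) (cons {v} γ y s p) = trans (form-cong (λ _ → refl) p) (trans (form-linʳ γ v y u)
      (trans (cong₂ (λ a b → γ * a + b) q (form-span u qs s)) (trans (+-identityʳ _) (zeroʳ γ))))

  -- For the identity the form is `dot` itself, so `form-sq` and `form-span` also serve to expand a
  -- norm and to test orthogonality to a span.
  id-op : SymOp
  id-op = record { app = λ x → x ; app-cong = λ p → p ; app-lin = λ _ _ _ _ → refl ; self-adj = λ _ _ → refl }

  -- With `t v = form u v / form u u` this is a Gram-Schmidt step for the form.
  shear : (V → Carrier) → V → V → V
  shear t u v = (- t v) ∙ u +̇ v

  shear-span : ∀ t u us {y} → Span us y → ∃₂ λ τ y′ → Span (map (shear t u) us) y′ × y ≗ τ ∙ u +̇ y′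
  shear-span t u [] (nil p) = 0# , 0̇ , nil (λ _ → refl) , λ i → trans (p i) (sym (trans (+-identityʳ _) (zeroˡ (u i))))
  shear-span t u (v ∷ us) (cons δ z s p) with shear-span t u us s
  ... | τ , z′ , s′ , q = δ * t v + τ , δ ∙ shear t u v +̇ z′ , cons δ z′ s′ (λ _ → refl) ,
    λ i → trans (p i) (trans (cong (λ w → δ * v i + w) (q i))
      (solve 6 (λ δ v τ u z t → δ :* v :+ (τ :* u :+ z) := (δ :* t :+ τ) :* u :+ (δ :* ((:- t) :* u :+ v) :+ z)) refl δ (v i) τ (u i) (z′ i) (t v)))

  module _ (L : SymOp) where
    open SymOp L

    -- The constant `K` makes positivity uniform on the span. It replaces compactness of the unit
    -- sphere: `attained` lowers the supremum by `1/K`.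
    Degenerate Definite : List V → Set
    Degenerate us = ∃ λ x → Span us x × ¬ (dot x x ≡ 0#) × form x x ≤ 0#
    Definite us = ∃ λ K → 0# ≤ K × (∀ x → Span us x → 0# ≤ form x x × dot x x ≤ K * form x x)

    -- Lagrange reduction of a quadratic form: split off one vector and make the others orthogonal to it.
    definite? : ∀ m us → length us ≡ m → Degenerate us ⊎ Definite us
    definite? _ [] _ = inj₂ (0# , ≤-refl , λ { x (nil p) →
      ≤-reflexive (sym (dot-0ˡ _ p)) , ≤-reflexive (trans (dot-0ˡ x p) (sym (zeroˡ _))) })
    definite? (suc m) (u ∷ us) len with dot u u ≟ᴿ 0#
    ... | yes u≡0 with definite? m us (ℕP.suc-injective len)
    ...   | inj₁ (x , s , r) = inj₁ (x , span-there s , r)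
    ...   | inj₂ (K , p , f) = inj₂ (K , p , λ { x (cons γ y s e) → f x (span-cong (λ i → trans (e i)
              (trans (cong (λ z → γ * z + y i) (dot-self≡0 u≡0 i)) (trans (cong (λ z → z + y i) (zeroʳ γ)) (+-identityˡ _)))) s) })
    definite? (suc m) (u ∷ us) len | no u≢0 with total (form u u) 0#
    ... | inj₁ a≤0 = inj₁ (u , span-here , u≢0 , a≤0)
    ... | inj₂ 0≤a with form u u ≟ᴿ 0#
    ...   | yes a≡0 = inj₁ (u , span-here , u≢0 , ≤-reflexive a≡0)
    ...   | no a≢0 = result
      where
      a = form u u
      inv = inverse a a≢0
      b = proj₁ inv
      t : V → Carrier
      t v = form u v * b
      us′ = map (shear t u) us
      U = dot u u
      us′⊆ : All (Span (u ∷ us)) us′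
      us′⊆ = AllP.map⁺ (All.map (λ {v} s → span-lin (- t v) span-here (span-there s)) (span-self us))
      orth : All (λ v → form u v ≡ 0#) us′
      orth = AllP.map⁺ (All.universal (λ v → trans (form-linʳ (- t v) u v u)
        (trans (solve 3 (λ f b a → (:- (f :* b)) :* a :+ f := f :* (con (+ 1) :- a :* b)) refl (form u v) b a)
        (trans (cong (λ q → form u v * (natR 1 − q)) (proj₂ inv))
          (solve 2 (λ u o → u :* ((o :+ con (+ 0)) :- o) := con (+ 0)) refl (form u v) 1#)))) us)
      result : Degenerate (u ∷ us) ⊎ Definite (u ∷ us)
      result with definite? m us′ (trans (length-map (shear t u) us) (ℕP.suc-injective len))
      ... | inj₁ (x , s , r) = inj₁ (x , span-trans us′⊆ s , r)
      ... | inj₂ (K , 0≤K , f) = inj₂ (K′ , 0≤K′ , good)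
        where
        -- For `x = g u + y′`, the inequality `|g u + y′|² ≤ 2 g² U + 2 Y` (that is,
        -- `|y′ - g u|² ≥ 0`) separates the two parts. Since `b = 1/a`, the first is `2 U b` times
        -- `g² a`; the second is at most `2 K B`. Both are covered by `K′ * (g² a + B)`.
        K′ = (U * b + U * b) + (K + K)
        0≤Ub = 0≤* (dot-self-nonneg u) (0≤inverse 0≤a (proj₂ inv))
        0≤K′ = 0≤+ (0≤+ 0≤Ub 0≤Ub) (0≤+ 0≤K 0≤K)
        good : ∀ x → Span (u ∷ us) x → 0# ≤ form x x × dot x x ≤ K′ * form x x
        good x (cons γ y s e) with shear-span t u us s
        ... | τ , y′ , s′ , e′ = subst (λ z → 0# ≤ z) (sym Bxx) 0≤B′ , subst₂ (λ p q → p ≤ K′ * q) (sym xx) (sym Bxx) ineq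
          where
          g = γ + τ
          x≗ : x ≗ g ∙ u +̇ y′
          x≗ i = trans (e i) (trans (cong (λ z → γ * u i + z) (e′ i))
            (solve 4 (λ γ τ u y → γ :* u :+ (τ :* u :+ y) := (γ :+ τ) :* u :+ y) refl γ τ (u i) (y′ i)))
          B = form y′ y′
          Y = dot y′ y′
          X = dot u y′
          0≤B = proj₁ (f y′ s′)
          Y≤KB = proj₂ (f y′ s′)
          Bxx : form x x ≡ g * g * a + B
          Bxx = trans (form-cong x≗ x≗) (trans (form-sq g u y′)
            (trans (cong (λ z → g * g * a + (g * z + g * z) + B) (form-span u orth s′))
              (solve 3 (λ g a b → g :* g :* a :+ (g :* con (+ 0) :+ g :* con (+ 0)) :+ b := g :* g :* a :+ b) refl g a B)))
          0≤B′ = 0≤+ (0≤* (0≤sq g) 0≤a) 0≤B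
          xx : dot x x ≡ g * g * U + (g * X + g * X) + Y
          xx = trans (dot-cong x≗ x≗) (SymOp.form-sq id-op g u y′)
          0≤sq′ : 0# ≤ g * g * U + (- g * X + - g * X) + Y
          0≤sq′ = subst (λ z → 0# ≤ z) (trans (SymOp.form-sq id-op (- g) u y′)
            (solve 4 (λ g u x y → (:- g) :* (:- g) :* u :+ (((:- g) :* x) :+ ((:- g) :* x)) :+ y := g :* g :* u :+ ((:- g) :* x :+ (:- g) :* x) :+ y) refl g U X Y))
            (dot-self-nonneg ((- g) ∙ u +̇ y′))
          ineq : g * g * U + (g * X + g * X) + Y ≤ K′ * (g * g * a + B)
          ineq = 0≤⇒≤ (0≤+ (0≤+ (0≤+ 0≤sq′ (0≤+ (≤⇒0≤ Y≤KB) (≤⇒0≤ Y≤KB))) (0≤+ (0≤* 0≤Ub 0≤B) (0≤* 0≤Ub 0≤B)))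
                               (0≤+ (0≤* 0≤K (0≤* (0≤sq g) 0≤a)) (0≤* 0≤K (0≤* (0≤sq g) 0≤a))))
            (trans (solve 8 (λ g U X Y K B b a →
              (g :* g :* U :+ ((:- g) :* X :+ (:- g) :* X) :+ Y) :+ ((K :* B :- Y) :+ (K :* B :- Y))
                :+ (U :* b :* B :+ U :* b :* B) :+ (K :* (g :* g :* a) :+ K :* (g :* g :* a))
              := (((U :* b :+ U :* b) :+ (K :+ K)) :* (g :* g :* a :+ B) :- (g :* g :* U :+ (g :* X :+ g :* X) :+ Y))
                 :+ (con (+ 2) :* U :* g :* g) :* (con (+ 1) :- a :* b)) refl g U X Y K B b a)
            (trans (cong (λ q → Z + natR 2 * U * g * g * (natR 1 − q)) (proj₂ inv))
              (solve 3 (λ z w o → z :+ w :* ((o :+ con (+ 0)) :- o) := z) refl Z (natR 2 * U * g * g) 1#)))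
            where Z = K′ * (g * g * a + B) − (g * g * U + (g * X + g * X) + Y)

-- Eigenvectors from the Rayleigh quotient on a Krylov space.

module Spectral (ℝ : RealField) (n : ℕ) where
  open Linear ℝ n public

  shift : Carrier → SymOp → SymOp
  shift s Q = record
    { app = λ x i → s * x i − app x i
    ; app-cong = λ p i → cong₂ (λ a b → s * a − b) (p i) (app-cong p i)
    ; app-lin = λ a x y i → trans (cong (λ z → s * (a * x i + y i) − z) (app-lin a x y i))
        (solve 6 (λ s a x y p q → s :* (a :* x :+ y) :- (a :* p :+ q) := a :* (s :* x :- p) :+ (s :* y :- q)) refl s a (x i) (y i) (app x i) (app y i))
    ; self-adj = λ x y → begin
        dot (λ i → s * x i − app x i) y ≡⟨ dot-cong (λ i → lem s (x i) (app x i)) (λ _ → refl) ⟩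
        dot ((- 1#) ∙ app x +̇ (s ∙ x +̇ 0̇)) y ≡⟨ trans (dot-linˡ _ _ _ _) (cong (λ z → (- 1#) * dot (app x) y + z) (dot-linˡ _ _ _ _)) ⟩
        (- 1#) * dot (app x) y + (s * dot x y + dot 0̇ y) ≡⟨ cong₂ (λ a b → (- 1#) * a + (s * dot x y + b)) (self-adj x y) (trans (dot-0ˡ y (λ _ → refl)) (sym (dot-0ʳ x (λ _ → refl)))) ⟩
        (- 1#) * dot x (app y) + (s * dot x y + dot x 0̇) ≡⟨ sym (trans (dot-linʳ _ _ _ _) (cong (λ z → (- 1#) * dot x (app y) + z) (dot-linʳ _ _ _ _))) ⟩
        dot x ((- 1#) ∙ app y +̇ (s ∙ y +̇ 0̇)) ≡⟨ dot-cong (λ _ → refl) (λ i → sym (lem s (y i) (app y i))) ⟩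
        dot x (λ i → s * y i − app y i) ∎
    }
    where
    open SymOp Q
    open ≡-Reasoning
    lem : ∀ s x p → s * x − p ≡ (- 1#) * p + (s * x + 0#)
    lem s x p = trans (cong (λ q → s * x − q) (sym (*-identityˡ p)))
      (solve 4 (λ s x p o → s :* x :- o :* p := (:- o) :* p :+ (s :* x :+ con (+ 0))) refl s x p 1#)

  shift-form : ∀ s Q x → SymOp.form (shift s Q) x x ≡ s * dot x x − SymOp.form Q x x
  shift-form s Q x = begin
    dot x (λ i → s * x i − app x i) ≡⟨ dot-cong (λ _ → refl) (λ i → trans (cong (λ z → s * x i + z) (neg (app x i))) (+-comm _ _)) ⟩
    dot x ((- 1#) ∙ app x +̇ (λ i → s * x i)) ≡⟨ dot-linʳ _ _ _ _ ⟩
    (- 1#) * dot x (app x) + dot x (λ i → s * x i) ≡⟨ cong (λ z → (- 1#) * dot x (app x) + z) (trans (dot-cong (λ _ → refl) (λ i → sym (+-identityʳ _))) (dot-linʳ s x 0̇ x)) ⟩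
    (- 1#) * dot x (app x) + (s * dot x x + dot x 0̇) ≡⟨ cong (λ z → (- 1#) * dot x (app x) + (s * dot x x + z)) (dot-0ʳ x (λ _ → refl)) ⟩
    (- 1#) * dot x (app x) + (s * dot x x + 0#) ≡⟨ trans (cong₂ _+_ (sym (neg _)) (+-identityʳ _)) (+-comm _ _) ⟩
    s * dot x x − dot x (app x) ∎
    where
    open SymOp Q
    open ≡-Reasoning
    neg : ∀ p → - p ≡ (- 1#) * p
    neg p = trans (cong -_ (sym (*-identityˡ p))) (solve 2 (λ o p → :- (o :* p) := (:- o) :* p) refl 1# p)

  module _ (L : SymOp) where
    open SymOp L

    -- With `y = app x`, the form at `t y + x` is `t² form y y + 2 t dot y y`. It is nonnegative for
    -- every `t`, so the linear coefficient `dot y y` vanishes. Positivity is known on the span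
    -- only, which is why `app x` has to lie there too.
    null⇒kernel : ∀ {us x} → (∀ y → Span us y → 0# ≤ form y y) → Span us x → Span us (app x) →
      form x x ≡ 0# → app x ≗ 0̇
    null⇒kernel {us} {x} psd s s′ e = dot-self≡0 (linear-term≡0 (dot y y) (form y y) (psd y s′) λ t →
      subst (λ z → 0# ≤ z) (trans (form-sq t y x) (cong (λ q → t * t * form y y + (t * dot y y + t * dot y y) + q) e)) (psd _ (span-lin t s′ s)))
      where y = app x

  Bounded : SymOp → Set
  Bounded Q = ∃ λ K → ∀ x → SymOp.form Q x x ≤ K * dot x x

  module Rayleigh (Q : SymOp) (bounded-Q : Bounded Q) (us : List V) {w : V}
    (closed : ∀ x → Span us x → Span us (SymOp.app Q x)) (w∈ : Span us w) (w≢0 : ¬ (dot w w ≡ 0#)) where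
    open SymOp Q

    -- The Rayleigh quotients closed downwards; the inequality is multiplied out, so membership
    -- involves no division.
    Below : Carrier → Set
    Below λ′ = ∃ λ x → Span us x × ¬ (dot x x ≡ 0#) × λ′ * dot x x ≤ form x x
    rayleigh : ∀ x → Span us x → ¬ (dot x x ≡ 0#) → ∃ λ q → Below q × q * dot x x ≡ form x x
    rayleigh x x∈ x≢0 with inverse (dot x x) x≢0
    ... | b , e = form x x * b , (x , x∈ , x≢0 , ≤-reflexive eq) , eq
      where
      eq : form x x * b * dot x x ≡ form x x
      eq = trans (solve 3 (λ f b d → f :* b :* d := f :* (d :* b)) refl (form x x) b (dot x x))
        (trans (cong (λ z → form x x * z) e) (trans (*-comm _ _) (*-identityˡ _)))
    nonempty : ∃ Below
    nonempty = proj₁ (rayleigh w w∈ w≢0) , proj₁ (proj₂ (rayleigh w w∈ w≢0))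
    bounded : ∀ q → Below q → q ≤ proj₁ bounded-Q
    bounded q (x , _ , x≢0 , le) = ≤-cancel-*ˡ (dot-self-nonneg x) x≢0
      (subst₂ _≤_ (*-comm _ _) (*-comm _ _) (≤-trans le (proj₂ bounded-Q x)))
    module Supremum (s : Carrier) (upper : ∀ q → Below q → q ≤ s) (least : ∀ b → (∀ q → Below q → q ≤ b) → s ≤ b) where
      psd : ∀ x → Span us x → 0# ≤ SymOp.form (shift s Q) x x
      psd x x∈ with dot x x ≟ᴿ 0#
      ... | yes x≡0 = ≤-reflexive (sym (dot-0ˡ _ (dot-self≡0 x≡0)))
      ... | no x≢0 with rayleigh x x∈ x≢0
      ...   | q , below , eq = subst (λ z → 0# ≤ z)
                (trans (solve 3 (λ d s q → d :* (s :- q) := s :* d :- q :* d) refl (dot x x) s q)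
                  (trans (cong (λ z → s * dot x x − z) eq) (sym (shift-form s Q x))))
                (0≤* (dot-self-nonneg x) (≤⇒0≤ (upper q below)))

      -- The supremum of the Rayleigh quotient over an invariant span is attained: otherwise the
      -- form s - Q would be definite there and s could be lowered.
      attained : ∃₂ λ x ν → Span us x × ¬ (dot x x ≡ 0#) × (∀ i → app x i ≡ ν * x i)
      attained with definite? (shift s Q) (length us) us refl
      ... | inj₁ (x , x∈ , x≢0 , le) = x , s , x∈ , x≢0 , λ i → sym (≡⇐−≡0 (null⇒kernel (shift s Q) psd x∈
               (span-cong (λ i → solve 3 (λ s x q → s :* x :- q := s :* x :+ ((:- con (+ 1)) :* q :+ con (+ 0))) refl s (x i) (app x i))
                 (span-lin s x∈ (span-lin (- natR 1) (closed x x∈) (span-0 us))))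
               (antisym le (psd x x∈)) i))
      ... | inj₂ (K , 0≤K , f) = ⊥-elim (¬1≤0 (subst (λ z → z ≤ 0#) (proj₂ inv) (0≤⇒≤ (0≤* 0≤K 0≤-k) (solve 2 (λ a b → a :* (:- b) := con (+ 0) :- a :* b) refl K k))))
        where
        -- Definiteness reads `dot x x ≤ K (s dot x x - form x x)`. Replacing `form x x` by the
        -- smaller `q dot x x` and dividing by `dot x x` gives a gap that does not depend on `x`; so
        -- `s - 1/K` would be a smaller upper bound.
        gap : ∀ q → Below q → 1# ≤ K * (s − q)
        gap q (x , x∈ , x≢0 , le) = ≤-cancel-*ˡ (dot-self-nonneg x) x≢0 (0≤⇒≤
          (0≤+ (≤⇒0≤ (subst (λ z → dot x x ≤ K * z) (shift-form s Q x) (proj₂ (f x x∈)))) (0≤* 0≤K (≤⇒0≤ le)))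
          (trans (solve 5 (λ d K s q f → (K :* (s :* d :- f) :- d) :+ K :* (f :- q :* d) := d :* (K :* (s :- q)) :- d) refl (dot x x) K s q (form x x))
            (cong (λ z → dot x x * (K * (s − q)) − z) (trans (sym (*-identityˡ _)) (*-comm _ _)))))
        K≢0 : ¬ (K ≡ 0#)
        K≢0 e = ¬1≤0 (subst (λ z → 1# ≤ z) (trans (cong (λ z → z * (s − proj₁ nonempty)) e) (zeroˡ _)) (gap _ (proj₂ nonempty)))
        inv = inverse K K≢0
        k = proj₁ inv
        lower : ∀ q → Below q → q ≤ s − k
        lower q b = ≤-cancel-*ˡ 0≤K K≢0 (0≤⇒≤ (≤⇒0≤ (gap q b))
          (trans (cong (λ z → K * (s − q) − z) (sym (proj₂ inv))) (solve 4 (λ K s q k → K :* (s :- q) :- K :* k := K :* (s :- k) :- K :* q) refl K s q k)))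
        0≤-k : 0# ≤ - k
        0≤-k = subst (λ z → 0# ≤ z) (solve 2 (λ s k → (s :- k) :- s := :- k) refl s k) (≤⇒0≤ (least (s − k) lower))

    top-eigenvector : ∃₂ λ x ν → Span us x × ¬ (dot x x ≡ 0#) × (∀ i → app x i ≡ ν * x i)
    top-eigenvector with complete Below nonempty (proj₁ bounded-Q , bounded)
    ... | s , upper , least = Supremum.attained s upper least

  module Krylov (Q : SymOp) (bound : Bounded Q) (w : V) (w≢0 : ¬ (dot w w ≡ 0#)) where
    open SymOp Q

    pow : ℕ → V
    pow zero = w
    pow (suc m) = app (pow m)

    krylov : ℕ → List V
    krylov zero = []
    krylov (suc m) = pow m ∷ krylov m

    length-krylov : ∀ m → length (krylov m) ≡ m
    length-krylov zero = refl
    length-krylov (suc m) = cong suc (length-krylov m)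

    app-krylov : ∀ m {x} → Span (krylov m) x → Span (krylov (suc m)) (app x)
    app-krylov zero (nil p) = span-cong (app-0 p) (span-0 _)
    app-krylov (suc m) (cons γ y s p) = span-cong (λ i → trans (app-cong p i) (app-lin γ (pow m) y i))
      (span-lin γ span-here (span-there (app-krylov m s)))

    dep⇒degree : ∀ m → Dep (krylov m) → ∃ λ k → Span (krylov k) (pow k)
    dep⇒degree (suc m) (here s) = m , s
    dep⇒degree (suc m) (there d) = dep⇒degree m d

    -- There are `n + 1` powers but only `n` coordinates, and all coordinates together separate
    -- vectors.
    degree-exists : ∃ λ k → Span (krylov k) (pow k)
    degree-exists = dep⇒degree (suc n) (dependent (allFin n) (krylov (suc n))
      (subst₂ ℕ._<_ (sym (length-tabulate {n = n} (λ i → i))) (sym (length-krylov (suc n))) (ℕP.n<1+n n))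
      (λ x _ a i → All.lookup a (∈-allFin i)))

    k : ℕ
    k = proj₁ degree-exists

    closed : ∀ x → Span (krylov k) x → Span (krylov k) (app x)
    closed x s = span-trans (proj₂ degree-exists ∷ span-self (krylov k)) (app-krylov k s)

    w∈ : ∀ m → Span (krylov m) (pow m) → Span (krylov m) w
    w∈ zero s = s
    w∈ (suc m) _ = go m
      where
      go : ∀ m → Span (krylov (suc m)) w
      go zero = span-here
      go (suc m) = span-there (go m)

    -- Self-adjointness gives `dot x (Q^m w) = ν^m dot x w`. If `dot x w` were 0, the eigenvector
    -- `x` would be orthogonal to the whole Krylov span, which contains `x` itself.
    eigenvector : ∃₂ λ x ν → (∀ i → app x i ≡ ν * x i) × ¬ (dot x w ≡ 0#)
    eigenvector with Rayleigh.top-eigenvector Q bound (krylov k) closed (w∈ k (proj₂ degree-exists)) w≢0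
    ... | x , ν , x∈ , x≢0 , eig = x , ν , eig , λ x⊥w → x≢0 (SymOp.form-span id-op x (orth x⊥w k) x∈)
      where
      orth-pow : dot x w ≡ 0# → ∀ m → dot x (pow m) ≡ 0#
      orth-pow e zero = e
      orth-pow e (suc m) = begin
        dot x (app (pow m))    ≡⟨ sym (self-adj x (pow m)) ⟩
        dot (app x) (pow m)    ≡⟨ dot-cong (λ i → trans (eig i) (sym (+-identityʳ _))) (λ _ → refl) ⟩
        dot (ν ∙ x +̇ 0̇) (pow m) ≡⟨ dot-linˡ ν x 0̇ (pow m) ⟩
        ν * dot x (pow m) + dot 0̇ (pow m) ≡⟨ cong₂ (λ a b → ν * a + b) (orth-pow e m) (dot-0ˡ _ (λ _ → refl)) ⟩
        ν * 0# + 0#            ≡⟨ trans (+-identityʳ _) (zeroʳ ν) ⟩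
        0#                     ∎
        where open ≡-Reasoning
      orth : dot x w ≡ 0# → ∀ m → All (λ v → dot x v ≡ 0#) (krylov m)
      orth e zero = []
      orth e (suc m) = orth-pow e m ∷ orth e m

-- Symmetric matrices as self-adjoint operators.

module Matrix (ℝ : RealField) (n : ℕ) (M : Fin n → Fin n → RealField.Carrier ℝ) (M-sym : ∀ i j → M i j ≡ M j i) where

  open Spectral ℝ n

  mul : V → V
  mul x i = dot (M i) x

  mul-def : ∀ x i → mul x i ≡ sum (λ j → M i j * x j)
  mul-def x i = dot-def (M i) x

  mul-op : SymOp
  mul-op = record
    { app = mul
    ; app-cong = λ p i → dot-cong (λ _ → refl) p
    ; app-lin = λ a x y i → dot-linʳ a x y (M i)
    ; self-adj = λ x y → begin
        dot (mul x) y
          ≡⟨ dot-def (mul x) y ⟩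
        sum (λ i → mul x i * y i)
          ≡⟨ sum-cong-≗ (λ i → trans (*-comm (mul x i) (y i)) (trans (cong (λ z → y i * z) (mul-def x i)) (*-distribˡ-sum (y i) (λ j → M i j * x j)))) ⟩
        sum (λ i → sum (λ j → y i * (M i j * x j)))
          ≡⟨ ∑-comm (λ i j → y i * (M i j * x j)) ⟩
        sum (λ j → sum (λ i → y i * (M i j * x j)))
          ≡⟨ sum-cong-≗ (λ j → sum-cong-≗ (λ i → trans (cong (λ m → y i * (m * x j)) (M-sym i j))
               (solve 3 (λ m x y → y :* (m :* x) := x :* (m :* y)) refl (M j i) (x j) (y i)))) ⟩
        sum (λ j → sum (λ i → x j * (M j i * y i)))
          ≡⟨ sum-cong-≗ (λ j → trans (sym (*-distribˡ-sum (x j) (λ i → M j i * y i))) (cong (λ z → x j * z) (sym (mul-def y j)))) ⟩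
        sum (λ j → x j * mul y j)
          ≡⟨ sym (dot-def x (mul y)) ⟩
        dot x (mul y) ∎
    }
    where open ≡-Reasoning

  ab≤a²+b² : ∀ a b → a * b ≤ a * a + b * b
  ab≤a²+b² a b with total (a * b) 0#
  ... | inj₁ p = ≤-trans p (0≤+ (0≤sq a) (0≤sq b))
  ... | inj₂ p = 0≤⇒≤ (0≤+ (0≤sq (a − b)) p)
    (solve 2 (λ a b → (a :- b) :* (a :- b) :+ a :* b := a :* a :+ b :* b :- a :* b) refl a b)

  weigh : ∀ x m r d → 0# ≤ x → m ≤ r → x * m + d ≤ r * x + 1# * d
  weigh x m r d p q = 0≤⇒≤ (0≤* (≤⇒0≤ q) p)
    (trans (solve 4 (λ r m x d → (r :- m) :* x := (r :* x :+ d) :- (x :* m :+ d)) refl r m x d)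
      (cong (λ z → (r * x + z) − (x * m + d)) (sym (*-identityˡ d))))

  -- Each term satisfies `(M i j x i) x j ≤ (M i j x i)² + (x j)²`. Summed over all entries, the
  -- first squares give at most the squared Frobenius norm `R` times `dot x x`, and the second give
  -- `n` times `dot x x`, with `N` being `n`.
  mul-bounded : Bounded mul-op
  mul-bounded = R + N , λ x → subst₂ _≤_ (sym (dot-def x (mul x))) (total-eq x) (sum-mono (λ i → x i * mul x i) (λ i → R * (x i * x i) + 1# * dot x x) (row x))
    where
    norm : Fin n → Carrier
    norm i = dot (M i) (M i)
    R = sum norm
    N = sum {n} (λ _ → 1#)
    row : ∀ x i → x i * mul x i ≤ R * (x i * x i) + 1# * dot x x
    row x i = ≤-trans step₁ step₂
      where
      entry : ∀ j → x i * (M i j * x j) ≤ x i * x i * (M i j * M i j) + x j * x j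
      entry j = subst₂ _≤_ (solve 3 (λ x m y → (m :* x) :* y := x :* (m :* y)) refl (x i) (M i j) (x j))
         (solve 3 (λ x m y → (m :* x) :* (m :* x) :+ y :* y := x :* x :* (m :* m) :+ y :* y) refl (x i) (M i j) (x j))
         (ab≤a²+b² (M i j * x i) (x j))
      step₁ : x i * mul x i ≤ x i * x i * norm i + dot x x
      step₁ = subst₂ _≤_ (trans (sym (*-distribˡ-sum (x i) (λ j → M i j * x j))) (cong (λ z → x i * z) (sym (mul-def x i))))
        (trans (∑-distrib-+ (λ j → x i * x i * (M i j * M i j)) (λ j → x j * x j))
          (cong₂ _+_ (trans (sym (*-distribˡ-sum (x i * x i) (λ j → M i j * M i j))) (cong (λ z → x i * x i * z) (sym (dot-def (M i) (M i))))) (sym (dot-def x x))))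
        (sum-mono (λ j → x i * (M i j * x j)) (λ j → x i * x i * (M i j * M i j) + x j * x j) entry)
      step₂ : x i * x i * norm i + dot x x ≤ R * (x i * x i) + 1# * dot x x
      step₂ = weigh (x i * x i) (norm i) R (dot x x) (0≤sq (x i)) (≤-sum norm (λ i → dot-self-nonneg (M i)) i)
    total-eq : ∀ x → sum (λ i → R * (x i * x i) + 1# * dot x x) ≡ (R + N) * dot x x
    total-eq x = trans (∑-distrib-+ (λ i → R * (x i * x i)) (λ _ → 1# * dot x x))
      (trans (cong₂ _+_ (trans (sym (*-distribˡ-sum R (λ i → x i * x i))) (cong (λ z → R * z) (sym (dot-def x x))))
        (trans (sum-cong-≗ {n} (λ _ → *-comm 1# (dot x x))) (trans (sym (*-distribˡ-sum {n} (dot x x) (λ _ → 1#))) (*-comm _ _))))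
        (sym (distribʳ _ _ _)))

  open SymOp mul-op public using (app-cong; self-adj)

  abstract
    eigenvector-not-orthogonal : ∀ w → ¬ (dot w w ≡ 0#) → ∃₂ λ x ν → (∀ i → mul x i ≡ ν * x i) × ¬ (dot x w ≡ 0#)
    eigenvector-not-orthogonal = Krylov.eigenvector mul-op mul-bounded

-- Two main signless Laplacian eigenvalues and collinear degree data.

module Signless (ℝ : RealField) {n : ℕ} (G : Graph n) (G-sym : ∀ u v → G u v ≡ G v u) where

  open Spectral ℝ n

  diag-sym : ∀ u v → (if u == v then natR (deg G u) else 0#) ≡ (if v == u then natR (deg G v) else 0#)
  diag-sym u v with u ≟ v | v ≟ u
  ... | yes refl | yes _ = refl
  ... | no _ | no _ = refl
  ... | yes p | no q = ⊥-elim (q (sym p))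
  ... | no p | yes q = ⊥-elim (p (sym q))

  open Matrix ℝ n (signlessLaplacian ℝ G) (λ u v → cong₂ _+_ (diag-sym u v) (cong (λ b → if b then 1# else 0#) (G-sym u v)))
    renaming (mul to app)

  ind : Fin n → Fin n → Carrier
  ind v u = if G v u then 1# else 0#

  app≡ : ∀ x v → app x v ≡ natR (deg G v) * x v + sum (λ u → ind v u * x u)
  app≡ x v = trans (mul-def x v) (trans (sum-cong-≗ (λ u → distribʳ (x u) _ _))
    (trans (∑-distrib-+ (λ u → (if v == u then natR (deg G v) else 0#) * x u) (λ u → ind v u * x u))
      (cong (λ z → z + sum (λ u → ind v u * x u)) (sum-diag v (natR (deg G v)) x))))

  ind*natR : ∀ v u m → ind v u * natR m ≡ natR (𝟙 (G v u) ℕ.* m)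
  ind*natR v u m with G v u
  ... | true = trans (*-identityˡ _) (cong natR (sym (ℕP.+-identityʳ m)))
  ... | false = zeroˡ _

  app-natR : ∀ (f : Fin n → ℕ) v → app (λ u → natR (f u)) v ≡ natR (deg G v ℕ.* f v ℕ.+ ΣN.sum (λ u → 𝟙 (G v u) ℕ.* f u))
  app-natR f v = trans (app≡ (λ u → natR (f u)) v) (sym (trans (natR-+ (deg G v ℕ.* f v) _)
    (cong₂ _+_ (natR-* (deg G v) (f v)) (trans (natR-sum (λ u → 𝟙 (G v u) ℕ.* f u)) (sum-cong-≗ (λ u → sym (ind*natR v u (f u))))))))

  -- Written as `natR 1` so that `app-natR` applies and `Q e` is computed in ℕ.
  e : V
  e _ = natR 1

  Qe : ∀ v → app e v ≡ natR (2 ℕ.* deg G v)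
  Qe v = trans (app-natR (λ _ → 1) v) (cong natR (cong₂ ℕ._+_ (ℕP.*-identityʳ (deg G v))
    (trans (ΣN.sum-cong-≗ (λ u → ℕP.*-identityʳ (𝟙 (G v u)))) (trans (sym (countTrue≡sum (G v))) (sym (ℕP.+-identityʳ _))))))

  QQe : ∀ v → app (app e) v ≡ natR (2 ℕ.* F G v)
  QQe v = trans (app-cong Qe v) (trans (app-natR (λ u → 2 ℕ.* deg G u) v) (cong natR (begin
    deg G v ℕ.* (2 ℕ.* deg G v) ℕ.+ ΣN.sum (λ u → 𝟙 (G v u) ℕ.* (2 ℕ.* deg G u))
      ≡⟨ cong₂ ℕ._+_ (swap2 (deg G v) (deg G v)) (trans (ΣN.sum-cong-≗ (λ u → swap2 (𝟙 (G v u)) (deg G u))) (sym (ΣN.*-distribˡ-sum 2 (λ u → 𝟙 (G v u) ℕ.* deg G u)))) ⟩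
    2 ℕ.* (deg G v ℕ.* deg G v) ℕ.+ 2 ℕ.* nbrDeg G v
      ≡⟨ sym (ℕP.*-distribˡ-+ 2 (deg G v ℕ.* deg G v) (nbrDeg G v)) ⟩
    2 ℕ.* F G v ∎)))
    where
    open ≡-Reasoning
    swap2 : ∀ a b → a ℕ.* (2 ℕ.* b) ≡ 2 ℕ.* (a ℕ.* b)
    swap2 = solve-∀

  dot-e : ∀ x → dot x e ≡ Σ[ x ]
  dot-e x = trans (dot-def x e) (trans (sum-cong-≗ (λ i → trans (cong (λ z → x i * z) (+-identityʳ 1#)) (*-identityʳ _))) (sym (Σ≡sum x)))

  main : ∀ {x ν} → (∀ i → app x i ≡ ν * x i) → ¬ (dot x e ≡ 0#) → IsMainEigenvalue ℝ G ν
  main {x} eig ne = x , (λ v → trans (Σ≡sum (λ u → signlessLaplacian ℝ G v u * x u)) (trans (sym (mul-def x v)) (eig v))) , λ q → ne (trans (dot-e x) q)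

  main⁻¹ : ∀ {ν} → IsMainEigenvalue ℝ G ν → ∃ λ x → (∀ i → app x i ≡ ν * x i) × ¬ (dot x e ≡ 0#)
  main⁻¹ (x , eig , ne) = x , (λ v → trans (mul-def x v) (trans (sym (Σ≡sum (λ u → signlessLaplacian ℝ G v u * x u))) (eig v))) , λ q → ne (trans (sym (dot-e x)) q)

  dot-eigen : ∀ {x ν} → (∀ i → app x i ≡ ν * x i) → ∀ y → dot x (app y) ≡ ν * dot x y
  dot-eigen {x} {ν} eig y = begin
    dot x (app y)           ≡⟨ sym (self-adj x y) ⟩
    dot (app x) y           ≡⟨ dot-cong (λ i → trans (eig i) (sym (+-identityʳ _))) (λ _ → refl) ⟩
    dot (ν ∙ x +̇ 0̇) y       ≡⟨ dot-linˡ ν x 0̇ y ⟩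
    ν * dot x y + dot 0̇ y   ≡⟨ trans (cong (λ z → ν * dot x y + z) (dot-0ˡ y (λ _ → refl))) (+-identityʳ _) ⟩
    ν * dot x y             ∎
    where open ≡-Reasoning

  quad : Carrier → Carrier → V
  quad α β = α ∙ app e +̇ (β ∙ e +̇ app (app e))

  -- Moving a polynomial in `Q` onto an eigenvector evaluates the polynomial at the eigenvalue. This
  -- links orthogonality to `quad α β` with being a root or being orthogonal to `e`.
  dot-quad : ∀ {x ν} α β → (∀ i → app x i ≡ ν * x i) → dot x (quad α β) ≡ (α * ν + β + ν * ν) * dot x e
  dot-quad {x} {ν} α β eig = trans (dot-linʳ α (app e) _ x) (trans (cong₂ (λ p q → α * p + q) (dot-eigen eig e)
    (trans (dot-linʳ β e _ x) (cong (λ z → β * dot x e + z) (trans (dot-eigen eig (app e)) (cong (λ z → ν * z) (dot-eigen eig e))))))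
    (solve 4 (λ a b n d → a :* (n :* d) :+ (b :* d :+ n :* (n :* d)) := (a :* n :+ b :+ n :* n) :* d) refl α β ν (dot x e)))

  -- The coefficients are those of `(t - μ₁)(t - μ₂)`. If `quad α β` were not zero, some eigenvector
  -- would not be orthogonal to it. By `dot-quad` it is not orthogonal to `e` either, so its
  -- eigenvalue is main, hence a root: a contradiction.
  two-main⇒quad : HasExactlyTwoMainEigenvalues ℝ G → ∃₂ λ α β → quad α β ≗ 0̇
  two-main⇒quad (μ₁ , μ₂ , _ , _ , _ , only) = α , β , go
    where
    α = - (μ₁ + μ₂)
    β = μ₁ * μ₂
    w = quad α β
    go : w ≗ 0̇
    go with dot w w ≟ᴿ 0#
    ... | yes w≡0 = dot-self≡0 w≡0
    ... | no w≢0 with eigenvector-not-orthogonal w w≢0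
    ...   | x , ν , eig , x·w≢0 = ⊥-elim (x·w≢0 (trans (dot-quad α β eig) (trans (cong (λ z → z * dot x e) root) (zeroˡ _))))
      where
      x·e≢0 : ¬ (dot x e ≡ 0#)
      x·e≢0 q = x·w≢0 (trans (dot-quad α β eig) (trans (cong (λ z → (α * ν + β + ν * ν) * z) q) (zeroʳ _)))
      root : α * ν + β + ν * ν ≡ 0#
      root with only ν (main eig x·e≢0)
      ... | inj₁ refl = solve 2 (λ a b → (:- (a :+ b)) :* a :+ a :* b :+ a :* a := con (+ 0)) refl μ₁ μ₂
      ... | inj₂ refl = solve 2 (λ a b → (:- (a :+ b)) :* b :+ a :* b :+ b :* b := con (+ 0)) refl μ₁ μ₂

  scale : ∀ a b c p q r → 4 ℕ.* (a ℕ.* q ℕ.+ b ℕ.* r ℕ.+ c ℕ.* p) ≡ 2 ℕ.* a ℕ.* (2 ℕ.* q) ℕ.+ 2 ℕ.* b ℕ.* (2 ℕ.* r) ℕ.+ 2 ℕ.* c ℕ.* (2 ℕ.* p)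
  scale = solve-∀

  -- All points satisfy the same equation `α (2d) + β + 2F = 0`, so the determinant with rows
  -- `(1, d, F)` vanishes. Its positive and negative terms stand on opposite sides to stay in ℕ; the
  -- factor 4 absorbs the two doublings.
  two-main⇒collinear : HasExactlyTwoMainEigenvalues ℝ G → ∀ u v w →
    F G u ℕ.* deg G v ℕ.+ F G v ℕ.* deg G w ℕ.+ F G w ℕ.* deg G u ≡ F G u ℕ.* deg G w ℕ.+ F G v ℕ.* deg G u ℕ.+ F G w ℕ.* deg G v
  two-main⇒collinear two u v w with two-main⇒quad two
  ... | α , β , q = ℕP.*-cancelˡ-≡ _ _ 4 (natR-injective _ _ (trans (nat-lhs (F G u) (F G v) (F G w) (deg G u) (deg G v) (deg G w))
          (trans (core (line u) (line v) (line w)) (sym (nat-lhs (F G u) (F G v) (F G w) (deg G v) (deg G w) (deg G u))))))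
    where
    f d : Fin n → Carrier
    f x = natR (2 ℕ.* F G x)
    d x = natR (2 ℕ.* deg G x)
    line : ∀ x → α * d x + (β * natR 1 + f x) ≡ 0#
    line x = trans (sym (cong₂ (λ a b → α * a + (β * natR 1 + b)) (Qe x) (QQe x))) (q x)
    nat-lhs : ∀ a b c p q r → natR (4 ℕ.* (a ℕ.* q ℕ.+ b ℕ.* r ℕ.+ c ℕ.* p)) ≡
      natR (2 ℕ.* a) * natR (2 ℕ.* q) + natR (2 ℕ.* b) * natR (2 ℕ.* r) + natR (2 ℕ.* c) * natR (2 ℕ.* p)
    nat-lhs a b c p q r = trans (cong natR (scale a b c p q r))
      (trans (natR-+ (2 ℕ.* a ℕ.* (2 ℕ.* q) ℕ.+ 2 ℕ.* b ℕ.* (2 ℕ.* r)) _)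
        (cong₂ _+_ (trans (natR-+ (2 ℕ.* a ℕ.* (2 ℕ.* q)) _) (cong₂ _+_ (natR-* (2 ℕ.* a) _) (natR-* (2 ℕ.* b) _))) (natR-* (2 ℕ.* c) _)))
    core : ∀ {p q r a b c} → α * p + (β * natR 1 + a) ≡ 0# → α * q + (β * natR 1 + b) ≡ 0# → α * r + (β * natR 1 + c) ≡ 0# →
      a * q + b * r + c * p ≡ a * r + b * p + c * q
    core {p} {q} {r} {a} {b} {c} h₁ h₂ h₃ = ≡⇐−≡0 (trans
      (solve 8 (λ α β p q r a b c → (a :* q :+ b :* r :+ c :* p) :- (a :* r :+ b :* p :+ c :* q)
          := (α :* p :+ (β :+ a)) :* (q :- r) :+ (α :* q :+ (β :+ b)) :* (r :- p) :+ (α :* r :+ (β :+ c)) :* (p :- q)) refl α (β * natR 1) p q r a b c)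
      (trans (cong₂ _+_ (cong₂ _+_ (cong (λ z → z * (q − r)) h₁) (cong (λ z → z * (r − p)) h₂)) (cong (λ z → z * (p − q)) h₃))
        (solve 3 (λ x y z → con (+ 0) :* x :+ con (+ 0) :* y :+ con (+ 0) :* z := con (+ 0)) refl (q − r) (r − p) (p − q))))

  -- Doubling `lin` gives `Q²e - A Qe + 2B e = 0`, so every main eigenvalue is a root of
  -- `t² - A t + 2B`, and a root other than `ν₁` equals `A - ν₁`. That a second one occurs comes
  -- from `w = (Q - ν₁) e`, which is nonzero because the degrees are not constant: an eigenvector
  -- not orthogonal to `w` belongs to an eigenvalue other than `ν₁`.
  linear⇒two-main : ∀ A B → (∀ v → F G v ℕ.+ B ≡ A ℕ.* deg G v) → ∀ u₀ v₀ → ¬ (deg G u₀ ≡ deg G v₀) →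
    HasExactlyTwoMainEigenvalues ℝ G
  linear⇒two-main A B lin u₀ v₀ irregular with eigenvector-not-orthogonal e e≢0
    where
    e≢0 : ¬ (dot e e ≡ 0#)
    e≢0 q = natR-suc≢0 0 (dot-self≡0 q u₀)
  ... | x₁ , ν₁ , eig₁ , x₁·e≢0 with eigenvector-not-orthogonal w w≢0
    where
    w : V
    w = (- ν₁) ∙ e +̇ app e
    value : w ≗ 0̇ → ∀ v → natR (2 ℕ.* deg G v) ≡ ν₁ * natR 1
    value p v = trans (sym (Qe v)) (≡⇐−≡0 (trans (solve 3 (λ q n o → q :- n :* o := (:- n) :* o :+ q) refl (app e v) ν₁ (natR 1)) (p v)))
    w≢0 : ¬ (dot w w ≡ 0#)
    w≢0 q = irregular (ℕP.*-cancelˡ-≡ _ _ 2 (natR-injective _ _ (trans (value (dot-self≡0 q) u₀) (sym (value (dot-self≡0 q) v₀)))))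
  ... | x₂ , ν₂ , eig₂ , x₂·w≢0 = ν₁ , ν₂ , ν₁≢ν₂ , main eig₁ x₁·e≢0 , main eig₂ x₂·e≢0 , only
    where
    x₂·w : dot x₂ ((- ν₁) ∙ e +̇ app e) ≡ (ν₂ − ν₁) * dot x₂ e
    x₂·w = trans (dot-linʳ (- ν₁) e (app e) x₂) (trans (cong (λ z → (- ν₁) * dot x₂ e + z) (dot-eigen eig₂ e))
      (solve 3 (λ a b d → (:- a) :* d :+ b :* d := (b :- a) :* d) refl ν₁ ν₂ (dot x₂ e)))
    ν₁≢ν₂ : ¬ (ν₁ ≡ ν₂)
    ν₁≢ν₂ q = x₂·w≢0 (trans x₂·w (trans (cong (λ z → z * dot x₂ e) (−≡0 (sym q))) (zeroˡ _)))
    x₂·e≢0 : ¬ (dot x₂ e ≡ 0#)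
    x₂·e≢0 q = x₂·w≢0 (trans x₂·w (trans (cong (λ z → (ν₂ − ν₁) * z) q) (zeroʳ _)))
    a b : Carrier
    a = natR A
    b = natR (2 ℕ.* B)
    quad≡0 : quad (- a) b ≗ 0̇
    quad≡0 v = trans (cong₂ (λ p q → (- a) * p + (b * natR 1 + q)) (Qe v) (QQe v))
      (trans (cong₂ (λ o z → (- a) * natR (2 ℕ.* deg G v) + (b * o + z)) (+-identityʳ 1#) refl)
      (trans (solve 5 (λ a d b f o → (:- a) :* d :+ (b :* o :+ f) := (f :+ b :* o) :- a :* d) refl a (natR (2 ℕ.* deg G v)) b (natR (2 ℕ.* F G v)) 1#)
      (−≡0 (trans (cong (λ z → natR (2 ℕ.* F G v) + z) (*-identityʳ b)) (trans (sym (natR-+ (2 ℕ.* F G v) (2 ℕ.* B)))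
        (trans (cong natR (trans (sym (ℕP.*-distribˡ-+ 2 (F G v) B)) (trans (cong (2 ℕ.*_) (lin v)) (trans (sym (ℕP.*-assoc 2 A _))
          (trans (cong (ℕ._* deg G v) (ℕP.*-comm 2 A)) (ℕP.*-assoc A 2 _)))))) (natR-* A (2 ℕ.* deg G v))))))))
    root : ∀ ν → IsMainEigenvalue ℝ G ν → (- a) * ν + b + ν * ν ≡ 0#
    root ν m with main⁻¹ m
    ... | x , eig , ne = *-zero-cancel ne (trans (*-comm _ _) (trans (sym (dot-quad (- a) b eig)) (dot-0ʳ x quad≡0)))
    only : ∀ ν → IsMainEigenvalue ℝ G ν → ν ≡ ν₁ ⊎ ν ≡ ν₂
    only ν m with ν ≟ᴿ ν₁
    ... | yes p = inj₁ p
    ... | no p = inj₂ (trans (other m p) (sym (other (main eig₂ x₂·e≢0) (λ q → ν₁≢ν₂ (sym q)))))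
      where
      other : ∀ {ν} → IsMainEigenvalue ℝ G ν → ¬ (ν ≡ ν₁) → ν ≡ a − ν₁
      other {ν} m p = ≡⇐−≡0 (*-zero-cancel (λ q → p (≡⇐−≡0 q)) (trans
        (solve 4 (λ ν ν₁ a b → (ν :- ν₁) :* (ν :- (a :- ν₁)) := ((:- a) :* ν :+ b :+ ν :* ν) :- ((:- a) :* ν₁ :+ b :+ ν₁ :* ν₁)) refl ν ν₁ a b)
        (−≡0 (trans (root ν m) (sym (root ν₁ (main eig₁ x₁·e≢0)))))))

-- Unicyclic graphs

open import Data.Nat using (_+_; _*_; _∸_; _≤_; _<_; z≤n; s≤s; _≤?_; _<?_)

sum-mono-ℕ : ∀ {n} (f g : Fin n → ℕ) → (∀ i → f i ≤ g i) → ΣN.sum f ≤ ΣN.sum g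
sum-mono-ℕ {zero} f g p = z≤n
sum-mono-ℕ {suc n} f g p = ℕP.+-mono-≤ (p Fin.zero) (sum-mono-ℕ _ _ (λ i → p (Fin.suc i)))

sum-diag-ℕ : ∀ {n} (v : Fin n) (f : Fin n → ℕ) → ΣN.sum (λ u → 𝟙 (v == u) * f u) ≡ f v
sum-diag-ℕ {suc n} Fin.zero f = trans (cong₂ _+_ (ℕP.*-identityˡ (f Fin.zero)) (ΣN.sum-replicate-zero n)) (ℕP.+-identityʳ _)
sum-diag-ℕ {suc n} (Fin.suc v) f = sum-diag-ℕ v (λ i → f (Fin.suc i))

==-refl : ∀ {n} (u : Fin n) → (u == u) ≡ true
==-refl u with u ≟ u
... | yes _ = refl
... | no p = ⊥-elim (p refl)

==⇒≡ : ∀ {n} {u v : Fin n} → (u == v) ≡ true → u ≡ v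
==⇒≡ {u = u} {v} e with u ≟ v
... | yes q = q

T⇒≡true : ∀ {b} → T b → b ≡ true
T⇒≡true = Equivalence.to T-≡

≡true⇒T : ∀ {b} → b ≡ true → T b
≡true⇒T = Equivalence.from T-≡

≡ᵇ-true : ∀ {m n} → (m ≡ᵇ n) ≡ true → m ≡ n
≡ᵇ-true e = ℕP.≡ᵇ⇒≡ _ _ (≡true⇒T e)

true-≡ᵇ : ∀ {m n} → m ≡ n → (m ≡ᵇ n) ≡ true
true-≡ᵇ e = T⇒≡true (ℕP.≡⇒≡ᵇ _ _ e)

-- c runs around the cycle for ever; it is injective on every window of r consecutive indices, a form of
-- injectivity that survives a change of origin.
record Skeleton {n} (G : Graph n) : Set where
  field
    len           : ℕ
    c             : ℕ → Fin n
  r : ℕ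
  r = 3 + len
  field
    period        : ∀ i → c (r + i) ≡ c i
    window-inj    : ∀ i d → d < r → c i ≡ c (d + i) → d ≡ 0
    adjacent      : ∀ i → G (c i) (c (suc i)) ≡ true
    -- Stated at index `suc i`, so that both cycle neighbours have indices without subtraction.
    chordless     : ∀ i k → G (c (suc i)) (c k) ≡ true → c k ≡ c i ⊎ c k ≡ c (2 + i)
    dist          : Fin n → ℕ
    dist-c        : ∀ i → dist (c i) ≡ 0
    dist≡0        : ∀ v → dist v ≡ 0 → ∃ λ i → c i ≡ v
    dist-step     : ∀ v w → G v w ≡ true → dist v ≤ suc (dist w)
    descend       : ∀ v k → dist v ≡ suc k → ∃ λ w → G v w ≡ true × dist w ≡ k
    -- With `≤` rather than `<`, this also rules out edges between two vertices at the same positive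
    -- distance.
    parent-unique : ∀ v w₁ w₂ → ¬ (dist v ≡ 0) → G v w₁ ≡ true → G v w₂ ≡ true →
                    dist w₁ ≤ dist v → dist w₂ ≤ dist v → w₁ ≡ w₂

  period* : ∀ m i → c (m * r + i) ≡ c i
  period* zero i = refl
  period* (suc m) i = trans (cong c (ℕP.+-assoc r (m * r) i)) (trans (period (m * r + i)) (period* m i))

  c-mod : ∀ i → c (i % r) ≡ c i
  c-mod i = trans (sym (period* (i / r) (i % r))) (cong c (trans (ℕP.+-comm _ (i % r)) (sym (m≡m%n+[m/n]*n i r))))

least : ∀ {P : ℕ → Set} → (∀ k → Dec (P k)) → ∀ k → P k → ∃ λ m → P m × (∀ j → P j → m ≤ j)
least P? zero p = 0 , p , λ _ _ → z≤n
least {P} P? (suc k) p with P? 0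
... | yes p₀ = 0 , p₀ , λ _ _ → z≤n
... | no ¬p₀ with least (λ j → P? (suc j)) k p
...   | m , pm , min = suc m , pm , λ { zero p₀ → ⊥-elim (¬p₀ p₀) ; (suc j) q → s≤s (min j q) }

-- The cycle, distances to it and unique parents in a unicyclic graph.

module Analysis {n} (G : Graph n) (simple : IsSimple G) (uni : Unicyclic G) where
  open IsSimple simple
  open Unicyclic uni

  infix 4 _~_
  _~_ : Fin n → Fin n → Set
  u ~ v = G u v ≡ true

  ~-sym : ∀ {u v} → u ~ v → v ~ u
  ~-sym {u} {v} p = trans (symmetric v u) p

  ~⇒≢ : ∀ {u v} → u ~ v → u ≢ v
  ~⇒≢ {u} p refl with trans (sym p) (irreflexive u)
  ... | ()

  -- Walks in `G` with `v` deleted: when one connects two different neighbours of `v`, then `v` lies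
  -- on a cycle with them.
  data Walk (v : Fin n) : Fin n → Fin n → Set where
    stop : ∀ {a} → a ≢ v → Walk v a a
    _▸_  : ∀ {a b d} → (a ≢ v × a ~ b) → Walk v b d → Walk v a d

  snoc : ∀ {v a b d} → Walk v a b → b ~ d → d ≢ v → Walk v a d
  snoc (stop p) q r = (p , q) ▸ stop r
  snoc (p ▸ w) q r = p ▸ snoc w q r

  join : ∀ {v a b z} → Walk v a z → Walk v b z → Walk v b a
  join (stop p) w = w
  join ((p , q) ▸ w) w′ = snoc (join w w′) (~-sym q) p

  record Path (v a b : Fin n) : Set where
    field
      m      : ℕ
      p      : ℕ → Fin n
      start  : p 0 ≡ a
      end    : p m ≡ b
      steps  : ∀ i → i < m → p i ~ p (suc i)
      simp   : ∀ i j → i ≤ m → j ≤ m → p i ≡ p j → i ≡ j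
      avoid  : ∀ i → i ≤ m → p i ≢ v

  -- When the new first vertex already occurs on the path, everything before that occurrence is
  -- dropped.
  loop-erase : ∀ {v a b} → Walk v a b → Path v a b
  loop-erase {a = a} (stop q) = record
    { m = 0 ; p = λ _ → a ; start = refl ; end = refl ; steps = λ _ ()
    ; simp = λ { _ _ z≤n z≤n _ → refl } ; avoid = λ _ _ → q }
  loop-erase {v} {a} {b} ((a≢v , a~d) ▸ w) = extend (loop-erase w)
    where
    extend : Path v _ b → Path v a b
    extend P with ℕP.anyUpTo? (λ i → Path.p P i ≟ a) (suc (Path.m P))
    ... | yes (i , s≤s i≤m , pi≡a) = record
      { m = m ∸ i ; p = λ k → p (i + k)
      ; start = trans (cong p (ℕP.+-identityʳ i)) pi≡a
      ; end = trans (cong p (ℕP.m+[n∸m]≡n i≤m)) end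
      ; steps = λ k k<m → subst (λ z → p (i + k) ~ p z) (sym (ℕP.+-suc i k))
          (steps (i + k) (subst (i + k <_) (ℕP.m+[n∸m]≡n i≤m) (ℕP.+-monoʳ-< i k<m)))
      ; simp = λ k l k≤ l≤ e → ℕP.+-cancelˡ-≡ i k l (simp (i + k) (i + l) (inRange k≤) (inRange l≤) e)
      ; avoid = λ k k≤ → avoid (i + k) (inRange k≤) }
      where
      open Path P
      inRange : ∀ {k} → k ≤ m ∸ i → i + k ≤ m
      inRange {k} q = subst (i + k ≤_) (ℕP.m+[n∸m]≡n i≤m) (ℕP.+-monoʳ-≤ i q)
    ... | no ¬q = record
      { m = suc m ; p = p′ ; start = refl ; end = end
      ; steps = λ { zero _ → subst (a ~_) (sym start) a~d ; (suc k) (s≤s q) → steps k q }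
      ; simp = simp′
      ; avoid = λ { zero _ → a≢v ; (suc k) (s≤s q) → avoid k q } }
      where
      open Path P
      p′ : ℕ → Fin n
      p′ zero = a
      p′ (suc k) = p k
      simp′ : ∀ i j → i ≤ suc m → j ≤ suc m → p′ i ≡ p′ j → i ≡ j
      simp′ zero zero _ _ _ = refl
      simp′ zero (suc j) _ q e = ⊥-elim (¬q (j , q , sym e))
      simp′ (suc i) zero q _ e = ⊥-elim (¬q (i , q , e))
      simp′ (suc i) (suc j) (s≤s q) (s≤s q′) e = cong suc (simp i j q q′ e)

  -- Loop erasure leaves a simple path from `w₁` to `w₂` off `v`, and `v` closes it up. Since
  -- `w₁ ≢ w₂` the path has at least two vertices, so the cycle has at least three.
  cycle-through : ∀ {v w₁ w₂} → v ~ w₁ → v ~ w₂ → w₁ ≢ w₂ → Walk v w₁ w₂ → ∃ λ C → CycleEdge {G = G} C v w₁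
  cycle-through {v} {w₁} {w₂} v~w₁ v~w₂ w₁≢w₂ w = close-up (loop-erase w)
    where
    close-up : Path v w₁ w₂ → ∃ λ C → CycleEdge {G = G} C v w₁
    close-up record { m = zero ; start = s ; end = e } = ⊥-elim (w₁≢w₂ (trans (sym s) e))
    close-up record { m = suc l ; p = p ; start = s ; end = e ; steps = steps ; simp = simp ; avoid = avoid } =
      record { len = l ; vtx = vtx ; inj = inj _ _ ; adjs = adjs
             ; close = ≡true⇒T (~-sym (subst (v ~_) (sym (trans (cong p (toℕ-fromℕ (suc l))) e)) v~w₂)) }
      , inj₁ (Fin.zero , inj₁ (refl , sym s))
      where
      vtx : Fin (3 + l) → Fin n
      vtx Fin.zero = v
      vtx (Fin.suc i) = p (toℕ i)
      bound : ∀ (i : Fin (2 + l)) → toℕ i ≤ suc l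
      bound i = ℕP.<⇒≤pred (toℕ<n i)
      inj : ∀ i j → vtx i ≡ vtx j → i ≡ j
      inj Fin.zero Fin.zero _ = refl
      inj Fin.zero (Fin.suc j) q = ⊥-elim (avoid _ (bound j) (sym q))
      inj (Fin.suc i) Fin.zero q = ⊥-elim (avoid _ (bound i) q)
      inj (Fin.suc i) (Fin.suc j) q = cong Fin.suc (toℕ-injective (simp _ _ (bound i) (bound j) q))
      adjs : ∀ (i : Fin (2 + l)) → T (G (vtx (inject₁ i)) (vtx (Fin.suc i)))
      adjs Fin.zero = ≡true⇒T (subst (v ~_) (sym s) v~w₁)
      adjs (Fin.suc i) = ≡true⇒T (subst (λ k → p k ~ p (suc (toℕ i))) (sym (toℕ-inject₁ i)) (steps (toℕ i) (toℕ<n i)))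

  open Cycle aCycle

  r : ℕ
  r = 3 + len

  c : ℕ → Fin n
  c i = vtx (i mod r)

  mod≡ : ∀ a b → a % r ≡ b % r → c a ≡ c b
  mod≡ a b e = cong vtx (toℕ-injective (trans (toℕ-fromℕ< (m%n<n a r)) (trans e (sym (toℕ-fromℕ< (m%n<n b r))))))

  ≡mod : ∀ a b → c a ≡ c b → a % r ≡ b % r
  ≡mod a b e = trans (sym (toℕ-fromℕ< (m%n<n a r))) (trans (cong toℕ (inj e)) (toℕ-fromℕ< (m%n<n b r)))

  period : ∀ i → c (r + i) ≡ c i
  period i = mod≡ (r + i) i (trans (cong (_% r) (ℕP.+-comm r i)) ([m+n]%n≡m%n i r))

  c-+ : ∀ k a b → c a ≡ c b → c (k + a) ≡ c (k + b)
  c-+ k a b e = mod≡ (k + a) (k + b) (trans (%-distribˡ-+ k a r)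
    (trans (cong (λ z → (k % r + z) % r) (≡mod a b e)) (sym (%-distribˡ-+ k b r))))

  c-pred : ∀ a b → c (suc a) ≡ c (suc b) → c a ≡ c b
  c-pred a b e = trans (sym (shift a)) (trans (c-+ (2 + len) (suc a) (suc b) e) (shift b))
    where
    shift : ∀ a → c (2 + len + suc a) ≡ c a
    shift a = trans (cong c (ℕP.+-suc (2 + len) a)) (period a)

  c-toℕ : ∀ k → c (toℕ k) ≡ vtx k
  c-toℕ k = cong vtx (toℕ-injective (trans (toℕ-fromℕ< (m%n<n (toℕ k) r)) (m<n⇒m%n≡m (toℕ<n k))))

  -- The sum `d + i % r` is below `2 r`. If it is below `r`, reduction changes nothing and `d = 0`;
  -- otherwise reduction subtracts `r` once, which would give `d = r`.
  window-inj : ∀ i d → d < r → c i ≡ c (d + i) → d ≡ 0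
  window-inj i d d<r e with suc (d + i % r) ≤? r
  ... | yes p = ℕP.+-cancelʳ-≡ (i % r) d 0 (trans (sym (m<n⇒m%n≡m p)) (sym small))
    where
    small : i % r ≡ (d + i % r) % r
    small = trans (≡mod i (d + i) e) (trans (%-distribˡ-+ d i r) (cong (λ z → (z + i % r) % r) (m<n⇒m%n≡m d<r)))
  ... | no p = ⊥-elim (ℕP.<-irrefl d≡r d<r)
    where
    big : r ≤ d + i % r
    big = ℕP.≮⇒≥ p
    x = d + i % r ∸ r
    x+r : x + r ≡ d + i % r
    x+r = ℕP.m∸n+n≡m big
    x<r : x < r
    x<r = ℕP.+-cancelʳ-< r x r (subst (_< r + r) (sym x+r) (ℕP.+-mono-< d<r (m%n<n i r)))
    small : i % r ≡ x
    small = trans (≡mod i (d + i) e) (trans (%-distribˡ-+ d i r) (trans (cong (λ z → (z + i % r) % r) (m<n⇒m%n≡m d<r))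
      (trans (cong (_% r) (sym x+r)) (trans ([m+n]%n≡m%n x r) (m<n⇒m%n≡m x<r)))))
    d≡r : d ≡ r
    d≡r = ℕP.+-cancelʳ-≡ (i % r) d r (trans (sym x+r) (trans (cong (_+ r) (sym small)) (ℕP.+-comm (i % r) r)))

  adjacent : ∀ i → c i ~ c (suc i)
  adjacent i = subst₂ _~_ (sym c-i) (sym (trans (c-+ 1 i j (mod≡ i j (sym (m%n%n≡m%n i r)))) refl)) base
    where
    j = i % r
    c-i : c i ≡ c j
    c-i = mod≡ i j (sym (m%n%n≡m%n i r))
    base : c j ~ c (suc j)
    base with suc (suc j) ≤? r
    ... | yes (s≤s p) = subst₂ _~_ (trans (sym (c-toℕ _)) (cong c (trans (toℕ-inject₁ k) (toℕ-fromℕ< p))))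
                         (trans (sym (c-toℕ _)) (cong (λ z → c (suc z)) (toℕ-fromℕ< p))) (T⇒≡true (adjs k))
      where k = fromℕ< p
    ... | no p = subst₂ _~_ (trans (sym (c-toℕ _)) (cong c (trans (toℕ-fromℕ (2 + len)) (sym (cong ℕ.pred last)))))
                   (trans (sym (c-toℕ Fin.zero)) (trans (sym (period 0)) (cong c (trans (ℕP.+-identityʳ r) (sym last))))) (T⇒≡true close)
      where
      last : suc j ≡ r
      last = ℕP.≤-antisym (m%n<n i r) (ℕP.≤-pred (ℕP.≰⇒> p))

  cycle-edge : ∀ {u v} → CycleEdge aCycle u v → ∃ λ i → (u ≡ c i × v ≡ c (suc i)) ⊎ (v ≡ c i × u ≡ c (suc i))
  cycle-edge (inj₁ (i , inj₁ (p , q))) = toℕ i , inj₁ (trans p (at i) , trans q (at′ i))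
    where
    at : ∀ i → vtx (inject₁ i) ≡ c (toℕ i)
    at i = trans (sym (c-toℕ _)) (cong c (toℕ-inject₁ i))
    at′ : ∀ i → vtx (Fin.suc i) ≡ c (suc (toℕ i))
    at′ i = sym (c-toℕ (Fin.suc i))
  cycle-edge (inj₁ (i , inj₂ (p , q))) = toℕ i , inj₂ (trans p (trans (sym (c-toℕ _)) (cong c (toℕ-inject₁ i))) , trans q (sym (c-toℕ (Fin.suc i))))
  cycle-edge (inj₂ (inj₁ (p , q))) = 2 + len , inj₁ (trans p (trans (sym (c-toℕ _)) (cong c (toℕ-fromℕ (2 + len)))) ,
    trans q (trans (sym (c-toℕ Fin.zero)) (trans (sym (period 0)) (cong c (ℕP.+-identityʳ r)))))
  cycle-edge (inj₂ (inj₂ (p , q))) = 2 + len , inj₂ (trans p (trans (sym (c-toℕ _)) (cong c (toℕ-fromℕ (2 + len)))) ,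
    trans q (trans (sym (c-toℕ Fin.zero)) (trans (sym (period 0)) (cong c (ℕP.+-identityʳ r)))))

  -- This is where uniqueness enters: the cycle just closed up has the same edges as `aCycle`, so
  -- the edge from `v` to `w₁` is one of its edges.
  on-cycle : ∀ {v w₁ w₂} → v ~ w₁ → v ~ w₂ → w₁ ≢ w₂ → Walk v w₁ w₂ →
    ∃ λ i → (v ≡ c i × w₁ ≡ c (suc i)) ⊎ (w₁ ≡ c i × v ≡ c (suc i))
  on-cycle {v} {w₁} p q ne w with cycle-through p q ne w
  ... | C , e = cycle-edge (Equivalence.to (unique C aCycle v w₁) e)

  window : ∀ s k → ∃ λ j → j < r × c k ≡ c (j + s)
  window s k = j , m%n<n k′ r , (begin
    c k                ≡⟨ mod≡ k (k + s * r) (sym ([m+kn]%n≡m%n k s r)) ⟩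
    c (k + s * r)      ≡⟨ cong c (eq k s (2 + len)) ⟩
    c (s + k′)         ≡⟨ c-+ s k′ j (mod≡ k′ j (sym (m%n%n≡m%n k′ r))) ⟩
    c (s + j)          ≡⟨ cong c (ℕP.+-comm s j) ⟩
    c (j + s)          ∎)
    where
    open ≡-Reasoning
    -- Represents `k - s` modulo `r`, since `2 + len` is `r - 1`.
    k′ = k + s * (2 + len)
    j = k′ % r
    eq : ∀ k s l → k + s * (1 + l) ≡ s + (k + s * l)
    eq = solve-∀

  -- If `c k` is not `c (2 + i)`, going back along the cycle from `c k` to `c (2 + i)` avoids
  -- `c (suc i)`. By `on-cycle` the edge to `c k` is then an edge of the cycle itself, so it leads
  -- to one of the two cycle neighbours.
  chordless : ∀ i k → c (suc i) ~ c k → c k ≡ c i ⊎ c k ≡ c (2 + i)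
  chordless i k e with window (2 + i) k
  ... | j , j<r , ck≡ with c k ≟ c (2 + i)
  ...   | yes p = inj₂ p
  ...   | no p = conclude (on-cycle e (adjacent (suc i)) p (subst (λ w → Walk (c (suc i)) w (c (2 + i))) (sym ck≡) (along j j<r-1)))
    where
    j<r-1 : suc j < r
    j<r-1 with suc j ℕP.≟ r
    ... | no q = ℕP.≤∧≢⇒< j<r q
    ... | yes q = ⊥-elim (~⇒≢ e (sym (trans ck≡ (trans (cong c (trans (ℕP.+-suc j (suc i)) (cong (_+ suc i) q))) (period (suc i))))))
    off : ∀ j → suc j < r → c (j + (2 + i)) ≢ c (suc i)
    off j q eq with window-inj (suc i) (suc j) q (trans (sym eq) (cong c (ℕP.+-suc j (suc i))))
    ... | ()
    along : ∀ j → suc j < r → Walk (c (suc i)) (c (j + (2 + i))) (c (2 + i))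
    along zero q = stop (off 0 q)
    along (suc j) q = (off (suc j) q , ~-sym (adjacent (j + (2 + i)))) ▸ along j (ℕP.<-trans (ℕP.n<1+n _) q)
    conclude : (∃ λ l → (c (suc i) ≡ c l × c k ≡ c (suc l)) ⊎ (c k ≡ c l × c (suc i) ≡ c (suc l))) → c k ≡ c i ⊎ c k ≡ c (2 + i)
    conclude (l , inj₁ (a , b)) = inj₂ (trans b (sym (c-+ 1 (suc i) l a)))
    conclude (l , inj₂ (a , b)) = inj₁ (trans a (sym (c-pred i l b)))

  -- Distance at most `k` from the cycle, in a decidable form: `Reach` only supplies some bound, and
  -- `least` then extracts the distance.
  Near : ℕ → Fin n → Set
  Near zero v = ∃ λ i → i < r × c i ≡ v
  Near (suc k) v = Near k v ⊎ (∃ λ w → v ~ w × Near k w)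

  near? : ∀ k v → Dec (Near k v)
  near? zero v = ℕP.anyUpTo? (λ i → c i ≟ v) r
  near? (suc k) v = near? k v ⊎-dec any? (λ w → (G v w BoolP.≟ true) ×-dec near? k w)

  reach⇒near : ∀ {v} → Reach G v (c 0) → ∃ λ k → Near k v
  reach⇒near here = 0 , 0 , s≤s z≤n , refl
  reach⇒near (step e p) with reach⇒near p
  ... | k , q = suc k , inj₂ (_ , T⇒≡true e , q)

  nearest : ∀ v → ∃ λ m → Near m v × (∀ j → Near j v → m ≤ j)
  nearest v with reach⇒near (connected v (c 0))
  ... | k , q = least (λ j → near? j v) k q

  dist : Fin n → ℕ
  dist v = proj₁ (nearest v)

  near-dist : ∀ v → Near (dist v) v
  near-dist v = proj₁ (proj₂ (nearest v))

  dist-min : ∀ v j → Near j v → dist v ≤ j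
  dist-min v = proj₂ (proj₂ (nearest v))

  dist-c : ∀ i → dist (c i) ≡ 0
  dist-c i = ℕP.n≤0⇒n≡0 (dist-min (c i) 0 (i % r , m%n<n i r , mod≡ (i % r) i (m%n%n≡m%n i r)))

  dist≡0 : ∀ v → dist v ≡ 0 → ∃ λ i → c i ≡ v
  dist≡0 v e with subst (λ k → Near k v) e (near-dist v)
  ... | i , _ , q = i , q

  dist-step : ∀ v w → v ~ w → dist v ≤ suc (dist w)
  dist-step v w e = dist-min v (suc (dist w)) (inj₂ (w , e , near-dist w))

  descend : ∀ v k → dist v ≡ suc k → ∃ λ w → v ~ w × dist w ≡ k
  descend v k e with subst (λ k → Near k v) e (near-dist v)
  ... | inj₁ q = ⊥-elim (ℕP.<-irrefl refl (subst (_≤ k) e (dist-min v k q)))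
  ... | inj₂ (w , v~w , q) = w , v~w , ℕP.≤-antisym (dist-min w k q) (ℕP.≤-pred (subst (_≤ suc (dist w)) e (dist-step v w v~w)))

  -- After the first step down, every vertex is strictly closer to the cycle than `v`, so the
  -- descent cannot meet `v`; the rest runs along the cycle, where `v` is not.
  walk-to-cycle : ∀ v → ¬ (dist v ≡ 0) → ∀ k w → dist w ≡ k → k ≤ dist v → w ≢ v → Walk v w (c 0)
  walk-to-cycle v off zero w e _ w≢v with dist≡0 w e
  ... | i , refl = around i
    where
    around : ∀ i → Walk v (c i) (c 0)
    around zero = stop (λ q → off (trans (cong dist (sym q)) (dist-c 0)))
    around (suc i) = ((λ q → off (trans (cong dist (sym q)) (dist-c (suc i)))) , ~-sym (adjacent i)) ▸ around i
  walk-to-cycle v off (suc k) w e k<d w≢v with descend w k e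
  ... | w′ , w~w′ , e′ = (w≢v , w~w′) ▸ walk-to-cycle v off k w′ e′ (ℕP.<⇒≤ k<d)
          (λ q → ℕP.<-irrefl (trans (sym e′) (cong dist q)) k<d)

  -- The walks from both neighbours to `c 0` connect them outside `v`, so two different ones would
  -- put `v` on the cycle, where the distance is 0.
  parent-unique : ∀ v w₁ w₂ → ¬ (dist v ≡ 0) → v ~ w₁ → v ~ w₂ → dist w₁ ≤ dist v → dist w₂ ≤ dist v → w₁ ≡ w₂
  parent-unique v w₁ w₂ off p₁ p₂ l₁ l₂ with w₁ ≟ w₂
  ... | yes q = q
  ... | no q with on-cycle p₁ p₂ q (join (walk-to-cycle v off _ w₂ refl l₂ (λ z → ~⇒≢ p₂ (sym z))) (walk-to-cycle v off _ w₁ refl l₁ (λ z → ~⇒≢ p₁ (sym z))))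
  ...   | i , inj₁ (e , _) = ⊥-elim (off (trans (cong dist e) (dist-c i)))
  ...   | i , inj₂ (_ , e) = ⊥-elim (off (trans (cong dist e) (dist-c (suc i))))

  skeleton : Skeleton G
  skeleton = record
    { len = len ; c = c ; period = period ; window-inj = window-inj ; adjacent = adjacent ; chordless = chordless
    ; dist = dist ; dist-c = dist-c ; dist≡0 = dist≡0 ; dist-step = dist-step ; descend = descend ; parent-unique = parent-unique }

true≢false : ∀ {b} → b ≡ true → b ≡ false → ⊥
true≢false refl ()

argmax : ∀ {n} (f : Fin n → ℕ) → Fin n → ∃ λ x → ∀ v → f v ≤ f x
argmax {suc zero} f _ = Fin.zero , λ { Fin.zero → ℕP.≤-refl }
argmax {suc (suc n)} f _ with argmax (λ i → f (Fin.suc i)) Fin.zero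
... | x , m with ℕP.≤-total (f Fin.zero) (f (Fin.suc x))
...   | inj₁ p = Fin.suc x , λ { Fin.zero → p ; (Fin.suc i) → m i }
...   | inj₂ p = Fin.zero , λ { Fin.zero → ℕP.≤-refl ; (Fin.suc i) → ℕP.≤-trans (m i) p }

-- Sums over neighbourhoods.

module Neighbours {n} (G : Graph n) where

  N : (Fin n → ℕ) → Fin n → ℕ
  N f v = ΣN.sum (λ u → 𝟙 (G v u) * f u)

  N1≡deg : ∀ v → N (λ _ → 1) v ≡ deg G v
  N1≡deg v = trans (ΣN.sum-cong-≗ (λ u → ℕP.*-identityʳ (𝟙 (G v u)))) (sym (countTrue≡sum (G v)))

  N-const : ∀ e v → ΣN.sum (λ u → 𝟙 (G v u) * e) ≡ deg G v * e
  N-const e v = trans (sym (ΣN.*-distribʳ-sum e (λ u → 𝟙 (G v u)))) (cong (_* e) (sym (countTrue≡sum (G v))))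

  -- The term `deg G v * e` counts `z` as if it also had the value `e`; the `e` on the left
  -- compensates without subtraction. `N-two` does the same for two exceptional neighbours.
  N-one : ∀ f v z e → G v z ≡ true → (∀ u → G v u ≡ true → u ≢ z → f u ≡ e) → N f v + e ≡ f z + deg G v * e
  N-one f v z e v~z others = begin
    N f v + e
      ≡⟨ cong (N f v +_) (sym (sum-diag-ℕ z (λ _ → e))) ⟩
    N f v + ΣN.sum (λ u → 𝟙 (z == u) * e)
      ≡⟨ sym (ΣN.∑-distrib-+ (λ u → 𝟙 (G v u) * f u) (λ u → 𝟙 (z == u) * e)) ⟩
    ΣN.sum (λ u → 𝟙 (G v u) * f u + 𝟙 (z == u) * e)
      ≡⟨ ΣN.sum-cong-≗ pointwise ⟩
    ΣN.sum (λ u → 𝟙 (z == u) * f u + 𝟙 (G v u) * e)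
      ≡⟨ ΣN.∑-distrib-+ (λ u → 𝟙 (z == u) * f u) (λ u → 𝟙 (G v u) * e) ⟩
    ΣN.sum (λ u → 𝟙 (z == u) * f u) + ΣN.sum (λ u → 𝟙 (G v u) * e)
      ≡⟨ cong₂ _+_ (sum-diag-ℕ z f) (N-const e v) ⟩
    f z + deg G v * e ∎
    where
    open ≡-Reasoning
    pointwise : ∀ u → 𝟙 (G v u) * f u + 𝟙 (z == u) * e ≡ 𝟙 (z == u) * f u + 𝟙 (G v u) * e
    pointwise u with z ≟ u
    ... | yes refl rewrite v~z = refl
    ... | no z≢u with G v u in eq
    ...   | true = trans (ℕP.+-identityʳ _) (cong (1 *_) (others u eq (λ q → z≢u (sym q))))
    ...   | false = refl

  N-two : ∀ f v z₁ z₂ e → z₁ ≢ z₂ → G v z₁ ≡ true → G v z₂ ≡ true →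
    (∀ u → G v u ≡ true → u ≢ z₁ → u ≢ z₂ → f u ≡ e) → N f v + (e + e) ≡ f z₁ + f z₂ + deg G v * e
  N-two f v z₁ z₂ e z₁≢z₂ v~z₁ v~z₂ others = begin
    N f v + (e + e)
      ≡⟨ cong (N f v +_) (sym (trans (ΣN.∑-distrib-+ (λ u → 𝟙 (z₁ == u) * e) (λ u → 𝟙 (z₂ == u) * e)) (cong₂ _+_ (sum-diag-ℕ z₁ (λ _ → e)) (sum-diag-ℕ z₂ (λ _ → e))))) ⟩
    N f v + ΣN.sum (λ u → 𝟙 (z₁ == u) * e + 𝟙 (z₂ == u) * e)
      ≡⟨ sym (ΣN.∑-distrib-+ (λ u → 𝟙 (G v u) * f u) (λ u → 𝟙 (z₁ == u) * e + 𝟙 (z₂ == u) * e)) ⟩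
    ΣN.sum (λ u → 𝟙 (G v u) * f u + (𝟙 (z₁ == u) * e + 𝟙 (z₂ == u) * e))
      ≡⟨ ΣN.sum-cong-≗ pointwise ⟩
    ΣN.sum (λ u → 𝟙 (z₁ == u) * f u + 𝟙 (z₂ == u) * f u + 𝟙 (G v u) * e)
      ≡⟨ ΣN.∑-distrib-+ (λ u → 𝟙 (z₁ == u) * f u + 𝟙 (z₂ == u) * f u) (λ u → 𝟙 (G v u) * e) ⟩
    ΣN.sum (λ u → 𝟙 (z₁ == u) * f u + 𝟙 (z₂ == u) * f u) + ΣN.sum (λ u → 𝟙 (G v u) * e)
      ≡⟨ cong₂ _+_ (trans (ΣN.∑-distrib-+ (λ u → 𝟙 (z₁ == u) * f u) (λ u → 𝟙 (z₂ == u) * f u)) (cong₂ _+_ (sum-diag-ℕ z₁ f) (sum-diag-ℕ z₂ f))) (N-const e v) ⟩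
    f z₁ + f z₂ + deg G v * e ∎
    where
    open ≡-Reasoning
    first : ∀ x e → 1 * x + (1 * e + 0) ≡ 1 * x + 0 + 1 * e
    first = solve-∀
    second : ∀ x e → 1 * x + (0 + 1 * e) ≡ 0 + 1 * x + 1 * e
    second = solve-∀
    pointwise : ∀ u → 𝟙 (G v u) * f u + (𝟙 (z₁ == u) * e + 𝟙 (z₂ == u) * e) ≡ 𝟙 (z₁ == u) * f u + 𝟙 (z₂ == u) * f u + 𝟙 (G v u) * e
    pointwise u with z₁ ≟ u | z₂ ≟ u
    ... | yes refl | yes q = ⊥-elim (z₁≢z₂ (sym q))
    ... | yes refl | no _ rewrite v~z₁ = first (f z₁) e
    ... | no _ | yes refl rewrite v~z₂ = second (f z₂) e
    ... | no p | no q with G v u in eq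
    ...   | true = trans (ℕP.+-identityʳ _) (cong (1 *_) (others u eq (λ q → p (sym q)) (λ p → q (sym p))))
    ...   | false = refl

  Only : Fin n → Fin n → Set
  Only v p = G v p ≡ true × (∀ u → G v u ≡ true → u ≡ p)

  N-only : ∀ f {v p} → Only v p → N f v ≡ f p
  N-only f {v} {p} (a , b) = ℕP.+-cancelʳ-≡ 0 _ _ (trans (N-one f v p 0 a (λ u q ne → ⊥-elim (ne (b u q)))) (cong (f p +_) (ℕP.*-zeroʳ (deg G v))))

  deg-only : ∀ {v p} → Only v p → deg G v ≡ 1
  deg-only {v} o = trans (sym (N1≡deg v)) (N-only (λ _ → 1) o)

  F-only : ∀ {v p} → Only v p → F G v ≡ 1 + deg G p
  F-only o = cong₂ _+_ (cong (λ d → d * d) (deg-only o)) (N-only (deg G) o)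

  -- Every neighbour contributes at least 1; beyond that `y` contributes `q` and `z` at least 1.
  N-lower : ∀ f v y z q → y ≢ z → G v y ≡ true → G v z ≡ true → (∀ u → G v u ≡ true → 1 ≤ f u) →
    f y ≡ suc q → 2 ≤ f z → deg G v + q + 1 ≤ N f v
  N-lower f v y z q y≢z v~y v~z pos fy fz = subst (_≤ N f v) total (sum-mono-ℕ _ _ pointwise)
    where
    total : ΣN.sum (λ u → 𝟙 (G v u) + 𝟙 (y == u) * q + 𝟙 (z == u) * 1) ≡ deg G v + q + 1
    total = trans (ΣN.∑-distrib-+ (λ u → 𝟙 (G v u) + 𝟙 (y == u) * q) (λ u → 𝟙 (z == u) * 1))
      (cong₂ _+_ (trans (ΣN.∑-distrib-+ (λ u → 𝟙 (G v u)) (λ u → 𝟙 (y == u) * q)) (cong₂ _+_ (sym (countTrue≡sum (G v))) (sum-diag-ℕ y (λ _ → q)))) (sum-diag-ℕ z (λ _ → 1)))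
    pointwise : ∀ u → 𝟙 (G v u) + 𝟙 (y == u) * q + 𝟙 (z == u) * 1 ≤ 𝟙 (G v u) * f u
    pointwise u with y ≟ u | z ≟ u
    ... | yes refl | yes p = ⊥-elim (y≢z (sym p))
    ... | yes refl | no _ rewrite v~y | fy = ℕP.≤-reflexive (lem q)
      where
      lem : ∀ q → 1 + 1 * q + 0 ≡ 1 * (1 + q)
      lem = solve-∀
    ... | no _ | yes refl rewrite v~z = ℕP.≤-trans fz (ℕP.≤-reflexive (sym (ℕP.*-identityˡ _)))
    ... | no _ | no _ with G v u in eq
    ...   | true = ℕP.≤-trans (pos u eq) (ℕP.≤-reflexive (sym (ℕP.*-identityˡ _)))
    ...   | false = z≤n

  1≤deg : ∀ {v z} → G v z ≡ true → 1 ≤ deg G v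
  1≤deg {v} {z} e = subst₂ _≤_ (sum-diag-ℕ z (λ _ → 1)) (sym (countTrue≡sum (G v))) (sum-mono-ℕ _ _ pointwise)
    where
    pointwise : ∀ u → 𝟙 (z == u) * 1 ≤ 𝟙 (G v u)
    pointwise u with z ≟ u
    ... | yes refl rewrite e = s≤s z≤n
    ... | no _ = z≤n

  2≤deg : ∀ {v a b} → a ≢ b → G v a ≡ true → G v b ≡ true → 2 ≤ deg G v
  2≤deg {v} {a} {b} a≢b va vb = subst₂ _≤_ (trans (ΣN.∑-distrib-+ (λ u → 𝟙 (a == u) * 1) (λ u → 𝟙 (b == u) * 1)) (cong₂ _+_ (sum-diag-ℕ a (λ _ → 1)) (sum-diag-ℕ b (λ _ → 1))))
      (sym (countTrue≡sum (G v))) (sum-mono-ℕ _ _ pointwise)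
    where
    pointwise : ∀ u → 𝟙 (a == u) * 1 + 𝟙 (b == u) * 1 ≤ 𝟙 (G v u)
    pointwise u with a ≟ u | b ≟ u
    ... | yes refl | yes q = ⊥-elim (a≢b (sym q))
    ... | yes refl | no _ rewrite va = s≤s z≤n
    ... | no _ | yes refl rewrite vb = s≤s z≤n
    ... | no _ | no _ = z≤n

  3≤deg : ∀ {v a b d} → a ≢ b → a ≢ d → b ≢ d → G v a ≡ true → G v b ≡ true → G v d ≡ true → 3 ≤ deg G v
  3≤deg {v} {a} {b} {d} a≢b a≢d b≢d va vb vd = subst₂ _≤_
      (trans (ΣN.∑-distrib-+ (λ u → 𝟙 (a == u) * 1 + 𝟙 (b == u) * 1) (λ u → 𝟙 (d == u) * 1))
        (cong₂ _+_ (trans (ΣN.∑-distrib-+ (λ u → 𝟙 (a == u) * 1) (λ u → 𝟙 (b == u) * 1)) (cong₂ _+_ (sum-diag-ℕ a (λ _ → 1)) (sum-diag-ℕ b (λ _ → 1))))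
          (sum-diag-ℕ d (λ _ → 1))))
      (sym (countTrue≡sum (G v))) (sum-mono-ℕ _ _ pointwise)
    where
    pointwise : ∀ u → 𝟙 (a == u) * 1 + 𝟙 (b == u) * 1 + 𝟙 (d == u) * 1 ≤ 𝟙 (G v u)
    pointwise u with a ≟ u | b ≟ u | d ≟ u
    ... | yes refl | yes q | _ = ⊥-elim (a≢b (sym q))
    ... | yes refl | no _ | yes q = ⊥-elim (a≢d (sym q))
    ... | yes refl | no _ | no _ rewrite va = s≤s z≤n
    ... | no _ | yes refl | yes q = ⊥-elim (b≢d (sym q))
    ... | no _ | yes refl | no _ rewrite vb = s≤s z≤n
    ... | no _ | no _ | yes refl rewrite vd = s≤s z≤n
    ... | no _ | no _ | no _ = z≤n

  deg-two+ : ∀ {v a b} (off : Fin n → Bool) → a ≢ b → G v a ≡ true → G v b ≡ true → off a ≡ false → off b ≡ false →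
    (∀ u → G v u ≡ true → u ≢ a → u ≢ b → off u ≡ true) → deg G v ≡ 2 + countTrue (λ u → if off u then G v u else false)
  deg-two+ {v} {a} {b} off a≢b va vb oa ob others = trans (countTrue≡sum (G v)) (trans (ΣN.sum-cong-≗ pointwise)
    (trans (ΣN.∑-distrib-+ (λ u → 𝟙 (a == u) * 1 + 𝟙 (b == u) * 1) (λ u → 𝟙 (if off u then G v u else false)))
      (cong₂ _+_ (trans (ΣN.∑-distrib-+ (λ u → 𝟙 (a == u) * 1) (λ u → 𝟙 (b == u) * 1)) (cong₂ _+_ (sum-diag-ℕ a (λ _ → 1)) (sum-diag-ℕ b (λ _ → 1))))
        (sym (countTrue≡sum (λ u → if off u then G v u else false))))))
    where
    pointwise : ∀ u → 𝟙 (G v u) ≡ 𝟙 (a == u) * 1 + 𝟙 (b == u) * 1 + 𝟙 (if off u then G v u else false)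
    pointwise u with a ≟ u | b ≟ u
    ... | yes refl | yes q = ⊥-elim (a≢b (sym q))
    ... | yes refl | no _ rewrite va | oa = refl
    ... | no _ | yes refl rewrite vb | ob = refl
    ... | no p | no q with G v u in eq
    ...   | true rewrite others u eq (λ q → p (sym q)) (λ p → q (sym p)) = refl
    ...   | false with off u
    ...     | true = refl
    ...     | false = refl

-- Up to no-root-branch, q = deg y - 1 and P = deg z - 1, where z is the parent of y and the other neighbours of y are leaves.
line-through : ∀ q P f d →
  f * suc q + (suc q * suc q + (q + suc P)) * 1 + (1 + suc q) * d ≡ f * 1 + (suc q * suc q + (q + suc P)) * d + (1 + suc q) * suc q →
  q * f + P ≡ (q * q + 2 * q + P) * d
line-through q P f d e = ℕP.+-cancelʳ-≡ (f + (2 + q) * d + (2 + q) * (1 + q)) _ _ (trans (lhs q P f d) (trans e (rhs q P f d)))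
  where
  lhs : ∀ q P f d → q * f + P + (f + (2 + q) * d + (2 + q) * (1 + q)) ≡ f * suc q + (suc q * suc q + (q + suc P)) * 1 + (1 + suc q) * d
  lhs = solve-∀
  rhs : ∀ q P f d → f * 1 + (suc q * suc q + (q + suc P)) * d + (1 + suc q) * suc q ≡ (q * q + 2 * q + P) * d + (f + (2 + q) * d + (2 + q) * (1 + q))
  rhs = solve-∀

-- Otherwise `P = q + x`, and inserting the lower bound for `s` makes the left side exceed the right
-- by at least `(q - 1) P x + q`.
P<q : ∀ q P s → 1 ≤ q → suc P + q + 1 ≤ s → q * (suc P * suc P + s) + P ≡ (q * q + 2 * q + P) * suc P → P < q
P<q (suc q′) P s _ low e with suc P ≤? suc q′
... | yes p = p
... | no p = ⊥-elim (ℕP.m+1+n≰m _ (ℕP.≤-trans (ℕP.≤-reflexive (big q′ x))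
        (subst₂ (λ a b → suc q′ * (suc a * suc a + (suc a + suc q′ + 1)) + a ≤ b) (sym P≡)
          (cong (λ a → (suc q′ * suc q′ + 2 * suc q′ + a) * suc a) (sym P≡)) ineq)))
  where
  x = P ∸ suc q′
  P≡ : suc q′ + x ≡ P
  P≡ = ℕP.m+[n∸m]≡n (ℕP.≤-pred (ℕP.≰⇒> p))
  ineq : suc q′ * (suc P * suc P + (suc P + suc q′ + 1)) + P ≤ (suc q′ * suc q′ + 2 * suc q′ + P) * suc P
  ineq = subst (suc q′ * (suc P * suc P + (suc P + suc q′ + 1)) + P ≤_) e (ℕP.+-monoˡ-≤ P (ℕP.*-monoʳ-≤ (suc q′) (ℕP.+-monoʳ-≤ (suc P * suc P) low)))
  big : ∀ q′ x → let P = suc q′ + x in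
    (suc q′ * suc q′ + 2 * suc q′ + P) * suc P + suc (q′ * P * x + q′) ≡ suc q′ * (suc P * suc P + (suc P + suc q′ + 1)) + P
  big = solve-∀

square-multiple : ∀ q P R S → q * R ≡ q * S + P * P → q ∣ P * P
square-multiple q P R S e = ∣m+n∣m⇒∣n (subst (q ∣_) e (m∣m*n R)) (m∣m*n S)

-- Here `z` is off the cycle: it has a parent of degree `e` and `P` children of degree `q + 1`, so
-- its neighbours have degree sum `s = e + P (q + 1)`. The hypothesis has the shape that `N-one`
-- produces.
inner-branch-key : ∀ q P e s → s + suc q ≡ e + suc P * suc q →
  q * (suc P * suc P + s) + P ≡ (q * q + 2 * q + P) * suc P → q * (P * P + P + e) ≡ q * (q + 1) + P * P
inner-branch-key q P e s hs h = ℕP.+-cancelʳ-≡ (q * q * P + 2 * q * P + q + P) _ _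
  (trans (lhs q P e) (trans (subst (λ s → q * (suc P * suc P + s) + P ≡ (q * q + 2 * q + P) * suc P) s≡ h) (rhs q P)))
  where
  cancel : ∀ e P q → e + suc P * suc q ≡ e + P * suc q + suc q
  cancel = solve-∀
  s≡ : s ≡ e + P * suc q
  s≡ = ℕP.+-cancelʳ-≡ (suc q) s (e + P * suc q) (trans hs (cancel e P q))
  lhs : ∀ q P e → q * (P * P + P + e) + (q * q * P + 2 * q * P + q + P) ≡ q * (suc P * suc P + (e + P * suc q)) + P
  lhs = solve-∀
  rhs : ∀ q P → (q * q + 2 * q + P) * suc P ≡ q * (q + 1) + P * P + (q * q * P + 2 * q * P + q + P)
  rhs = solve-∀

divide-key : ∀ q P e R j → q * (P * P + P + e) ≡ q * R + P * P → 1 ≤ q → P * P ≡ j * q → j * q + P + e ≡ R + j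
divide-key (suc q) P e R j key _ eq = ℕP.*-cancelˡ-≡ _ _ (suc q)
  (trans (cong (λ z → suc q * (z + P + e)) (sym eq)) (trans key (trans (cong (suc q * R +_) eq) (factor (suc q) R j))))
  where
  factor : ∀ q R j → q * R + j * q ≡ q * (R + j)
  factor = solve-∀

-- With `P² = j q` and `j ≥ 1`, division by `q` leaves `j q + P + e = q + 1 + j`. But
-- `j q ≥ q + j - 1` and `P + e ≥ 3`, so the left side is too large.
no-inner-branch : ∀ q P e → 1 ≤ q → 1 ≤ P → 2 ≤ e → q * (P * P + P + e) ≡ q * (q + 1) + P * P → ⊥
no-inner-branch (suc q) (suc P) (suc (suc e)) q≥1 _ (s≤s (s≤s _)) key with square-multiple (suc q) (suc P) _ (suc q + 1) key
... | divides (suc j) eq with ℕP.+-cancelʳ-≡ (2 + q + suc j) (suc (j * q + P + e)) 0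
        (trans (lem q P e j) (trans (divide-key (suc q) (suc P) (2 + e) (suc q + 1) (suc j) key q≥1 eq) (rem q j)))
  where
  lem : ∀ q P e j → suc (j * q + P + e) + (2 + q + suc j) ≡ suc j * suc q + suc P + (2 + e)
  lem = solve-∀
  rem : ∀ q j → suc q + 1 + suc j ≡ 0 + (2 + q + suc j)
  rem = solve-∀
...   | ()

-- Here `z` is on the cycle: its two cycle neighbours have degree sum `e`, and its other `P - 1`
-- neighbours have degree `q + 1`. The hypothesis has the shape that `N-two` produces.
root-branch-key : ∀ q P e s → s + (suc q + suc q) ≡ e + suc P * suc q →
  q * (suc P * suc P + s) + P ≡ (q * q + 2 * q + P) * suc P → q * (P * P + P + e) ≡ q * (2 * q + 2) + P * P
root-branch-key q P e s hs h = ℕP.+-cancelʳ-≡ (q * q * P + 2 * q * P + (q + q) + P + q * q) _ _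
  (trans (lhs q P e) (trans (cong (λ z → q * (suc P * suc P + z) + P) (sym hs)) (trans (mid q P s) (trans (cong (_+ q * (suc q + suc q)) h) (rhs q P)))))
  where
  lhs : ∀ q P e → q * (P * P + P + e) + (q * q * P + 2 * q * P + (q + q) + P + q * q) ≡ q * (suc P * suc P + (e + suc P * suc q)) + P
  lhs = solve-∀
  mid : ∀ q P s → q * (suc P * suc P + (s + (suc q + suc q))) + P ≡ q * (suc P * suc P + s) + P + q * (suc q + suc q)
  mid = solve-∀
  rhs : ∀ q P → (q * q + 2 * q + P) * suc P + q * (suc q + suc q) ≡ q * (2 * q + 2) + P * P + (q * q * P + 2 * q * P + (q + q) + P + q * q)
  rhs = solve-∀

-- Division by `q` leaves `j q + P + e = 2 q + 2 + j`. For `j ≥ 2` one has `j q ≥ 2 q + j - 2`,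
-- while `P + e ≥ 6`: impossible. So `j = 1`.
root-branch-square : ∀ q P e → 1 ≤ q → 2 ≤ P → 4 ≤ e → q * (P * P + P + e) ≡ q * (2 * q + 2) + P * P → P * P ≡ q × e + P ≡ q + 3
root-branch-square (suc q) (suc (suc P)) (suc (suc (suc (suc e)))) q≥1 (s≤s (s≤s _)) (s≤s (s≤s (s≤s (s≤s _)))) key
  with square-multiple (suc q) (2 + P) _ (2 * suc q + 2) key
... | divides (suc zero) eq = trans eq (ℕP.*-identityˡ (suc q)) ,
      ℕP.+-cancelʳ-≡ (suc q) _ _ (trans (lem q P e) (trans (divide-key (suc q) (2 + P) (4 + e) (2 * suc q + 2) 1 key q≥1 eq) (rem q)))
  where
  lem : ∀ q P e → 4 + e + (2 + P) + suc q ≡ 1 * suc q + (2 + P) + (4 + e)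
  lem = solve-∀
  rem : ∀ q → 2 * suc q + 2 + 1 ≡ suc q + 3 + suc q
  rem = solve-∀
... | divides (suc (suc j)) eq with ℕP.+-cancelʳ-≡ (2 * q + 6 + j) (suc (1 + j * q + P + e)) 0
        (trans (lem q P e j) (trans (divide-key (suc q) (2 + P) (4 + e) (2 * suc q + 2) (2 + j) key q≥1 eq) (rem q j)))
  where
  lem : ∀ q P e j → suc (1 + j * q + P + e) + (2 * q + 6 + j) ≡ (2 + j) * suc q + (2 + P) + (4 + e)
  lem = solve-∀
  rem : ∀ q j → 2 * suc q + 2 + (2 + j) ≡ 0 + (2 * q + 6 + j)
  rem = solve-∀
...   | ()

-- With `q = P²` the line divided by `P` reads `P f + 1 = (P³ + 2 P + 1)(d + 1)`; modulo `P` this is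
-- `1 ≡ d + 1`.
degree≡1-mod : ∀ q P f d → P * P ≡ q → 1 ≤ P → q * f + P ≡ (q * q + 2 * q + P) * suc d → P ∣ d
degree≡1-mod q (suc P) f d refl _ e = ∣m+n∣m⇒∣n (subst (suc P ∣_) (ℕP.suc-injective (ℕP.*-cancelˡ-≡ _ _ (suc P) (trans (lhs (suc P) f) (trans e (rhs (suc P) d))))) (m∣m*n f)) (m∣m*n _)
  where
  lhs : ∀ P f → P * suc (P * f) ≡ P * P * f + P
  lhs = solve-∀
  rhs : ∀ P d → (P * P * (P * P) + 2 * (P * P) + P) * suc d ≡ P * suc (P * ((P * P + 2) * suc d) + d)
  rhs = solve-∀

no-root-branch : ∀ q P d₁ d₂ → 2 ≤ P → P * P ≡ q → suc d₁ + suc d₂ + P ≡ q + 3 → P ∣ d₁ → P ∣ d₂ → ⊥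
no-root-branch q (suc (suc P)) .(a * suc (suc P)) .(b * suc (suc P)) (s≤s (s≤s _)) refl e (divides a refl) (divides b refl)
  with ∣1⇒≡1 (∣m+n∣m⇒∣n {m = p * p} {n = 1} (divides (a + b + 1) (ℕP.+-cancelʳ-≡ 2 _ _ (trans (rhs p) (trans (sym e) (lhs a b p))))) (m∣m*n p))
  where
  p = suc (suc P)
  lhs : ∀ a b p → suc (a * p) + suc (b * p) + p ≡ (a + b + 1) * p + 2
  lhs = solve-∀
  rhs : ∀ p → p * p + 1 + 2 ≡ p * p + 3
  rhs = solve-∀
... | ()

Collinear : ∀ {n} → Graph n → Set
Collinear G = ∀ u v w →
  F G u * deg G v + F G v * deg G w + F G w * deg G u ≡ F G u * deg G w + F G v * deg G u + F G w * deg G v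

-- No vertex has distance 2 or more from the cycle.

module Shape {n} (G : Graph n) (simple : IsSimple G) (S : Skeleton G) where
  open IsSimple simple public
  open Skeleton S public
  open Neighbours G public

  infix 4 _~_
  _~_ : Fin n → Fin n → Set
  u ~ v = G u v ≡ true

  ~-sym : ∀ {u v} → u ~ v → v ~ u
  ~-sym {u} {v} p = trans (symmetric v u) p

  -- The index `i - 1` modulo `r`, written as `i + (r - 1)`.
  prev : ℕ → ℕ
  prev i = 2 + len + i

  c-prev : ∀ i → c (suc (prev i)) ≡ c i
  c-prev i = period i

  prev~ : ∀ i → c i ~ c (prev i)
  prev~ i = ~-sym (subst (c (prev i) ~_) (c-prev i) (adjacent (prev i)))

  prev≢next : ∀ i → c (prev i) ≢ c (suc i)
  prev≢next i e with window-inj (suc i) (suc len) (s≤s (ℕP.n≤1+n _)) (trans (sym e) (cong c (sym (ℕP.+-suc (suc len) i))))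
  ... | ()

  2≤deg-c : ∀ i → 2 ≤ deg G (c i)
  2≤deg-c i = 2≤deg (prev≢next i) (prev~ i) (adjacent i)

  cycle-nbrs : ∀ i u → dist u ≡ 0 → c i ~ u → u ≡ c (prev i) ⊎ u ≡ c (suc i)
  cycle-nbrs i u du e with dist≡0 u du
  ... | k , refl with chordless (prev i) k (subst (_~ c k) (sym (c-prev i)) e)
  ...   | inj₁ p = inj₁ p
  ...   | inj₂ p = inj₂ (trans p (trans (cong c (lem len i)) (period (suc i))))
    where
    lem : ∀ l i → 2 + (2 + l + i) ≡ 3 + l + (1 + i)
    lem = solve-∀

  -- Besides the farther neighbour `w` there is a parent of `v`, unless `v` is on the cycle and has
  -- two cycle neighbours.
  dist<nbr⇒2≤deg : ∀ {v w} → v ~ w → dist w ≡ suc (dist v) → 2 ≤ deg G v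
  dist<nbr⇒2≤deg {v} {w} e dw with dist v in dv
  ... | zero with dist≡0 v dv
  ...   | i , refl = 2≤deg-c i
  dist<nbr⇒2≤deg {v} {w} e dw | suc k with descend v k dv
  ... | p , v~p , dp = 2≤deg {a = p} {b = w} (λ q → ℕP.m≢1+n+m k {1} (trans (sym dp) (trans (cong dist q) dw))) v~p e

  top-only : ∀ v k → dist v ≡ suc k → (∀ u → v ~ u → dist u ≤ dist v) → ∃ λ p → Only v p × dist p ≡ k
  top-only v k dv top with descend v k dv
  ... | p , v~p , dp = p , (v~p , λ u v~u → parent-unique v u p (λ z → ℕP.1+n≢0 (trans (sym dv) z)) v~u v~p (top u v~u)
          (ℕP.≤-trans (ℕP.≤-reflexive dp) (ℕP.≤-trans (ℕP.n≤1+n k) (ℕP.≤-reflexive (sym dv))))) , dp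

  module Deep (collinear : Collinear G) (k : ℕ) (x : Fin n) (top : ∀ v → dist v ≤ 2 + k) (dx : dist x ≡ 2 + k) where

    top-leaf : ∀ v → dist v ≡ 2 + k → ∃ λ p → Only v p × dist p ≡ 1 + k
    top-leaf v dv = top-only v (1 + k) dv (λ u _ → subst (dist u ≤_) (sym dv) (top u))

    y : Fin n
    y = proj₁ (top-leaf x dx)
    x-only : Only x y
    x-only = proj₁ (proj₂ (top-leaf x dx))
    dy : dist y ≡ 1 + k
    dy = proj₂ (proj₂ (top-leaf x dx))

    z : Fin n
    z = proj₁ (descend y k dy)
    y~z : y ~ z
    y~z = proj₁ (proj₂ (descend y k dy))
    dz : dist z ≡ k
    dz = proj₂ (proj₂ (descend y k dy))

    pred-of : ∀ {m} → 1 ≤ m → ∃ λ p → m ≡ suc p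
    pred-of {suc m} _ = m , refl

    q P : ℕ
    q = proj₁ (pred-of (1≤deg y~z))
    P = proj₁ (pred-of (1≤deg (~-sym y~z)))
    deg-y : deg G y ≡ suc q
    deg-y = proj₂ (pred-of (1≤deg y~z))
    deg-z : deg G z ≡ suc P
    deg-z = proj₂ (pred-of (1≤deg (~-sym y~z)))

    1≤q : 1 ≤ q
    1≤q = ℕP.≤-pred (subst (2 ≤_) deg-y (dist<nbr⇒2≤deg (~-sym (proj₁ x-only)) (trans dx (cong suc (sym dy)))))

    2≤deg-z : 2 ≤ deg G z
    2≤deg-z = dist<nbr⇒2≤deg (~-sym y~z) (trans dy (cong suc (sym dz)))

    up : ∀ {v u p} → ¬ (dist v ≡ 0) → v ~ p → dist p ≤ dist v → v ~ u → u ≢ p → dist u ≡ suc (dist v)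
    up {v} {u} {p} off v~p dp v~u u≢p with dist u ≤? dist v
    ... | yes du = ⊥-elim (u≢p (parent-unique v u p off v~u v~p du dp))
    ... | no du = ℕP.≤-antisym (dist-step u v (~-sym v~u)) (ℕP.≰⇒> du)

    -- Besides `z`, every neighbour of `y` is one level farther out, hence at the maximal distance
    -- and a leaf.
    nbrDeg-y : nbrDeg G y ≡ q + suc P
    nbrDeg-y = ℕP.+-cancelʳ-≡ 1 _ _ (trans (N-one (deg G) y z 1 y~z leaf) (trans (cong₂ (λ a b → a + b * 1) deg-z deg-y) (lem P q)))
      where
      lem : ∀ P q → suc P + suc q * 1 ≡ q + suc P + 1
      lem = solve-∀
      leaf : ∀ u → y ~ u → u ≢ z → deg G u ≡ 1
      leaf u y~u u≢z with top-leaf u (trans (up (λ e → ℕP.1+n≢0 (trans (sym dy) e)) y~z (subst₂ _≤_ (sym dz) (sym dy) (ℕP.n≤1+n k)) y~u u≢z) (cong suc dy))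
      ... | _ , o , _ = deg-only o

    -- The points of `x` and `y` are `(1, q + 2)` and `(q + 1, (q + 1)² + q + P + 1)`, so the slope
    -- is `(q² + 2 q + P) / q`; the equation is multiplied by `q`.
    line : ∀ v → q * F G v + P ≡ (q * q + 2 * q + P) * deg G v
    line v = line-through q P (F G v) (deg G v) (begin
      F G v * suc q + (suc q * suc q + (q + suc P)) * 1 + (1 + suc q) * deg G v
        ≡⟨ sym (cong₂ _+_ (cong₂ _+_ (cong (F G v *_) deg-y) (cong₂ _*_ Fy (deg-only x-only))) (cong (_* deg G v) Fx)) ⟩
      F G v * deg G y + F G y * deg G x + F G x * deg G v
        ≡⟨ collinear v y x ⟩
      F G v * deg G x + F G y * deg G v + F G x * deg G y
        ≡⟨ cong₂ _+_ (cong₂ _+_ (cong (F G v *_) (deg-only x-only)) (cong (_* deg G v) Fy)) (cong₂ _*_ Fx deg-y) ⟩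
      F G v * 1 + (suc q * suc q + (q + suc P)) * deg G v + (1 + suc q) * suc q ∎)
      where
      open ≡-Reasoning
      Fy : F G y ≡ suc q * suc q + (q + suc P)
      Fy = cong₂ (λ a b → a * a + b) deg-y nbrDeg-y
      Fx : F G x ≡ 1 + suc q
      Fx = trans (F-only x-only) (cong suc deg-y)

    line-z : q * (suc P * suc P + nbrDeg G z) + P ≡ (q * q + 2 * q + P) * suc P
    line-z = subst (λ d → q * (d * d + nbrDeg G z) + P ≡ (q * q + 2 * q + P) * d) deg-z (line z)

    -- The second large neighbour of `z` that `N-lower` asks for: the next cycle vertex if `z` is on
    -- the cycle, its parent otherwise.
    z′ : ∃ λ z′ → z ~ z′ × y ≢ z′ × 2 ≤ deg G z′
    z′ with dist z in dz₀
    ... | zero with dist≡0 z dz₀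
    ...   | i , ci≡z = c (suc i) , subst (_~ c (suc i)) ci≡z (adjacent i) , (λ e → ℕP.0≢1+n (trans (sym (dist-c (suc i))) (trans (cong dist (sym e)) dy))) , 2≤deg-c (suc i)
    z′ | suc j with descend z j dz₀
    ... | p , z~p , dp = p , z~p , (λ e → ℕP.m≢1+n+m j {1} (trans (sym dp) (trans (cong dist (sym e)) (trans dy (cong suc (trans (sym dz) dz₀)))))) ,
          dist<nbr⇒2≤deg (~-sym z~p) (trans dz₀ (cong suc (sym dp)))

    P<q′ : P < q
    P<q′ with z′
    ... | w , z~w , y≢w , w≥2 = P<q q P (nbrDeg G z) 1≤q
      (subst (λ d → d + q + 1 ≤ nbrDeg G z) deg-z (N-lower (deg G) z y w q y≢w (~-sym y~z) z~w (λ u z~u → 1≤deg (~-sym z~u)) deg-y w≥2)) line-z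

    -- If `u` has a child `w`, then `w` is a leaf with `F = 1 + deg u`, and the line at `w` gives
    -- `deg u = q + 1`. If `u` has none, it is a leaf with `F = P + 2`, and the line at `u` would
    -- give `P = q`, against `P<q′`.
    child-degree : ∀ u → z ~ u → dist u ≡ suc k → deg G u ≡ suc q
    child-degree u z~u du with any? (λ w → (G u w BoolP.≟ true) ×-dec (suc (dist u) ≤? dist w))
    ... | yes (w , u~w , du<dw) with top-leaf w (ℕP.≤-antisym (top w) (subst (λ d → suc d ≤ dist w) du du<dw))
    ...   | p , (w~p , only) , _ = ℕP.suc-injective (ℕP.*-cancelˡ-≡ _ _ q {{ℕ.>-nonZero 1≤q}} (ℕP.+-cancelʳ-≡ P _ _ (trans (subst₂ (λ f d → q * f + P ≡ (q * q + 2 * q + P) * d)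
              (trans (F-only (w~p , only)) (cong (λ v → suc (deg G v)) (sym (only u (~-sym u~w))))) (deg-only (w~p , only)) (line w)) (lem q P))))
      where
      lem : ∀ q P → (q * q + 2 * q + P) * 1 ≡ q * suc (suc q) + P
      lem = solve-∀
    child-degree u z~u du | no none with top-only u k du (λ w u~w → ℕP.≮⇒≥ (λ lt → none (w , u~w , lt)))
    ... | p , (u~p , only) , _ = ⊥-elim (ℕP.<-irrefl (ℕP.*-cancelˡ-≡ P q q {{ℕ.>-nonZero 1≤q}} (ℕP.+-cancelʳ-≡ (2 * q + P) _ _ (trans (lem q P) (trans
            (subst₂ (λ f d → q * f + P ≡ (q * q + 2 * q + P) * d) 
              (trans (F-only (u~p , only)) (cong suc (trans (cong (deg G) (sym (only z (~-sym z~u)))) deg-z))) (deg-only (u~p , only)) (line u)) (lem′ q P))))) P<q′)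
      where
      lem : ∀ q P → q * P + (2 * q + P) ≡ q * suc (suc P) + P
      lem = solve-∀
      lem′ : ∀ q P → (q * q + 2 * q + P) * 1 ≡ q * q + (2 * q + P)
      lem′ = solve-∀

    inner : ∀ j → k ≡ suc j → ⊥
    inner j k≡ with descend z j (trans dz k≡)
    ... | p , z~p , dp = no-inner-branch q P (deg G p) 1≤q (ℕP.≤-pred (subst (2 ≤_) deg-z 2≤deg-z))
            (dist<nbr⇒2≤deg (~-sym z~p) (trans dz (trans k≡ (cong suc (sym dp)))))
            (inner-branch-key q P (deg G p) (nbrDeg G z) (subst (λ d → nbrDeg G z + suc q ≡ deg G p + d * suc q) deg-z
              (N-one (deg G) z p (suc q) z~p (λ u z~u u≢p → child-degree u z~u (trans (up (λ e → ℕP.1+n≢0 (trans (sym k≡) (trans (sym dz) e))) z~p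
                (subst₂ _≤_ (sym dp) (sym (trans dz k≡)) (ℕP.n≤1+n j)) z~u u≢p) (cong suc dz))))) line-z)

    root : k ≡ 0 → ⊥
    root k≡0 with dist≡0 z (trans dz k≡0)
    ... | i , ci≡z = no-root-branch q P (proj₁ d₁) (proj₁ d₂) 2≤P PP≡q (trans (cong₂ (λ a b → a + b + P) (sym (proj₂ d₁)) (sym (proj₂ d₂))) e+P)
          (div a (proj₁ d₁) (proj₂ d₁)) (div b (proj₁ d₂) (proj₂ d₂))
      where
      a b : Fin n
      a = c (prev i)
      b = c (suc i)
      z~a : z ~ a
      z~a = subst (_~ a) ci≡z (prev~ i)
      z~b : z ~ b
      z~b = subst (_~ b) ci≡z (adjacent i)
      d₁ : ∃ λ d → deg G a ≡ suc d
      d₁ = pred-of (1≤deg (~-sym z~a))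
      d₂ : ∃ λ d → deg G b ≡ suc d
      d₂ = pred-of (1≤deg (~-sym z~b))
      children : ∀ u → z ~ u → u ≢ a → u ≢ b → deg G u ≡ suc q
      children u z~u u≢a u≢b with dist u in du
      ... | suc (suc m) = ⊥-elim (ℕP.<⇒≱ (s≤s (s≤s z≤n)) (subst₂ _≤_ du (cong suc (trans dz k≡0)) (dist-step u z (~-sym z~u))))
      ... | suc zero = child-degree u z~u (trans du (cong suc (sym k≡0)))
      ... | zero with cycle-nbrs i u du (subst (_~ u) (sym ci≡z) z~u)
      ...   | inj₁ e = ⊥-elim (u≢a e)
      ...   | inj₂ e = ⊥-elim (u≢b e)
      dy≡1 : dist y ≡ 1
      dy≡1 = trans dy (cong suc k≡0)
      y≢c : ∀ j → y ≢ c j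
      y≢c j e = ℕP.1+n≢0 (trans (sym dy≡1) (trans (cong dist e) (dist-c j)))
      2≤P : 2 ≤ P
      2≤P = ℕP.≤-pred (subst (3 ≤_) deg-z (3≤deg (y≢c _) (y≢c _) (prev≢next i) (~-sym y~z) z~a z~b))
      facts : P * P ≡ q × deg G a + deg G b + P ≡ q + 3
      facts = root-branch-square q P (deg G a + deg G b) 1≤q 2≤P (ℕP.+-mono-≤ (2≤deg-c _) (2≤deg-c _))
        (root-branch-key q P (deg G a + deg G b) (nbrDeg G z) (subst (λ d → nbrDeg G z + (suc q + suc q) ≡ deg G a + deg G b + d * suc q) deg-z
          (N-two (deg G) z a b (suc q) (prev≢next i) z~a z~b children)) line-z)
      PP≡q = proj₁ facts
      e+P = proj₂ facts
      div : ∀ v d → deg G v ≡ suc d → P ∣ d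
      div v d e = degree≡1-mod q P (F G v) d PP≡q (ℕP.≤-trans (s≤s z≤n) 2≤P) (subst (λ m → q * F G v + P ≡ (q * q + 2 * q + P) * m) e (line v))

    absurd : ⊥
    absurd = split k refl
      where
      split : ∀ j → k ≡ j → ⊥
      split zero = root
      split (suc j) = inner j

  shallow : Collinear G → ∀ v → dist v ≤ 1
  shallow H v with argmax dist v
  ... | x , top with dist x in dx
  ...   | zero = ℕP.≤-trans (top v) z≤n
  ...   | suc zero = top v
  ...   | suc (suc k) = ⊥-elim (Deep.absurd H k x top dx)

rotate : ∀ {n} {G : Graph n} → Skeleton G → ℕ → Skeleton G
rotate {G = G} S s = record
  { len = len
  ; c = λ i → c (s + i)
  ; period = λ i → trans (cong c (reorder s r i)) (period (s + i))
  ; window-inj = λ i d d<r e → window-inj (s + i) d d<r (trans e (cong c (reorder s d i)))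
  ; adjacent = λ i → subst (λ k → G (c (s + i)) (c k) ≡ true) (sym (ℕP.+-suc s i)) (adjacent (s + i))
  ; chordless = λ i k e → subst (λ j → c (s + k) ≡ c (s + i) ⊎ c (s + k) ≡ c j) (sym (reorder s 2 i))
      (chordless (s + i) (s + k) (subst (λ j → G (c j) (c (s + k)) ≡ true) (ℕP.+-suc s i) e))
  ; dist = dist ; dist-c = λ i → dist-c (s + i)
  -- The old index `i` becomes `i - s` modulo `r`, represented by `i + s * (r - 1)`.
  ; dist≡0 = λ v e → let i , p = dist≡0 v e in i + s * (2 + len) , trans (cong c (shift s i (2 + len))) (trans (period* s i) p)
  ; dist-step = dist-step ; descend = descend ; parent-unique = parent-unique }
  where
  open Skeleton S
  reorder : ∀ s d i → s + (d + i) ≡ d + (s + i)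
  reorder = solve-∀
  shift : ∀ s i l → s + (i + s * l) ≡ s * (1 + l) + i
  shift = solve-∀

-- Two leaves and a vertex of degree `3 + k` on one line: the line is not vertical, so the leaves,
-- having equal degrees, have equal `F`.
leaf-weight : ∀ k a b f → a * 1 + b * (3 + k) + f * 1 ≡ a * (3 + k) + b * 1 + f * 1 → a ≡ b
leaf-weight k a b f e = sym (ℕP.*-cancelʳ-≡ _ _ (2 + k) (ℕP.+-cancelʳ-≡ (a + b + f) _ _ (trans (lhs k a b f) (trans e (rhs k a b f)))))
  where
  lhs : ∀ k a b f → b * (2 + k) + (a + b + f) ≡ a * 1 + b * (3 + k) + f * 1
  lhs = solve-∀
  rhs : ∀ k a b f → a * (3 + k) + b * 1 + f * 1 ≡ a * (2 + k) + (a + b + f)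
  rhs = solve-∀

-- Collinearity of a cycle vertex with `K` pendant vertices, one with none, and a leaf. Here `a` and
-- `b` count those cycle neighbours of the first and of the second vertex that carry pendant
-- vertices, and `s₁`, `s₂` are the neighbour degree sums.
pair-balance : ∀ k a b s₁ s₂ → let K = suc k in
  s₁ + 2 ≡ 4 + a * K + (2 + K) → s₂ + 2 ≡ 4 + b * K + 2 →
  ((2 + K) * (2 + K) + s₁) * 2 + (4 + s₂) * 1 + (3 + K) * (2 + K) ≡ ((2 + K) * (2 + K) + s₁) * 1 + (4 + s₂) * (2 + K) + (3 + K) * 2 →
  2 * K + a ≡ b * (1 + K)
pair-balance k a b s₁ s₂ h₁ h₂ e = ℕP.*-cancelˡ-≡ _ _ K (ℕP.+-cancelʳ-≡ X _ _ (trans (lhs K a b)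
    (trans (subst₂ (λ s₁ s₂ → ((2 + K) * (2 + K) + s₁) * 2 + (4 + s₂) * 1 + (3 + K) * (2 + K) ≡ ((2 + K) * (2 + K) + s₁) * 1 + (4 + s₂) * (2 + K) + (3 + K) * 2) s₁≡ s₂≡ e) (rhs K a b))))
  where
  K = suc k
  X = (2 + K) * (2 + K) + (4 + a * K + K) + (8 + b * K) + (3 + K) * 2 + 8 * K + 8
  s₁≡ : s₁ ≡ 4 + a * K + K
  s₁≡ = ℕP.+-cancelʳ-≡ 2 _ _ (trans h₁ (lem a K))
    where
    lem : ∀ a K → 4 + a * K + (2 + K) ≡ 4 + a * K + K + 2
    lem = solve-∀
  s₂≡ : s₂ ≡ 4 + b * K
  s₂≡ = ℕP.+-cancelʳ-≡ 2 _ _ h₂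
  lhs : ∀ K a b → K * (2 * K + a) + ((2 + K) * (2 + K) + (4 + a * K + K) + (8 + b * K) + (3 + K) * 2 + 8 * K + 8)
    ≡ ((2 + K) * (2 + K) + (4 + a * K + K)) * 2 + (4 + (4 + b * K)) * 1 + (3 + K) * (2 + K)
  lhs = solve-∀
  rhs : ∀ K a b → ((2 + K) * (2 + K) + (4 + a * K + K)) * 1 + (4 + (4 + b * K)) * (2 + K) + (3 + K) * 2
    ≡ K * (b * (1 + K)) + ((2 + K) * (2 + K) + (4 + a * K + K) + (8 + b * K) + (3 + K) * 2 + 8 * K + 8)
  rhs = solve-∀

single-big : ∀ k p p′ → 2 * suc k + (𝟙 p + 𝟙 p′) ≡ 1 * (2 + k) → k ≡ 0 × p′ ≡ false
single-big k p p′ e with ℕP.+-cancelʳ-≡ (2 + k) (k + (𝟙 p + 𝟙 p′)) 0 (trans (lem k (𝟙 p + 𝟙 p′)) (trans e (ℕP.*-identityˡ (2 + k))))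
  where
  lem : ∀ k a → k + a + (2 + k) ≡ 2 * suc k + a
  lem = solve-∀
single-big zero false false e | _ = refl , refl

-- p, p′ (resp. n, n′) tell whether the cycle neighbours of a vertex with (resp. without) pendant vertices have pendant vertices.
pair-patterns : ∀ k p p′ n n′ → 2 * suc k + (𝟙 p + 𝟙 p′) ≡ (𝟙 n + 𝟙 n′) * (2 + k) →
  (n ≡ true × n′ ≡ true × p′ ≡ true) ⊎ (n′ ≡ not n × k ≡ 0 × p′ ≡ false)
pair-patterns k p p′ true true e = inj₁ (refl , refl , both p p′ (ℕP.+-cancelˡ-≡ (2 * suc k) _ _ (trans e (lem k))))
  where
  lem : ∀ k → 2 * (2 + k) ≡ 2 * suc k + 2
  lem = solve-∀
  both : ∀ p p′ → 𝟙 p + 𝟙 p′ ≡ 2 → p′ ≡ true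
  both true true _ = refl
  both false true _ = refl
  both true false ()
  both false false ()
pair-patterns k p p′ true false e = inj₂ (refl , single-big k p p′ e)
pair-patterns k p p′ false true e = inj₂ (refl , single-big k p p′ e)

residue : ∀ r → ∃ λ t → r ≡ 3 * t ⊎ r ≡ 1 + 3 * t ⊎ r ≡ 2 + 3 * t
residue zero = 0 , inj₁ refl
residue (suc r) with residue r
... | t , inj₁ e = t , inj₂ (inj₁ (cong suc e))
... | t , inj₂ (inj₁ e) = t , inj₂ (inj₂ (cong suc e))
... | t , inj₂ (inj₂ e) = suc t , inj₁ (trans (cong suc e) (sym (ℕP.*-suc 3 t)))

-- Degree patterns along a cycle with pendant vertices.

module Sun {n} (G : Graph n) (simple : IsSimple G) (S : Skeleton G)
  (flat : ∀ v → Skeleton.dist S v ≤ 1) (x : Fin n) (dx : Skeleton.dist S x ≡ 1) (x~c0 : G x (Skeleton.c S 0) ≡ true) where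
  open Shape G simple S

  pendant : ∀ v → dist v ≡ 1 → ∃ λ i → Only v (c i)
  pendant v dv with top-only v 0 dv (λ u _ → subst (dist u ≤_) (sym dv) (flat u))
  ... | p , o , dp with dist≡0 p dp
  ...   | i , refl = i , o

  off-cycle : ∀ u → ¬ (dist u ≡ 0) → dist u ≡ 1
  off-cycle u off = ℕP.≤-antisym (flat u) (ℕP.n≢0⇒n>0 off)

  other-nbrs : ∀ i u → c i ~ u → u ≢ c (prev i) → u ≢ c (suc i) → dist u ≡ 1
  other-nbrs i u e ne ne′ = off-cycle u (λ du → case (cycle-nbrs i u du e))
    where
    case : u ≡ c (prev i) ⊎ u ≡ c (suc i) → ⊥
    case (inj₁ p) = ne p
    case (inj₂ p) = ne′ p

  only-at : ∀ {v i} → dist v ≡ 1 → v ~ c i → Only v (c i)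
  only-at {v} {i} dv e with pendant v dv
  ... | j , (a , only) = e , λ u v~u → trans (only u v~u) (sym (only (c i) e))

  off≢c : ∀ {v} i → dist v ≡ 1 → v ≢ c i
  off≢c i dv e = ℕP.1+n≢0 (trans (sym dv) (trans (cong dist e) (dist-c i)))

  big-degree : ∃ λ k → deg G (c 0) ≡ 3 + k
  big-degree = deg G (c 0) ∸ 3 , sym (ℕP.m+[n∸m]≡n (3≤deg (off≢c _ dx) (off≢c _ dx) (prev≢next 0) (~-sym x~c0) (prev~ 0) (adjacent 0)))

  module Pattern (collinear : Collinear G) (k : ℕ) (deg-c0 : deg G (c 0) ≡ 3 + k) where

    x-only : Only x (c 0)
    x-only = only-at dx x~c0

    -- The pendant vertices `v` and `x` have equal `F` by `leaf-weight`, and `F` at a pendant vertex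
    -- is one more than the degree of its neighbour.
    degree-with-pendant : ∀ v i → dist v ≡ 1 → v ~ c i → deg G (c i) ≡ 3 + k
    degree-with-pendant v i dv e = trans (ℕP.suc-injective (trans (sym (F-only o)) (trans (leaf-weight k (F G v) (F G x) (F G (c 0))
        (subst₂ (λ d d′ → F G v * d + F G x * (3 + k) + F G (c 0) * d′ ≡ F G v * (3 + k) + F G x * d′ + F G (c 0) * d) (deg-only x-only) (deg-only o)
          (subst (λ D → F G v * deg G x + F G x * D + F G (c 0) * deg G v ≡ F G v * D + F G x * deg G v + F G (c 0) * deg G x) deg-c0 (collinear v x (c 0)))))
        (F-only x-only)))) deg-c0
      where o = only-at dv e

    cycle-degree : ∀ i → deg G (c i) ≡ 2 ⊎ deg G (c i) ≡ 3 + k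
    cycle-degree i with any? (λ u → (G (c i) u BoolP.≟ true) ×-dec (dist u ℕP.≟ 1))
    ... | yes (u , e , du) = inj₂ (degree-with-pendant u i du (~-sym e))
    ... | no none = inj₁ (ℕP.+-cancelʳ-≡ 0 _ _ (trans (cong (_+ 0) (sym (N1≡deg (c i))))
            (trans (N-two (λ _ → 1) (c i) _ _ 0 (prev≢next i) (prev~ i) (adjacent i) (λ u e a b → ⊥-elim (none (u , e , other-nbrs i u e a b))))
              (cong (2 +_) (ℕP.*-zeroʳ (deg G (c i)))))))

    b : ℕ → Bool
    b i = deg G (c i) ≡ᵇ 3 + k

    b≡true : ∀ {i} → b i ≡ true → deg G (c i) ≡ 3 + k
    b≡true = ≡ᵇ-true

    b≡false : ∀ {i} → b i ≡ false → deg G (c i) ≡ 2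
    b≡false {i} e with cycle-degree i
    ... | inj₁ q = q
    ... | inj₂ q = ⊥-elim (true≢false (true-≡ᵇ q) e)

    deg-b : ∀ i → deg G (c i) ≡ 2 + 𝟙 (b i) * suc k
    deg-b i with b i in eq
    ... | true = trans (b≡true eq) (cong (2 +_) (sym (ℕP.*-identityˡ (suc k))))
    ... | false = b≡false eq

    b-cong : ∀ {i j} → c i ≡ c j → b i ≡ b j
    b-cong e = cong (λ v → deg G v ≡ᵇ 3 + k) e

    b0 : b 0 ≡ true
    b0 = true-≡ᵇ deg-c0

    nbrDeg-c : ∀ i → nbrDeg G (c i) + 2 ≡ 4 + (𝟙 (b (prev i)) + 𝟙 (b (suc i))) * suc k + deg G (c i)
    nbrDeg-c i = trans (N-two (deg G) (c i) _ _ 1 (prev≢next i) (prev~ i) (adjacent i) (λ u e a b → deg-only (proj₂ (pendant u (other-nbrs i u e a b)))))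
      (trans (cong₂ (λ d d′ → d + d′ + deg G (c i) * 1) (deg-b (prev i)) (deg-b (suc i))) (lem (𝟙 (b (prev i))) (𝟙 (b (suc i))) (suc k) (deg G (c i))))
      where
      lem : ∀ a b K d → 2 + a * K + (2 + b * K) + d * 1 ≡ 4 + (a + b) * K + d
      lem = solve-∀

    abstract
      -- In `2 K + a = b (1 + K)`, with `a` and `b` at most 2 and `K` at least 1, the value `b = 2`
      -- forces `a = 2`, `b = 1` forces `K = 1` and `a = 0`, and `b = 0` is impossible.
      pair : ∀ i j → b i ≡ true → b j ≡ false →
        (b (prev j) ≡ true × b (suc j) ≡ true × b (suc i) ≡ true) ⊎ (b (suc j) ≡ not (b (prev j)) × k ≡ 0 × b (suc i) ≡ false)
      pair i j bi bj = pair-patterns k (b (prev i)) (b (suc i)) (b (prev j)) (b (suc j))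
        (pair-balance k (𝟙 (b (prev i)) + 𝟙 (b (suc i))) (𝟙 (b (prev j)) + 𝟙 (b (suc j))) (nbrDeg G (c i)) (nbrDeg G (c j))
          (trans (nbrDeg-c i) (cong (4 + (𝟙 (b (prev i)) + 𝟙 (b (suc i))) * suc k +_) (b≡true bi))) (trans (nbrDeg-c j) (cong (4 + (𝟙 (b (prev j)) + 𝟙 (b (suc j))) * suc k +_) (b≡false bj)))
          (subst (Line (3 + k) 2) (trans (F-only x-only) (cong suc deg-c0)) (subst₂ (λ d d′ → Line d d′ (F G x)) (b≡true bi) (b≡false bj)
            (subst (λ d → F G (c i) * deg G (c j) + F G (c j) * d + F G x * deg G (c i) ≡ F G (c i) * d + F G (c j) * deg G (c i) + F G x * deg G (c j))
              (deg-only x-only) (collinear (c i) (c j) x)))))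
        where
        Line : ℕ → ℕ → ℕ → Set
        Line d d′ f = (d * d + nbrDeg G (c i)) * d′ + (d′ * d′ + nbrDeg G (c j)) * 1 + f * d ≡ (d * d + nbrDeg G (c i)) * 1 + (d′ * d′ + nbrDeg G (c j)) * d + f * d′

    AllBig : Set
    AllBig = ∀ i → deg G (c i) ≡ 3 + k

    EveryThird : Set
    EveryThird = ∃ λ t → r ≡ 3 * t × (∀ m → deg G (c (3 * m)) ≡ 3 × deg G (c (1 + 3 * m)) ≡ 2 × deg G (c (2 + 3 * m)) ≡ 2)

    -- Comparing each large vertex with `j` makes its successor small; comparing each small one with
    -- `c 0` gives it exactly one large neighbour. Starting at `c 0`, the pattern large, small,
    -- small is thereby forced to repeat.
    every-third : ∀ j → b j ≡ false → b (suc j) ≡ not (b (prev j)) → k ≡ 0 → EveryThird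
    every-third j bj alt k≡0 = proj₁ (divisible (residue r)) , proj₂ (divisible (residue r)) , λ m → let p , q , s = pattern′ m in
        trans (b≡true p) (cong (3 +_) k≡0) , b≡false q , b≡false s
      where
      big-next : ∀ i → b i ≡ true → b (suc i) ≡ false
      big-next i bi with pair i j bi bj
      ... | inj₂ (_ , _ , e) = e
      ... | inj₁ (p , q , _) with trans (sym q) (trans alt (cong not p))
      ...   | ()
      small-next : ∀ i → b i ≡ false → b (suc i) ≡ not (b (prev i))
      small-next i bi with pair 0 i b0 bi
      ... | inj₂ (e , _ , _) = e
      ... | inj₁ (_ , _ , e) = ⊥-elim (true≢false e (big-next 0 b0))
      small-next′ : ∀ i → b (suc i) ≡ false → b (2 + i) ≡ not (b i)
      small-next′ i bi = trans (small-next (suc i) bi) (cong not (b-cong (trans (cong c (ℕP.+-suc (2 + len) i)) (period i))))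
      pattern″ : ∀ i → b i ≡ true → b (1 + i) ≡ false × b (2 + i) ≡ false × b (3 + i) ≡ true
      pattern″ i bi = e₁ , e₂ , trans (small-next′ (1 + i) e₂) (cong not e₁)
        where
        e₁ = big-next i bi
        e₂ = trans (small-next′ i e₁) (cong not bi)
      third : ∀ m → b (3 * m) ≡ true
      third zero = b0
      third (suc m) = subst (λ i → b i ≡ true) (sym (ℕP.*-suc 3 m)) (proj₂ (proj₂ (pattern″ (3 * m) (third m))))
      pattern′ : ∀ m → b (3 * m) ≡ true × b (1 + 3 * m) ≡ false × b (2 + 3 * m) ≡ false
      pattern′ m = third m , proj₁ (pattern″ (3 * m) (third m)) , proj₁ (proj₂ (pattern″ (3 * m) (third m)))
      -- Index `r` is `c 0` again, so `r` cannot have one of the residues modulo 3 at which the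
      -- vertices are small.
      br : b r ≡ true
      br = trans (b-cong (trans (cong c (sym (ℕP.+-identityʳ r))) (period 0))) b0
      divisible : (∃ λ t → r ≡ 3 * t ⊎ r ≡ 1 + 3 * t ⊎ r ≡ 2 + 3 * t) → ∃ λ t → r ≡ 3 * t
      divisible (t , inj₁ e) = t , e
      divisible (t , inj₂ (inj₁ e)) = ⊥-elim (true≢false (subst (λ i → b i ≡ true) e br) (proj₁ (proj₂ (pattern′ t))))
      divisible (t , inj₂ (inj₂ e)) = ⊥-elim (true≢false (subst (λ i → b i ≡ true) e br) (proj₂ (proj₂ (pattern′ t))))

    -- A small vertex `j` is compared with `c 0`. If both neighbours of `j` are large, then
    -- comparing `j` with any large vertex makes the successor large too, and induction from `c 0`
    -- reaches `j` itself: a contradiction. So exactly one neighbour of `j` is large.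
    dichotomy : AllBig ⊎ EveryThird
    dichotomy with ℕP.anyUpTo? (λ i → b i BoolP.≟ false) r
    ... | no none = inj₁ (λ i → b≡true (trans (b-cong (sym (c-mod i))) (is-true (λ e → none (i % r , m%n<n i r , e)))))
      where
      is-true : ∀ {b} → b ≢ false → b ≡ true
      is-true {true} _ = refl
      is-true {false} p = ⊥-elim (p refl)
    ... | yes (j , _ , bj) with pair 0 j b0 bj
    ...   | inj₂ (alt , k≡0 , _) = inj₂ (every-third j bj alt k≡0)
    ...   | inj₁ (p , q , _) = ⊥-elim (true≢false (all j) bj)
      where
      all : ∀ i → b i ≡ true
      all zero = b0
      all (suc i) with pair i j (all i) bj
      ... | inj₁ (_ , _ , e) = e
      ... | inj₂ (alt , _ , _) with trans (sym q) (trans alt (cong not p))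
      ...   | ()

-- Labellings and isomorphisms with the cycle, `G₁` and `G₂`.

record Enumeration {n} (f : Fin n → Bool) (k : ℕ) : Set where
  field
    at       : Fin k → Fin n
    at-inj   : ∀ i j → at i ≡ at j → i ≡ j
    at-true  : ∀ i → f (at i) ≡ true
    at-onto  : ∀ u → f u ≡ true → ∃ λ i → at i ≡ u

enumerate : ∀ {n} (f : Fin n → Bool) → Enumeration f (countTrue f)
enumerate {zero} f = record { at = λ () ; at-inj = λ () ; at-true = λ () ; at-onto = λ () }
enumerate {suc n} f with f Fin.zero in eq | enumerate (λ i → f (Fin.suc i))
... | false | E = record
  { at = λ i → Fin.suc (at i)
  ; at-inj = λ i j e → at-inj i j (FinP.suc-injective e)
  ; at-true = at-true
  ; at-onto = λ { Fin.zero e → ⊥-elim (true≢false e eq) ; (Fin.suc u) e → let i , p = at-onto u e in i , cong Fin.suc p } }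
  where open Enumeration E
... | true | E = record
  { at = λ { Fin.zero → Fin.zero ; (Fin.suc i) → Fin.suc (at i) }
  ; at-inj = λ { Fin.zero Fin.zero _ → refl ; (Fin.suc i) (Fin.suc j) e → cong Fin.suc (at-inj i j (FinP.suc-injective e)) }
  ; at-true = λ { Fin.zero → eq ; (Fin.suc i) → at-true i }
  ; at-onto = λ { Fin.zero _ → Fin.zero , refl ; (Fin.suc u) e → let i , p = at-onto u e in Fin.suc i , cong Fin.suc p } }
  where open Enumeration E

-- Any two enumerations of one predicate inject into each other; the other one is `enumerate f`.
-- This is how the pendant vertices of the explicit graphs are counted.
enumeration⇒count : ∀ {n} {f : Fin n → Bool} {k} → Enumeration f k → countTrue f ≡ k
enumeration⇒count {f = f} E = ℕP.≤-antisym (embed (enumerate f) E) (embed E (enumerate f))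
  where
  open Enumeration
  embed : ∀ {a b} → Enumeration f a → Enumeration f b → a ≤ b
  embed A B = injective⇒≤ {f = λ i → proj₁ (at-onto B (at A i) (at-true A i))} λ {i} {j} e → at-inj A i j
    (trans (sym (proj₂ (at-onto B (at A i) (at-true A i)))) (trans (cong (at B) e) (proj₂ (at-onto B (at A j) (at-true A j)))))

-- The map goes from the model to `G`, because `c` and the enumerations send labels to vertices; the
-- inverse is read off from surjectivity.
iso-from : ∀ {n m} {G : Graph n} {H : Graph m} (φ : Fin m → Fin n) → (∀ x y → φ x ≡ φ y → x ≡ y) →
  (∀ v → ∃ λ x → φ x ≡ v) → (∀ x y → G (φ x) (φ y) ≡ H x y) → G ≅ H
iso-from {G = G} {H} φ φ-inj onto edge = mk⤖ {to = to} (inj , λ y → φ y , λ { refl → φ-inj _ _ (proj₂ (onto (φ y))) }) ,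
  λ u v → trans (sym (cong₂ G (proj₂ (onto u)) (proj₂ (onto v)))) (edge (to u) (to v))
  where
  to : _ → _
  to v = proj₁ (onto v)
  inj : ∀ {u v} → to u ≡ to v → u ≡ v
  inj {u} {v} e = trans (sym (proj₂ (onto u))) (trans (cong φ e) (proj₂ (onto v)))

bool-ext : ∀ {a b : Bool} → (a ≡ true → b ≡ true) → (b ≡ true → a ≡ true) → a ≡ b
bool-ext {true} f g = sym (f refl)
bool-ext {false} {true} f g = g refl
bool-ext {false} {false} f g = refl

==-comm : ∀ {m} (u v : Fin m) → (u == v) ≡ (v == u)
==-comm u v = bool-ext (λ e → trans (cong (_== u) (sym (==⇒≡ {u = u} e))) (==-refl u)) (λ e → trans (cong (_== v) (sym (==⇒≡ {u = v} e))) (==-refl v))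

∨-true : ∀ a {b} → a ∨ b ≡ true → a ≡ true ⊎ b ≡ true
∨-true true _ = inj₁ refl
∨-true false e = inj₂ e

∨-introˡ : ∀ {a b} → a ≡ true → a ∨ b ≡ true
∨-introˡ refl = refl

∨-introʳ : ∀ a {b} → b ≡ true → a ∨ b ≡ true
∨-introʳ a refl = ∨-zeroʳ a

∧-true : ∀ {a b} → a ∧ b ≡ true → a ≡ true × b ≡ true
∧-true {true} e = refl , e

∧-intro : ∀ {a b} → a ≡ true → b ≡ true → a ∧ b ≡ true
∧-intro refl refl = refl

CycRel : ℕ → ℕ → ℕ → Set
CycRel r i j = suc i ≡ j ⊎ suc j ≡ i ⊎ (i ≡ r ∸ 1 × j ≡ 0) ⊎ (j ≡ r ∸ 1 × i ≡ 0)

cycAdj⇒rel : ∀ r (i j : Fin r) → cycAdj r i j ≡ true → CycRel r (toℕ i) (toℕ j)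
cycAdj⇒rel r i j e with ∨-true (suc (toℕ i) ≡ᵇ toℕ j) e
... | inj₁ p = inj₁ (≡ᵇ-true p)
... | inj₂ e with ∨-true (suc (toℕ j) ≡ᵇ toℕ i) e
...   | inj₁ p = inj₂ (inj₁ (≡ᵇ-true p))
...   | inj₂ e with ∨-true ((toℕ i ≡ᵇ (r ∸ 1)) ∧ (toℕ j ≡ᵇ 0)) e
...     | inj₁ p = inj₂ (inj₂ (inj₁ (≡ᵇ-true (proj₁ (∧-true p)) , ≡ᵇ-true (proj₂ (∧-true p)))))
...     | inj₂ p = inj₂ (inj₂ (inj₂ (≡ᵇ-true (proj₁ (∧-true p)) , ≡ᵇ-true (proj₂ (∧-true p)))))

rel⇒cycAdj : ∀ r (i j : Fin r) → CycRel r (toℕ i) (toℕ j) → cycAdj r i j ≡ true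
rel⇒cycAdj r i j (inj₁ e) = ∨-introˡ (true-≡ᵇ e)
rel⇒cycAdj r i j (inj₂ (inj₁ e)) = ∨-introʳ (suc (toℕ i) ≡ᵇ toℕ j) (∨-introˡ (true-≡ᵇ e))
rel⇒cycAdj r i j (inj₂ (inj₂ (inj₁ (e , e′)))) = ∨-introʳ (suc (toℕ i) ≡ᵇ toℕ j) (∨-introʳ (suc (toℕ j) ≡ᵇ toℕ i)
  (∨-introˡ (∧-intro (true-≡ᵇ e) (true-≡ᵇ e′))))
rel⇒cycAdj r i j (inj₂ (inj₂ (inj₂ (e , e′)))) = ∨-introʳ (suc (toℕ i) ≡ᵇ toℕ j) (∨-introʳ (suc (toℕ j) ≡ᵇ toℕ i)
  (∨-introʳ ((toℕ i ≡ᵇ (r ∸ 1)) ∧ (toℕ j ≡ᵇ 0)) (∧-intro (true-≡ᵇ e) (true-≡ᵇ e′))))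

module CycleLabels {n} (G : Graph n) (simple : IsSimple G) (S : Skeleton G) where
  open Shape G simple S

  c-gap : ∀ i j → i ≤ j → j < r → c i ≡ c j → i ≡ j
  c-gap i j i≤j j<r e = trans (cong (_+ i) (sym d≡0)) (ℕP.m∸n+n≡m i≤j)
    where
    d≡0 : j ∸ i ≡ 0
    d≡0 = window-inj i (j ∸ i) (ℕP.≤-<-trans (ℕP.m∸n≤m j i) j<r) (trans e (cong c (sym (ℕP.m∸n+n≡m i≤j))))

  c-injective : ∀ i j → i < r → j < r → c i ≡ c j → i ≡ j
  c-injective i j i<r j<r e with ℕP.≤-total i j
  ... | inj₁ i≤j = c-gap i j i≤j j<r e
  ... | inj₂ j≤i = sym (c-gap j i j≤i i<r (sym e))

  c-r : c r ≡ c 0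
  c-r = trans (cong c (sym (ℕP.+-identityʳ r))) (period 0)

  rel⇒adj : ∀ i j → CycRel r i j → c i ~ c j
  rel⇒adj i j (inj₁ refl) = adjacent i
  rel⇒adj i j (inj₂ (inj₁ refl)) = ~-sym (adjacent j)
  rel⇒adj i j (inj₂ (inj₂ (inj₁ (refl , refl)))) = subst (c (2 + len) ~_) c-r (adjacent (2 + len))
  rel⇒adj i j (inj₂ (inj₂ (inj₂ (refl , refl)))) = ~-sym (subst (c (2 + len) ~_) c-r (adjacent (2 + len)))

  adj⇒rel : ∀ i j → i < r → j < r → c i ~ c j → CycRel r i j
  adj⇒rel zero j _ j<r e with chordless (2 + len) j (subst (_~ c j) (sym c-r) e)
  ... | inj₁ p = inj₂ (inj₂ (inj₂ (c-injective j (2 + len) j<r ℕP.≤-refl p , refl)))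
  ... | inj₂ p = inj₁ (sym (c-injective j 1 j<r (s≤s (s≤s z≤n)) (trans p (trans (cong c (ℕP.+-comm 1 r)) (period 1)))))
  adj⇒rel (suc i) j i<r j<r e with chordless i j e
  ... | inj₁ p = inj₂ (inj₁ (cong suc (c-injective j i j<r (ℕP.<-trans (ℕP.n<1+n i) i<r) p)))
  ... | inj₂ p with 2 + i <? r
  ...   | yes q = inj₁ (sym (c-injective j (2 + i) j<r q p))
  ...   | no q = inj₂ (inj₂ (inj₁ (ℕP.suc-injective last , c-injective j 0 j<r (s≤s z≤n) (trans p (trans (cong c last) c-r)))))
    where
    last : 2 + i ≡ r
    last = ℕP.≤-antisym i<r (ℕP.≮⇒≥ q)

  -- The length is a separate variable `R`, so that the labels may live in `Fin (3 * t)` for `G₂`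
  -- with no transport along `r ≡ 3 * t`.
  label-adj : ∀ R → R ≡ r → (i j : Fin R) → G (c (toℕ i)) (c (toℕ j)) ≡ cycAdj R i j
  label-adj R refl i j = bool-ext (λ e → rel⇒cycAdj r i j (adj⇒rel _ _ (toℕ<n i) (toℕ<n j) e)) (λ e → rel⇒adj _ _ (cycAdj⇒rel r i j e))

  label-inj : ∀ R → R ≡ r → (i j : Fin R) → c (toℕ i) ≡ c (toℕ j) → i ≡ j
  label-inj R refl i j e = toℕ-injective (c-injective _ _ (toℕ<n i) (toℕ<n j) e)

  label-onto : ∀ R → R ≡ r → ∀ v → dist v ≡ 0 → ∃ λ (i : Fin R) → c (toℕ i) ≡ v
  label-onto R refl v dv with dist≡0 v dv
  ... | i , refl = fromℕ< (m%n<n i r) , trans (cong c (toℕ-fromℕ< (m%n<n i r))) (c-mod i)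

  -- Injections in both directions between vertices and labels give `n ≡ r`, and `resize` then
  -- changes the size of the model.
  bare⇒cycle : (∀ v → dist v ≡ 0) → G ≅ cycleGraph n
  bare⇒cycle bare = resize (ℕP.≤-antisym (injective⇒≤ {f = λ v → proj₁ (onto v)} λ {u} {v} e →
      trans (sym (proj₂ (onto u))) (trans (cong (λ i → c (toℕ i)) e) (proj₂ (onto v))))
      (injective⇒≤ {f = λ i → c (toℕ i)} (label-inj r refl _ _)))
      (iso-from (λ i → c (toℕ i)) (label-inj r refl) onto (label-adj r refl))
    where
    onto : ∀ v → ∃ λ (i : Fin r) → c (toℕ i) ≡ v
    onto v = label-onto r refl v (bare v)
    resize : ∀ {m} → n ≡ m → G ≅ cycleGraph m → G ≅ cycleGraph n
    resize refl iso = iso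

module Decorate {n} (G : Graph n) (simple : IsSimple G) (S : Skeleton G)
  (flat : ∀ v → Skeleton.dist S v ≤ 1) (x : Fin n) (dx : Skeleton.dist S x ≡ 1) (x~c0 : G x (Skeleton.c S 0) ≡ true) where
  open Shape G simple S
  open CycleLabels G simple S
  open Sun G simple S flat x dx x~c0

  off : Fin n → Bool
  off u = dist u ≡ᵇ 1

  leaf? : ℕ → Fin n → Bool
  leaf? i u = if off u then G (c i) u else false

  leaf?-true : ∀ {i u} → leaf? i u ≡ true → dist u ≡ 1 × c i ~ u
  leaf?-true {i} {u} e with off u in eq
  ... | true = ≡ᵇ-true eq , e

  true-leaf? : ∀ {i u} → dist u ≡ 1 → c i ~ u → leaf? i u ≡ true
  true-leaf? du e rewrite du = e

  off-c : ∀ i → off (c i) ≡ false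
  off-c i rewrite dist-c i = refl

  pendants : ∀ i k → deg G (c i) ≡ 2 + k → Enumeration (leaf? i) k
  pendants i k e = subst (Enumeration (leaf? i)) (ℕP.+-cancelˡ-≡ 2 _ _ (trans (sym (deg-two+ off (prev≢next i) (prev~ i) (adjacent i) (off-c _) (off-c _)
    (λ u p a b → true-≡ᵇ (other-nbrs i u p a b)))) e)) (enumerate (leaf? i))

  flat-cases : ∀ v → dist v ≡ 0 ⊎ dist v ≡ 1
  flat-cases v with dist v | flat v
  ... | zero | _ = inj₁ refl
  ... | suc zero | _ = inj₂ refl
  ... | suc (suc _) | s≤s ()

  leaf-adj : ∀ {R} → R ≡ r → ∀ (i j : Fin R) {u} → dist u ≡ 1 → c (toℕ j) ~ u → G (c (toℕ i)) u ≡ (i == j)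
  leaf-adj {R} R≡r i j {u} du e = bool-ext
    (λ q → trans (cong (i ==_) (label-inj R R≡r j i (sym (proj₂ (only-at du (~-sym e)) _ (~-sym q))))) (==-refl i))
    (λ q → subst (λ k → c (toℕ k) ~ u) (sym (==⇒≡ q)) e)

  leaf-leaf : ∀ {u v} → dist u ≡ 1 → dist v ≡ 1 → G u v ≡ false
  leaf-leaf {u} {v} du dv with G u v in eq
  ... | false = refl
  ... | true with pendant u du
  ...   | i , (_ , only) = ⊥-elim (off≢c i dv (only v eq))

  all-big⇒G₁ : ∀ k → (∀ i → deg G (c i) ≡ 3 + k) → G ≅ G₁ r (suc k)
  all-big⇒G₁ k big = iso-from φ φ-inj φ-onto φ-adj
    where
    E : ∀ i → Enumeration (leaf? i) (suc k)
    E i = pendants i (suc k) (big i)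
    module E i = Enumeration (E i)
    ψ : Fin r × Fin (suc (suc k)) → Fin n
    ψ (i , Fin.zero) = c (toℕ i)
    ψ (i , Fin.suc p) = E.at (toℕ i) p
    φ : Fin (r * suc (suc k)) → Fin n
    φ x = ψ (remQuot {r} (suc (suc k)) x)
    dist-leaf : ∀ (i : Fin r) p → dist (E.at (toℕ i) p) ≡ 1
    dist-leaf i p = proj₁ (leaf?-true {toℕ i} (E.at-true (toℕ i) p))
    leaf~ : ∀ (i : Fin r) p → c (toℕ i) ~ E.at (toℕ i) p
    leaf~ i p = proj₂ (leaf?-true {toℕ i} (E.at-true (toℕ i) p))
    ψ-inj : ∀ a b → ψ a ≡ ψ b → a ≡ b
    ψ-inj (i , Fin.zero) (j , Fin.zero) e = cong (_, Fin.zero) (label-inj r refl i j e)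
    ψ-inj (i , Fin.zero) (j , Fin.suc p) e = ⊥-elim (off≢c (toℕ i) (dist-leaf j p) (sym e))
    ψ-inj (i , Fin.suc p) (j , Fin.zero) e = ⊥-elim (off≢c (toℕ j) (dist-leaf i p) e)
    ψ-inj (i , Fin.suc p) (j , Fin.suc q) e with label-inj r refl j i (proj₂ (only-at (dist-leaf i p) (~-sym (leaf~ i p))) (c (toℕ j)) (~-sym (subst (c (toℕ j) ~_) (sym e) (leaf~ j q))))
    ... | refl = cong (λ p → i , Fin.suc p) (E.at-inj (toℕ i) p q e)
    φ-inj : ∀ a b → φ a ≡ φ b → a ≡ b
    φ-inj a b e = trans (sym (combine-remQuot {r} (suc (suc k)) a))
      (trans (cong (λ q → combine (proj₁ q) (proj₂ q)) (ψ-inj (remQuot {r} (suc (suc k)) a) (remQuot {r} (suc (suc k)) b) e)) (combine-remQuot {r} (suc (suc k)) b))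
    ψ-onto : ∀ v → ∃ λ a → ψ a ≡ v
    ψ-onto v with flat-cases v
    ... | inj₁ dv = let i , e = label-onto r refl v dv in (i , Fin.zero) , e
    ... | inj₂ dv with pendant v dv
    ...   | j , (v~cj , _) with label-onto r refl (c j) (dist-c j)
    ...     | i , e with E.at-onto (toℕ i) v (true-leaf? dv (subst (_~ v) (sym e) (~-sym v~cj)))
    ...       | p , q = (i , Fin.suc p) , q
    φ-onto : ∀ v → ∃ λ a → φ a ≡ v
    φ-onto v with ψ-onto v
    ... | (i , p) , e = combine i p , trans (cong ψ (remQuot-combine i p)) e
    φ-adj : ∀ a b → G (φ a) (φ b) ≡ G₁ r (suc k) a b
    φ-adj a b with remQuot {r} (suc (suc k)) a | remQuot {r} (suc (suc k)) b
    ... | i , Fin.zero | j , Fin.zero = label-adj r refl i j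
    ... | i , Fin.zero | j , Fin.suc q = leaf-adj refl i j (dist-leaf j q) (leaf~ j q)
    ... | i , Fin.suc p | j , Fin.zero = trans (symmetric _ _) (trans (leaf-adj refl j i (dist-leaf i p) (leaf~ i p)) (==-comm j i))
    ... | i , Fin.suc p | j , Fin.suc q = leaf-leaf (dist-leaf i p) (dist-leaf j q)

  every-third⇒G₂ : ∀ t → r ≡ 3 * t → (∀ m → deg G (c (3 * m)) ≡ 3 × deg G (c (1 + 3 * m)) ≡ 2 × deg G (c (2 + 3 * m)) ≡ 2) → G ≅ G₂ t
  every-third⇒G₂ t r≡ degs = iso-from φ φ-inj φ-onto φ-adj
    where
    R≡r : 3 * t ≡ r
    R≡r = sym r≡
    E : ∀ m → Enumeration (leaf? (3 * m)) 1
    E m = pendants (3 * m) 1 (proj₁ (degs m))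
    leaf : ℕ → Fin n
    leaf m = Enumeration.at (E m) Fin.zero
    dist-leaf : ∀ m → dist (leaf m) ≡ 1
    dist-leaf m = proj₁ (leaf?-true {3 * m} (Enumeration.at-true (E m) Fin.zero))
    leaf~ : ∀ m → c (3 * m) ~ leaf m
    leaf~ m = proj₂ (leaf?-true {3 * m} (Enumeration.at-true (E m) Fin.zero))
    3*< : ∀ (s : Fin t) → 3 * toℕ s < r
    3*< s = subst (3 * toℕ s <_) R≡r (ℕP.*-monoʳ-< 3 (toℕ<n s))
    <r : ∀ (i : Fin (3 * t)) → toℕ i < r
    <r i = subst (toℕ i <_) R≡r (toℕ<n i)
    ψ : Fin (3 * t) ⊎ Fin t → Fin n
    ψ (inj₁ i) = c (toℕ i)
    ψ (inj₂ s) = leaf (toℕ s)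
    φ : Fin (3 * t + t) → Fin n
    φ x = ψ (splitAt (3 * t) x)
    ψ-inj : ∀ a b → ψ a ≡ ψ b → a ≡ b
    ψ-inj (inj₁ i) (inj₁ j) e = cong inj₁ (label-inj (3 * t) R≡r i j e)
    ψ-inj (inj₁ i) (inj₂ s) e = ⊥-elim (off≢c (toℕ i) (dist-leaf (toℕ s)) (sym e))
    ψ-inj (inj₂ s) (inj₁ i) e = ⊥-elim (off≢c (toℕ i) (dist-leaf (toℕ s)) e)
    ψ-inj (inj₂ s) (inj₂ s′) e = cong inj₂ (toℕ-injective (ℕP.*-cancelˡ-≡ _ _ 3 (c-injective _ _ (3*< s) (3*< s′)
      (sym (proj₂ (only-at (dist-leaf (toℕ s)) (~-sym (leaf~ (toℕ s)))) _ (~-sym (subst (c (3 * toℕ s′) ~_) (sym e) (leaf~ (toℕ s′)))))))))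
    φ-inj : ∀ a b → φ a ≡ φ b → a ≡ b
    φ-inj a b e = trans (sym (join-splitAt (3 * t) t a)) (trans (cong (Fin.join (3 * t) t) (ψ-inj (splitAt (3 * t) a) (splitAt (3 * t) b) e)) (join-splitAt (3 * t) t b))
    -- A pendant neighbour besides the two cycle neighbours would already make the degree 3; so
    -- pendant vertices sit only at indices divisible by 3.
    not-small : ∀ {i v} → dist v ≡ 1 → v ~ c i → deg G (c i) ≡ 2 → ⊥
    not-small {i} dv e d = ℕP.<-irrefl refl (subst (3 ≤_) d (3≤deg (off≢c _ dv) (off≢c _ dv) (prev≢next i) (~-sym e) (prev~ i) (adjacent i)))
    ψ-onto : ∀ v → ∃ λ a → ψ a ≡ v
    ψ-onto v with flat-cases v
    ... | inj₁ dv = let i , e = label-onto (3 * t) R≡r v dv in inj₁ i , e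
    ... | inj₂ dv with pendant v dv
    ...   | j , (v~cj , _) with label-onto (3 * t) R≡r (c j) (dist-c j)
    ...     | i , e with residue (toℕ i)
    ...       | m , inj₂ (inj₁ p) = ⊥-elim (not-small dv (subst (v ~_) (trans (sym e) (cong c p)) v~cj) (proj₁ (proj₂ (degs m))))
    ...       | m , inj₂ (inj₂ p) = ⊥-elim (not-small dv (subst (v ~_) (trans (sym e) (cong c p)) v~cj) (proj₂ (proj₂ (degs m))))
    ...       | m , inj₁ p = inj₂ (fromℕ< m<t) , trans (cong leaf (toℕ-fromℕ< m<t)) leaf≡v
      where
      m<t : m < t
      m<t = ℕP.*-cancelˡ-< 3 m t (subst (_< 3 * t) p (toℕ<n i))
      leaf≡v : leaf m ≡ v
      leaf≡v with Enumeration.at-onto (E m) v (true-leaf? dv (subst (_~ v) (sym (trans (cong c (sym p)) e)) (~-sym v~cj)))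
      ... | Fin.zero , q = q
    φ-onto : ∀ v → ∃ λ a → φ a ≡ v
    φ-onto v with ψ-onto v
    ... | a , e = Fin.join (3 * t) t a , trans (cong ψ (splitAt-join (3 * t) t a)) e
    mixed : ∀ (i : Fin (3 * t)) (s : Fin t) → G (c (toℕ i)) (leaf (toℕ s)) ≡ (toℕ i ≡ᵇ 3 * toℕ s)
    mixed i s = bool-ext
      (λ e → true-≡ᵇ (c-injective _ _ (<r i) (3*< s) (proj₂ (only-at (dist-leaf (toℕ s)) (~-sym (leaf~ (toℕ s)))) _ (~-sym e))))
      (λ e → subst (λ i → c i ~ leaf (toℕ s)) (sym (≡ᵇ-true {toℕ i} e)) (leaf~ (toℕ s)))
    φ-adj : ∀ a b → G (φ a) (φ b) ≡ G₂ t a b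
    φ-adj a b with splitAt (3 * t) a | splitAt (3 * t) b
    ... | inj₁ i | inj₁ j = label-adj (3 * t) R≡r i j
    ... | inj₁ i | inj₂ s = mixed i s
    ... | inj₂ s | inj₁ i = trans (symmetric _ _) (mixed i s)
    ... | inj₂ s | inj₂ s′ = leaf-leaf (dist-leaf (toℕ s)) (dist-leaf (toℕ s′))

-- The degrees of G₁ and G₂

-- The hypotheses of `linear⇒two-main`, kept free of the field so that they can be computed on the
-- models and carried along an isomorphism.
record LinearDegrees {n} (G : Graph n) : Set where
  field
    A B       : ℕ
    linear    : ∀ v → F G v + B ≡ A * deg G v
    u₀ v₀     : Fin n
    irregular : deg G u₀ ≢ deg G v₀

transport : ∀ {n m} {G : Graph n} {H : Graph m} → G ≅ H → LinearDegrees H → LinearDegrees G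
transport {G = G} {H} (f , edge) L = record
  { A = A ; B = B
  ; linear = λ v → trans (cong (_+ B) (cong₂ (λ d s → d * d + s) (deg≡ v) (nbrDeg≡ v))) (trans (linear (to v)) (cong (A *_) (sym (deg≡ v))))
  ; u₀ = π ⟨$⟩ˡ u₀ ; v₀ = π ⟨$⟩ˡ v₀
  ; irregular = λ e → irregular (trans (sym (deg-from u₀)) (trans e (deg-from v₀))) }
  where
  open LinearDegrees L
  π : Permutation _ _
  π = ⤖⇒↔ f
  to : _ → _
  to = Bijection.to f
  deg≡ : ∀ v → deg G v ≡ deg H (to v)
  deg≡ v = trans (countTrue≡sum (G v)) (trans (ΣN.sum-cong-≗ (λ u → cong 𝟙 (edge v u)))
    (trans (sym (ΣN.sum-permute (λ x → 𝟙 (H (to v) x)) π)) (sym (countTrue≡sum (H (to v))))))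
  nbrDeg≡ : ∀ v → nbrDeg G v ≡ nbrDeg H (to v)
  nbrDeg≡ v = trans (ΣN.sum-cong-≗ (λ u → cong₂ (λ b d → 𝟙 b * d) (edge v u) (deg≡ u)))
    (sym (ΣN.sum-permute (λ x → 𝟙 (H (to v) x) * deg H x) π))
  deg-from : ∀ x → deg G (π ⟨$⟩ˡ x) ≡ deg H x
  deg-from x = trans (deg≡ (π ⟨$⟩ˡ x)) (cong (deg H) (inverseʳ π))

-- `before` and `after` keep the wrap-around explicit; for `G₂` the residues of the neighbours
-- modulo 3 are read off from them.
record CycleNbrs (r : ℕ) (i : Fin r) : Set where
  field
    a b  : Fin r
    a≢b  : a ≢ b
    i~a  : cycAdj r i a ≡ true
    i~b  : cycAdj r i b ≡ true
    only : ∀ j → cycAdj r i j ≡ true → j ≡ a ⊎ j ≡ b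
    before : suc (toℕ a) ≡ toℕ i ⊎ (toℕ i ≡ 0 × suc (toℕ a) ≡ r)
    after  : toℕ b ≡ suc (toℕ i) ⊎ (suc (toℕ i) ≡ r × toℕ b ≡ 0)

cycleNbrs : ∀ {r} → 3 ≤ r → (i : Fin r) → CycleNbrs r i
cycleNbrs {r} (s≤s (s≤s (s≤s {n = l} z≤n))) i = record
  { a = a ; b = b ; a≢b = λ e → distinct before after (cong toℕ e)
  ; i~a = rel⇒cycAdj r i a (rel-a before)
  ; i~b = rel⇒cycAdj r i b (rel-b after)
  ; only = λ j e → only before after j (cycAdj⇒rel r i j e)
  ; before = before ; after = after }
  where
  prev : ∀ m → m < r → ∃ λ (a : Fin r) → suc (toℕ a) ≡ m ⊎ (m ≡ 0 × suc (toℕ a) ≡ r)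
  prev zero _ = fromℕ< ℕP.≤-refl , inj₂ (refl , cong suc (toℕ-fromℕ< {2 + l} {r} ℕP.≤-refl))
  prev (suc m) p = fromℕ< (ℕP.<⇒≤ p) , inj₁ (cong suc (toℕ-fromℕ< (ℕP.<⇒≤ p)))
  next : ∃ λ (b : Fin r) → toℕ b ≡ suc (toℕ i) ⊎ (suc (toℕ i) ≡ r × toℕ b ≡ 0)
  next with suc (toℕ i) <? r
  ... | yes p = fromℕ< p , inj₁ (toℕ-fromℕ< p)
  ... | no p = Fin.zero , inj₂ (ℕP.≤-antisym (toℕ<n i) (ℕP.≮⇒≥ p) , refl)
  a b : Fin r
  a = proj₁ (prev (toℕ i) (toℕ<n i))
  b = proj₁ next
  Before After : Set
  Before = suc (toℕ a) ≡ toℕ i ⊎ (toℕ i ≡ 0 × suc (toℕ a) ≡ r)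
  After = toℕ b ≡ suc (toℕ i) ⊎ (suc (toℕ i) ≡ r × toℕ b ≡ 0)
  before : Before
  before = proj₂ (prev (toℕ i) (toℕ<n i))
  after : After
  after = proj₂ next
  rel-a : Before → CycRel r (toℕ i) (toℕ a)
  rel-a (inj₁ e) = inj₂ (inj₁ e)
  rel-a (inj₂ (p , q)) = inj₂ (inj₂ (inj₂ (ℕP.suc-injective q , p)))
  rel-b : After → CycRel r (toℕ i) (toℕ b)
  rel-b (inj₁ e) = inj₁ (sym e)
  rel-b (inj₂ (p , q)) = inj₂ (inj₂ (inj₁ (ℕP.suc-injective p , q)))
  -- Without wrap-around the indices differ by 2; with it, a coincidence would force `r ≤ 2`.
  distinct : Before → After → toℕ a ≡ toℕ b → ⊥
  distinct (inj₁ p) (inj₁ q) e = ℕP.m≢1+n+m (toℕ i) {1} (trans (sym p) (cong suc (trans e q)))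
  distinct (inj₁ p) (inj₂ (q , q′)) e with trans (cong suc (trans (cong suc (trans (sym q′) (sym e))) p)) q
  ... | ()
  distinct (inj₂ (p , p′)) (inj₁ q) e with trans (sym (cong suc (trans e (trans q (cong suc p))))) p′
  ... | ()
  distinct (inj₂ (p , p′)) (inj₂ (q , q′)) e with trans (sym (cong suc p)) q
  ... | ()
  only : Before → After → ∀ j → CycRel r (toℕ i) (toℕ j) → j ≡ a ⊎ j ≡ b
  only _ (inj₁ q) j (inj₁ e) = inj₂ (toℕ-injective (trans (sym e) (sym q)))
  only _ (inj₂ (q , _)) j (inj₁ e) = ⊥-elim (ℕP.<-irrefl (trans (sym e) q) (toℕ<n j))
  only (inj₁ p) _ j (inj₂ (inj₁ e)) = inj₁ (toℕ-injective (ℕP.suc-injective (trans e (sym p))))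
  only (inj₂ (p , _)) _ j (inj₂ (inj₁ e)) = ⊥-elim (ℕP.1+n≢0 (trans e p))
  only _ (inj₁ q) j (inj₂ (inj₂ (inj₁ (e , _)))) = ⊥-elim (ℕP.<-irrefl (trans q (cong suc e)) (toℕ<n b))
  only _ (inj₂ (_ , q)) j (inj₂ (inj₂ (inj₁ (_ , e)))) = inj₂ (toℕ-injective (trans e (sym q)))
  only (inj₁ p) _ j (inj₂ (inj₂ (inj₂ (_ , e)))) = ⊥-elim (ℕP.1+n≢0 (trans p e))
  only (inj₂ (_ , p)) _ j (inj₂ (inj₂ (inj₂ (e , _)))) = inj₁ (toℕ-injective (trans e (ℕP.suc-injective (sym p))))

module _ {n} (H : Graph n) where
  open Neighbours H

  cycle-vertex : ∀ {v a b} (off : Fin n → Bool) k → a ≢ b → H v a ≡ true → H v b ≡ true → off a ≡ false → off b ≡ false →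
    (∀ u → H v u ≡ true → u ≢ a → u ≢ b → off u ≡ true) → (∀ u → H v u ≡ true → off u ≡ true → deg H u ≡ 1) →
    Enumeration (λ u → if off u then H v u else false) k → deg H v ≡ 2 + k × nbrDeg H v ≡ deg H a + deg H b + k
  cycle-vertex {v} {a} {b} off k a≢b va vb oa ob others leaves E = d ,
    ℕP.+-cancelʳ-≡ 2 _ _ (trans (N-two (deg H) v a b 1 a≢b va vb (λ u p q q′ → leaves u p (others u p q q′)))
      (trans (cong (λ d → deg H a + deg H b + d * 1) d) (lem (deg H a + deg H b) k)))
    where
    d : deg H v ≡ 2 + k
    d = trans (deg-two+ off a≢b va vb oa ob others) (cong (2 +_) (enumeration⇒count E))
    lem : ∀ s k → s + (2 + k) * 1 ≡ s + k + 2
    lem = solve-∀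

module G₁-degrees (r k : ℕ) (3≤r : 3 ≤ r) where
  H : Graph (r * suc k)
  H = G₁ r k

  open Neighbours H

  -- `G₁` on coordinates. `G₁` itself matches on `remQuot` of its arguments and does not reduce at a
  -- vertex given by `combine`.
  adj : Fin r × Fin (suc k) → Fin r × Fin (suc k) → Bool
  adj (i , Fin.zero) (j , Fin.zero) = cycAdj r i j
  adj (i , Fin.zero) (j , Fin.suc _) = i == j
  adj (i , Fin.suc _) (j , Fin.zero) = i == j
  adj (i , Fin.suc _) (j , Fin.suc _) = false

  coord : Fin (r * suc k) → Fin r × Fin (suc k)
  coord = remQuot {r} (suc k)

  vertex : Fin r × Fin (suc k) → Fin (r * suc k)
  vertex (i , p) = combine i p

  coord-vertex : ∀ a → coord (vertex a) ≡ a
  coord-vertex (i , p) = remQuot-combine i p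

  vertex-coord : ∀ v → vertex (coord v) ≡ v
  vertex-coord v = combine-remQuot {r} (suc k) v

  H≡adj : ∀ u v → H u v ≡ adj (coord u) (coord v)
  H≡adj u v with coord u | coord v
  ... | i , Fin.zero | j , Fin.zero = refl
  ... | i , Fin.zero | j , Fin.suc _ = refl
  ... | i , Fin.suc _ | j , Fin.zero = refl
  ... | i , Fin.suc _ | j , Fin.suc _ = refl

  H-vertex : ∀ a b → H (vertex a) (vertex b) ≡ adj a b
  H-vertex a b = trans (H≡adj (vertex a) (vertex b)) (cong₂ adj (coord-vertex a) (coord-vertex b))

  by-coord : {P : Fin (r * suc k) → Set} → (∀ a → P (vertex a)) → ∀ v → P v
  by-coord {P} f v = subst P (vertex-coord v) (f (coord v))

  vertex-inj : ∀ {a b} → vertex a ≡ vertex b → a ≡ b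
  vertex-inj {a} {b} e = trans (sym (coord-vertex a)) (trans (cong coord e) (coord-vertex b))

  leaf-only : ∀ i p → Only (vertex (i , Fin.suc p)) (vertex (i , Fin.zero))
  leaf-only i p = trans (H-vertex _ _) (==-refl i) , by-coord λ a e → only a (trans (sym (H-vertex (i , Fin.suc p) a)) e)
    where
    only : ∀ a → adj (i , Fin.suc p) a ≡ true → vertex a ≡ vertex (i , Fin.zero)
    only (j , Fin.zero) e = cong (λ j → vertex (j , Fin.zero)) (sym (==⇒≡ e))

  is-off : Fin r × Fin (suc k) → Bool
  is-off (_ , Fin.zero) = false
  is-off (_ , Fin.suc _) = true

  off : Fin (r * suc k) → Bool
  off v = is-off (coord v)

  off-vertex : ∀ a → off (vertex a) ≡ is-off a
  off-vertex a = cong is-off (coord-vertex a)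

  at-cycle : ∀ i → let open CycleNbrs (cycleNbrs 3≤r i) in
    deg H (vertex (i , Fin.zero)) ≡ 2 + k × nbrDeg H (vertex (i , Fin.zero)) ≡ deg H (vertex (a , Fin.zero)) + deg H (vertex (b , Fin.zero)) + k
  at-cycle i = cycle-vertex H off k (λ e → a≢b (cong proj₁ (vertex-inj e))) (trans (H-vertex _ _) i~a) (trans (H-vertex _ _) i~b) (off-vertex _) (off-vertex _)
    (by-coord λ u e ne ne′ → trans (off-vertex u) (others u (trans (sym (H-vertex _ u)) e) (λ p → ne (cong vertex p)) (λ p → ne′ (cong vertex p))))
    (by-coord λ u e o → leaves u (trans (sym (off-vertex u)) o))
    (record { at = λ p → vertex (i , Fin.suc p)
            ; at-inj = λ p q e → FinP.suc-injective (cong proj₂ (vertex-inj e))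
            ; at-true = λ p → trans (cong₂ (λ o e → if o then e else false) (off-vertex (i , Fin.suc p)) (H-vertex (i , Fin.zero) (i , Fin.suc p))) (==-refl i)
            ; at-onto = by-coord λ u e → onto u (trans (sym (cong₂ (λ o e → if o then e else false) (off-vertex u) (H-vertex (i , Fin.zero) u))) e) })
    where
    open CycleNbrs (cycleNbrs 3≤r i)
    others : ∀ u → adj (i , Fin.zero) u ≡ true → u ≢ (a , Fin.zero) → u ≢ (b , Fin.zero) → is-off u ≡ true
    others (j , Fin.suc _) _ _ _ = refl
    others (j , Fin.zero) e ne ne′ with only j e
    ... | inj₁ p = ⊥-elim (ne (cong (_, Fin.zero) p))
    ... | inj₂ p = ⊥-elim (ne′ (cong (_, Fin.zero) p))
    leaves : ∀ u → is-off u ≡ true → deg H (vertex u) ≡ 1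
    leaves (j , Fin.suc p) _ = deg-only (leaf-only j p)
    onto : ∀ u → (if is-off u then adj (i , Fin.zero) u else false) ≡ true → ∃ λ p → vertex (i , Fin.suc p) ≡ vertex u
    onto (j , Fin.suc p) e = p , cong (λ j → vertex (j , Fin.suc p)) (==⇒≡ e)

  linear-degrees : 1 ≤ k → LinearDegrees H
  linear-degrees (s≤s {n = k′} _) = record
    -- The points are `(1, k + 3)` for a pendant vertex and `(k + 2, k² + 7 k + 8)` for a cycle
    -- vertex; the line through them has slope `k + 5`.
    { A = 5 + k ; B = 2 ; linear = by-coord linear
    ; u₀ = vertex (i₀ , Fin.zero) ; v₀ = vertex (i₀ , Fin.suc Fin.zero)
    ; irregular = λ e → ℕP.1+n≢0 (ℕP.suc-injective (trans (sym (proj₁ (at-cycle i₀))) (trans e (deg-only (leaf-only i₀ Fin.zero))))) }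
    where
    i₀ : Fin r
    i₀ = fromℕ< (ℕP.≤-trans (s≤s z≤n) 3≤r)
    linear : ∀ a → F H (vertex a) + 2 ≡ (5 + k) * deg H (vertex a)
    linear (i , Fin.zero) = trans (cong₂ (λ d s → d * d + s + 2) (proj₁ (at-cycle i)) (trans (proj₂ (at-cycle i)) (cong₂ (λ d d′ → d + d′ + k) (proj₁ (at-cycle _)) (proj₁ (at-cycle _)))))
      (trans (lem k) (cong ((5 + k) *_) (sym (proj₁ (at-cycle i)))))
      where
      lem : ∀ k → (2 + k) * (2 + k) + (2 + k + (2 + k) + k) + 2 ≡ (5 + k) * (2 + k)
      lem = solve-∀
    linear (i , Fin.suc p) = trans (cong (_+ 2) (trans (F-only (leaf-only i p)) (cong suc (proj₁ (at-cycle i))))) (trans (lem k) (cong ((5 + k) *_) (sym (deg-only (leaf-only i p)))))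
      where
      lem : ∀ k → 1 + (2 + k) + 2 ≡ (5 + k) * 1
      lem = solve-∀

3∤1+3* : ∀ m l → 3 * m ≢ 1 + 3 * l
3∤1+3* m l e with trans (sym ([m+kn]%n≡m%n 0 m 3)) (trans (cong (_% 3) (trans (ℕP.*-comm m 3) (trans e (cong suc (ℕP.*-comm 3 l))))) ([m+kn]%n≡m%n 1 l 3))
... | ()

3∤2+3* : ∀ m l → 3 * m ≢ 2 + 3 * l
3∤2+3* m l e with trans (sym ([m+kn]%n≡m%n 0 m 3)) (trans (cong (_% 3) (trans (ℕP.*-comm m 3) (trans e (cong (2 +_) (ℕP.*-comm 3 l))))) ([m+kn]%n≡m%n 2 l 3))
... | ()

module G₂-degrees (t : ℕ) (1≤t : 1 ≤ t) where
  H : Graph (3 * t + t)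
  H = G₂ t

  open Neighbours H

  3≤3t : 3 ≤ 3 * t
  3≤3t = ℕP.*-monoʳ-≤ 3 1≤t

  adj : Fin (3 * t) ⊎ Fin t → Fin (3 * t) ⊎ Fin t → Bool
  adj (inj₁ i) (inj₁ j) = cycAdj (3 * t) i j
  adj (inj₁ i) (inj₂ s) = toℕ i ≡ᵇ 3 * toℕ s
  adj (inj₂ s) (inj₁ i) = toℕ i ≡ᵇ 3 * toℕ s
  adj (inj₂ _) (inj₂ _) = false

  coord : Fin (3 * t + t) → Fin (3 * t) ⊎ Fin t
  coord = splitAt (3 * t)

  vertex : Fin (3 * t) ⊎ Fin t → Fin (3 * t + t)
  vertex = Fin.join (3 * t) t

  coord-vertex : ∀ a → coord (vertex a) ≡ a
  coord-vertex = splitAt-join (3 * t) t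

  H≡adj : ∀ u v → H u v ≡ adj (coord u) (coord v)
  H≡adj u v with coord u | coord v
  ... | inj₁ _ | inj₁ _ = refl
  ... | inj₁ _ | inj₂ _ = refl
  ... | inj₂ _ | inj₁ _ = refl
  ... | inj₂ _ | inj₂ _ = refl

  H-vertex : ∀ a b → H (vertex a) (vertex b) ≡ adj a b
  H-vertex a b = trans (H≡adj (vertex a) (vertex b)) (cong₂ adj (coord-vertex a) (coord-vertex b))

  by-coord : {P : Fin (3 * t + t) → Set} → (∀ a → P (vertex a)) → ∀ v → P v
  by-coord {P} f v = subst P (join-splitAt (3 * t) t v) (f (coord v))

  vertex-inj : ∀ {a b} → vertex a ≡ vertex b → a ≡ b
  vertex-inj {a} {b} e = trans (sym (coord-vertex a)) (trans (cong coord e) (coord-vertex b))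

  base : Fin t → Fin (3 * t)
  base s = fromℕ< (ℕP.*-monoʳ-< 3 (toℕ<n s))

  toℕ-base : ∀ s → toℕ (base s) ≡ 3 * toℕ s
  toℕ-base s = toℕ-fromℕ< (ℕP.*-monoʳ-< 3 (toℕ<n s))

  leaf-only : ∀ s → Only (vertex (inj₂ s)) (vertex (inj₁ (base s)))
  leaf-only s = trans (H-vertex (inj₂ s) (inj₁ (base s))) (true-≡ᵇ (toℕ-base s)) , by-coord λ a e → only a (trans (sym (H-vertex (inj₂ s) a)) e)
    where
    only : ∀ a → adj (inj₂ s) a ≡ true → vertex a ≡ vertex (inj₁ (base s))
    only (inj₁ i) e = cong (λ i → vertex (inj₁ i)) (toℕ-injective (trans (≡ᵇ-true {toℕ i} e) (sym (toℕ-base s))))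

  is-off : Fin (3 * t) ⊎ Fin t → Bool
  is-off (inj₁ _) = false
  is-off (inj₂ _) = true

  off : Fin (3 * t + t) → Bool
  off v = is-off (coord v)

  off-vertex : ∀ a → off (vertex a) ≡ is-off a
  off-vertex a = cong is-off (coord-vertex a)

  Pendants : Fin (3 * t) → ℕ → Set
  Pendants i = Enumeration (λ u → if off u then H (vertex (inj₁ i)) u else false)

  pendant-vertex : ∀ i u → (if off (vertex u) then H (vertex (inj₁ i)) (vertex u) else false) ≡ (if is-off u then adj (inj₁ i) u else false)
  pendant-vertex i u = cong₂ (λ o e → if o then e else false) (off-vertex u) (H-vertex (inj₁ i) u)

  one-pendant : ∀ i m → toℕ i ≡ 3 * m → Pendants i 1
  one-pendant i m e = record
    { at = λ _ → vertex (inj₂ s)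
    ; at-inj = λ { Fin.zero Fin.zero _ → refl }
    ; at-true = λ _ → trans (pendant-vertex i (inj₂ s)) (true-≡ᵇ (trans e (cong (3 *_) (sym (toℕ-fromℕ< m<t)))))
    ; at-onto = by-coord λ u p → onto u (trans (sym (pendant-vertex i u)) p) }
    where
    m<t : m < t
    m<t = ℕP.*-cancelˡ-< 3 m t (subst (_< 3 * t) e (toℕ<n i))
    s : Fin t
    s = fromℕ< m<t
    onto : ∀ u → (if is-off u then adj (inj₁ i) u else false) ≡ true → ∃ λ (_ : Fin 1) → vertex (inj₂ s) ≡ vertex u
    onto (inj₂ s′) p = Fin.zero , cong (λ s → vertex (inj₂ s)) (toℕ-injective (trans (toℕ-fromℕ< m<t) (ℕP.*-cancelˡ-≡ _ _ 3 (trans (sym e) (≡ᵇ-true {toℕ i} p)))))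

  no-pendant : ∀ i → (∀ m → 3 * m ≢ toℕ i) → Pendants i 0
  no-pendant i ne = record
    { at = λ () ; at-inj = λ () ; at-true = λ ()
    ; at-onto = by-coord λ u p → onto u (trans (sym (pendant-vertex i u)) p) }
    where
    onto : ∀ u → (if is-off u then adj (inj₁ i) u else false) ≡ true → ∃ λ (_ : Fin 0) → _
    onto (inj₂ s) p = ⊥-elim (ne (toℕ s) (sym (≡ᵇ-true {toℕ i} p)))

  at-cycle : ∀ i k → Pendants i k → let open CycleNbrs (cycleNbrs 3≤3t i) in
    deg H (vertex (inj₁ i)) ≡ 2 + k × nbrDeg H (vertex (inj₁ i)) ≡ deg H (vertex (inj₁ a)) + deg H (vertex (inj₁ b)) + k
  at-cycle i k = cycle-vertex H off k (λ e → a≢b (inj₁-injective (vertex-inj {inj₁ a} {inj₁ b} e)))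
    (trans (H-vertex (inj₁ i) (inj₁ a)) i~a) (trans (H-vertex (inj₁ i) (inj₁ b)) i~b) (off-vertex (inj₁ a)) (off-vertex (inj₁ b))
    (by-coord λ u e ne ne′ → trans (off-vertex u) (others u (trans (sym (H-vertex (inj₁ i) u)) e) (λ p → ne (cong vertex p)) (λ p → ne′ (cong vertex p))))
    (by-coord λ u e o → leaves u (trans (sym (off-vertex u)) o))
    where
    open CycleNbrs (cycleNbrs 3≤3t i)
    others : ∀ u → adj (inj₁ i) u ≡ true → u ≢ inj₁ a → u ≢ inj₁ b → is-off u ≡ true
    others (inj₂ _) _ _ _ = refl
    others (inj₁ j) e ne ne′ with only j e
    ... | inj₁ p = ⊥-elim (ne (cong inj₁ p))
    ... | inj₂ p = ⊥-elim (ne′ (cong inj₁ p))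
    leaves : ∀ u → is-off u ≡ true → deg H (vertex u) ≡ 1
    leaves (inj₂ s) _ = deg-only (leaf-only s)

  deg₀ : ∀ i m → toℕ i ≡ 3 * m → deg H (vertex (inj₁ i)) ≡ 3
  deg₀ i m e = proj₁ (at-cycle i 1 (one-pendant i m e))

  none₁ : ∀ i m → toℕ i ≡ 1 + 3 * m → Pendants i 0
  none₁ i m e = no-pendant i (λ l p → 3∤1+3* l m (trans p e))

  none₂ : ∀ i m → toℕ i ≡ 2 + 3 * m → Pendants i 0
  none₂ i m e = no-pendant i (λ l p → 3∤2+3* l m (trans p e))

  deg₁ : ∀ i m → toℕ i ≡ 1 + 3 * m → deg H (vertex (inj₁ i)) ≡ 2
  deg₁ i m e = proj₁ (at-cycle i 0 (none₁ i m e))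

  deg₂ : ∀ i m → toℕ i ≡ 2 + 3 * m → deg H (vertex (inj₁ i)) ≡ 2
  deg₂ i m e = proj₁ (at-cycle i 0 (none₂ i m e))

  linear-at : ∀ i k d d′ → Pendants i k → let open CycleNbrs (cycleNbrs 3≤3t i) in
    deg H (vertex (inj₁ a)) ≡ d → deg H (vertex (inj₁ b)) ≡ d′ → (2 + k) * (2 + k) + (d + d′ + k) + 1 ≡ 5 * (2 + k) →
    F H (vertex (inj₁ i)) + 1 ≡ 5 * deg H (vertex (inj₁ i))
  linear-at i k d d′ E da db e with at-cycle i k E
  ... | p , q = trans (cong₂ (λ d s → d * d + s + 1) p (trans q (cong₂ (λ d d′ → d + d′ + k) da db))) (trans e (cong (5 *_) (sym p)))

  pred-3* : ∀ {x} m → suc x ≡ 3 * m → ∃ λ l → x ≡ 2 + 3 * l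
  pred-3* (suc m) e = m , ℕP.suc-injective (trans e (ℕP.*-suc 3 m))

  linear : ∀ a → F H (vertex a) + 1 ≡ 5 * deg H (vertex a)
  linear (inj₂ s) = trans (cong (_+ 1) (trans (F-only (leaf-only s)) (cong suc (deg₀ (base s) (toℕ s) (toℕ-base s)))))
    (cong (5 *_) (sym (deg-only (leaf-only s))))
  linear (inj₁ i) with residue (toℕ i)
  -- As 3 divides the length, wrapping respects residues: the neighbours of residue 0 have residues
  -- 2 and 1, those of residue 1 have 0 and 2, those of residue 2 have 1 and 0. The numerals are the
  -- number of pendant vertices at `i` and the degrees of these two neighbours.
  ... | m , inj₁ e = linear-at i 1 2 2 (one-pendant i m e) (small-a before) (small-b after) refl
    where
    open CycleNbrs (cycleNbrs 3≤3t i)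
    small-a : suc (toℕ a) ≡ toℕ i ⊎ (toℕ i ≡ 0 × suc (toℕ a) ≡ 3 * t) → deg H (vertex (inj₁ a)) ≡ 2
    small-a (inj₁ p) = let l , q = pred-3* m (trans p e) in deg₂ a l q
    small-a (inj₂ (_ , p)) = let l , q = pred-3* t p in deg₂ a l q
    small-b : toℕ b ≡ suc (toℕ i) ⊎ (suc (toℕ i) ≡ 3 * t × toℕ b ≡ 0) → deg H (vertex (inj₁ b)) ≡ 2
    small-b (inj₁ p) = deg₁ b m (trans p (cong suc e))
    small-b (inj₂ (p , _)) = ⊥-elim (3∤1+3* t m (trans (sym p) (cong suc e)))
  ... | m , inj₂ (inj₁ e) = linear-at i 0 3 2 (none₁ i m e) (big-a before) (small-b after) refl
    where
    open CycleNbrs (cycleNbrs 3≤3t i)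
    big-a : suc (toℕ a) ≡ toℕ i ⊎ (toℕ i ≡ 0 × suc (toℕ a) ≡ 3 * t) → deg H (vertex (inj₁ a)) ≡ 3
    big-a (inj₁ p) = deg₀ a m (ℕP.suc-injective (trans p e))
    big-a (inj₂ (p , _)) = ⊥-elim (ℕP.0≢1+n (trans (sym p) e))
    small-b : toℕ b ≡ suc (toℕ i) ⊎ (suc (toℕ i) ≡ 3 * t × toℕ b ≡ 0) → deg H (vertex (inj₁ b)) ≡ 2
    small-b (inj₁ p) = deg₂ b m (trans p (cong suc e))
    small-b (inj₂ (p , _)) = ⊥-elim (3∤2+3* t m (trans (sym p) (cong suc e)))
  ... | m , inj₂ (inj₂ e) = linear-at i 0 2 3 (none₂ i m e) (small-a before) (big-b after) refl
    where
    open CycleNbrs (cycleNbrs 3≤3t i)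
    small-a : suc (toℕ a) ≡ toℕ i ⊎ (toℕ i ≡ 0 × suc (toℕ a) ≡ 3 * t) → deg H (vertex (inj₁ a)) ≡ 2
    small-a (inj₁ p) = deg₁ a m (ℕP.suc-injective (trans p e))
    small-a (inj₂ (p , _)) = ⊥-elim (ℕP.0≢1+n (trans (sym p) e))
    big-b : toℕ b ≡ suc (toℕ i) ⊎ (suc (toℕ i) ≡ 3 * t × toℕ b ≡ 0) → deg H (vertex (inj₁ b)) ≡ 3
    big-b (inj₁ p) = deg₀ b (suc m) (trans p (trans (cong suc e) (sym (ℕP.*-suc 3 m))))
    big-b (inj₂ (_ , p)) = deg₀ b 0 p

  linear-degrees : LinearDegrees H
  linear-degrees = record
    -- The three kinds of vertices give `(1, 4)`, `(2, 9)` and `(3, 14)`.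
    { A = 5 ; B = 1 ; linear = by-coord linear
    ; u₀ = vertex (inj₁ (base s₀)) ; v₀ = vertex (inj₂ s₀)
    ; irregular = λ e → ℕP.1+n≢0 (ℕP.suc-injective (trans (sym (deg₀ (base s₀) (toℕ s₀) (toℕ-base s₀))) (trans e (deg-only (leaf-only s₀))))) }
    where
    s₀ : Fin t
    s₀ = fromℕ< 1≤t

-- From collinearity to `G₁` or `G₂`.

module Classification {n} (G : Graph n) (simple : IsSimple G) (uni : Unicyclic G) (not-cycle : ¬ (G ≅ cycleGraph n)) (collinear : Collinear G) where

  S₀ : Skeleton G
  S₀ = Analysis.skeleton G simple uni

  open Skeleton S₀ using (dist; c; len; dist≡0)

  flat : ∀ v → dist v ≤ 1
  flat = Shape.shallow G simple S₀ collinear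

  pendant-exists : ∃ λ x → dist x ≡ 1
  pendant-exists with any? (λ v → dist v ℕP.≟ 1)
  ... | yes p = p
  ... | no none = ⊥-elim (not-cycle (CycleLabels.bare⇒cycle G simple S₀ λ v → ℕP.n<1⇒n≡0 (ℕP.≤∧≢⇒< (flat v) (λ e → none (v , e)))))

  module _ (i : ℕ) (x : Fin n) (dx : dist x ≡ 1) (x~ci : G x (c i) ≡ true) where

    S : Skeleton G
    S = rotate S₀ i

    x~c0 : G x (Skeleton.c S 0) ≡ true
    x~c0 = subst (λ j → G x (c j) ≡ true) (sym (ℕP.+-identityʳ i)) x~ci

    open Sun G simple S flat x dx x~c0
    open Decorate G simple S flat x dx x~c0

    classify : (∃₂ λ r k → 3 ≤ r × 1 ≤ k × G ≅ G₁ r k) ⊎ (∃ λ t → 1 ≤ t × G ≅ G₂ t)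
    classify with big-degree
    ... | k , e with Pattern.dichotomy collinear k e
    ...   | inj₁ big = inj₁ (3 + len , suc k , s≤s (s≤s (s≤s z≤n)) , s≤s z≤n , all-big⇒G₁ k big)
    ...   | inj₂ (t , r≡ , degs) = inj₂ (t , positive t r≡ , every-third⇒G₂ t r≡ degs)
      where
      positive : ∀ t → 3 + len ≡ 3 * t → 1 ≤ t
      positive (suc t) _ = s≤s z≤n

  classification : (∃₂ λ r k → 3 ≤ r × 1 ≤ k × G ≅ G₁ r k) ⊎ (∃ λ t → 1 ≤ t × G ≅ G₂ t)
  classification with pendant-exists
  ... | x , dx with Shape.top-only G simple S₀ x 0 dx (λ u _ → subst (dist u ≤_) (sym dx) (flat u))
  ...   | p , (x~p , _) , dp with dist≡0 p dp
  ...     | i , refl = classify i x dx x~p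

theorem10 : (ℝ : RealField) (n : ℕ) (G : Graph n) →
    IsSimple G → Unicyclic G → ¬ (G ≅ cycleGraph n) →
    HasExactlyTwoMainEigenvalues ℝ G ⇔
    ((∃₂ λ r k → 3 ≤ r × 1 ≤ k × G ≅ G₁ r k) ⊎ (∃ λ t → 1 ≤ t × G ≅ G₂ t))
theorem10 ℝ n G simple unicyclic not-cycle = mk⇔
  (λ two → Classification.classification G simple unicyclic not-cycle (two-main⇒collinear two))
  (λ { (inj₁ (r , k , 3≤r , 1≤k , iso)) → two-main (transport iso (G₁-degrees.linear-degrees r k 3≤r 1≤k))
     ; (inj₂ (t , 1≤t , iso)) → two-main (transport iso (G₂-degrees.linear-degrees t 1≤t)) })
  where
  open Signless ℝ G (IsSimple.symmetric simple)
  two-main : LinearDegrees G → HasExactlyTwoMainEigenvalues ℝ G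
  two-main L = linear⇒two-main A B linear u₀ v₀ irregular
    where open LinearDegrees L
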